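{- For any $k$, the function $\mathrm{csm}_k:\mathrm{Mat}_{n+1}\to\mathcal Z_k(\mathbb R^{n+1}/\mathbf 1)$ sending $M$ to $\mathrm{csm}_k(M)$ is a valuation under matroid polytope subdivisions: for every $M\in\mathrm{Mat}_{n+1}$ and every matroid polytope subdivision $\mathcal S$ of $Q=Q(M)$, $$\mathrm{csm}_k(M)=\sum_{F\in\mathrm{int}(\mathcal S)}(-1)^{\dim Q-\dim F}\,\mathrm{csm}_k(M_F).$$
   Context: $\mathrm{Mat}_{n+1}$ is the set of matroids on $E=\{0,\dots,n\}$. The matroid polytope of $M$ is $Q(M)=\mathrm{conv}\{\mathbf e_B: B\text{ a basis of }M\}\subseteq\mathbb R^{n+1}$, where $\mathbf e_B=\sum_{i\in B}\mathbf e_i$. A subdivision of a $D$-dimensional polytope $Q$ is a collection of $D$-dimensional polytopes $P_1,\dots,P_m$ with vertices among those of $Q$, whose union is $Q$, and such that any nonempty $P_i\cap P_j$ is a proper face of both; it is a matroid polytope subdivision if every $P_i$ is a matroid polytope. Faces of $\mathcal S$ are faces of the $P_i$; $\mathrm{int}(\mathcal S)$ is the set of faces of $\mathcal S$ not contained in the boundary of $Q$. Each such face $F$ is a matroid polytope, and $M_F$ denotes the matroid with $Q(M_F)=F$. $\mathcal Z_k(\mathbb R^{n+1}/\mathbf 1)$ is the group of $k$-dimensional fan tropical cycles in $\mathbb R^{n+1}/\mathbb R(1,\dots,1)$: balanced rational weighted pure $k$-dimensional fans modulo the equivalence identifying fans with the same support (union of nonzero-weight top cones) and agreeing weights on overlapping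 top cones; addition is union of supports with addition of weights. $\mathrm{csm}_k(M)$: for loopless $M$ of rank $d+1$, the $k$-skeleton of the Bergman fan $\mathcal B(M)$ (cones spanned by $\mathbf e_{F_1},\dots,\mathbf e_{F_k}$ modulo $\mathbf 1$ for chains of flats $\emptyset=F_0\subsetneq F_1\subsetneq\dots\subsetneq F_k\subsetneq F_{k+1}=E$) with weights $(-1)^{d-k}\prod_{i=0}^k\beta(M|F_{i+1}/F_i)$, where $\beta(N)=(-1)^{r(N)}\sum_F\mu(\emptyset,F)r(F)$ for loopless $N$ and $\beta(N)=0$ if $N$ has a loop; $\mathrm{csm}_k(M)=\emptyset$ (the zero cycle) if $M$ has a loop. -}

module Defs where

open import Data.Bool using (Bool; true; false; _∧_; _∨_; not; if_then_else_)
open import Data.Nat as N using (ℕ; zero; suc; _∸_; _⊔_)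
import Data.Integer as Z
import Data.Rational as Q
open import Data.Fin using (Fin)
open import Data.Fin.Subset as Sub
  using (Subset; ⁅_⁆; _∪_; _∩_; ∣_∣; ∁)
  renaming (⊥ to ∅ˢ; ⊤ to Eˢ)
open import Data.Vec as V using (Vec; lookup; _[_]≔_)
open import Data.List as L using (List; []; _∷_; filterᵇ; allFin; map; foldr; length)
open import Data.Bool.ListAction using (all; any)
open import Data.List.Relation.Unary.All using (All)
open import Data.List.Relation.Unary.Any using (Any)
open import Data.List.Relation.Unary.AllPairs using (AllPairs)
open import Data.Product using (Σ; ∃; _×_; _,_; proj₁; proj₂)
open import Function.Bundles using (_⇔_)
open import Relation.Binary.PropositionalEquality using (_≡_; _≢_)
open import Relation.Nullary using (¬_)

mem : ∀ {m} → Fin m → Subset m → Bool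
mem x A = lookup A x

allSubsets : ∀ m → List (Subset m)
allSubsets zero    = V.[] ∷ []
allSubsets (suc m) =
  map (false V.∷_) (allSubsets m) L.++ map (true V.∷_) (allSubsets m)

_⊆ᵇ_ : ∀ {m} → Subset m → Subset m → Bool
_⊆ᵇ_ {m} A B = all (λ x → not (mem x A) ∨ mem x B) (allFin m)

_≡ᵇ_ : ∀ {m} → Subset m → Subset m → Bool
A ≡ᵇ B = (A ⊆ᵇ B) ∧ (B ⊆ᵇ A)

_⊊ᵇ_ : ∀ {m} → Subset m → Subset m → Bool
A ⊊ᵇ B = (A ⊆ᵇ B) ∧ not (B ⊆ᵇ A)

_∖_ : ∀ {m} → Subset m → Subset m → Subset m
A ∖ B = A ∩ ∁ B

record Matroid (m : ℕ) : Set where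
  field
    isBasis  : Subset m → Bool
    nonempty : ∃ λ B → isBasis B ≡ true
    exchange : ∀ B₁ B₂ → isBasis B₁ ≡ true → isBasis B₂ ≡ true →
               ∀ x → mem x B₁ ≡ true → mem x B₂ ≡ false →
               ∃ λ y → mem y B₂ ≡ true × mem y B₁ ≡ false ×
                       isBasis ((B₁ [ x ]≔ false) [ y ]≔ true) ≡ true
open Matroid public

SameBases : ∀ {m} → Matroid m → Matroid m → Set
SameBases M N = ∀ B → isBasis M B ≡ isBasis N B

maxℕ : List ℕ → ℕ
maxℕ = foldr _⊔_ 0

rk : ∀ {m} → Matroid m → Subset m → ℕ
rk {m} M A = maxℕ (map (λ B → ∣ A ∩ B ∣) (filterᵇ (isBasis M) (allSubsets m)))

-- Matroid-like data (ground set S ⊆ Fin m, rank function ρ), used for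
-- minors M|F/G : ground set F ∖ G, rank ρ(A) = r_M(A ∪ G) - r_M(G).

RankData : ℕ → Set
RankData m = Subset m × (Subset m → ℕ)

loopyᵇ : ∀ {m} → RankData m → Bool
loopyᵇ {m} (S , ρ) = any (λ x → mem x S ∧ (ρ ⁅ x ⁆ N.≡ᵇ 0)) (allFin m)

isFlatᵇ : ∀ {m} → RankData m → Subset m → Bool
isFlatᵇ {m} (S , ρ) A =
  (A ⊆ᵇ S) ∧ all (λ x → not (mem x S ∧ not (mem x A)) ∨ (ρ A N.<ᵇ ρ (A ∪ ⁅ x ⁆))) (allFin m)

flats : ∀ {m} → RankData m → List (Subset m)
flats {m} N = filterᵇ (isFlatᵇ N) (allSubsets m)

sumℤ : List Z.ℤ → Z.ℤ
sumℤ = foldr Z._+_ Z.0ℤ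

prodℤ : List Z.ℤ → Z.ℤ
prodℤ = foldr Z._*_ Z.1ℤ

sgn : ℕ → Z.ℤ
sgn zero    = Z.1ℤ
sgn (suc k) = Z.- sgn k

-- Möbius function μ(∅, F) of the lattice of flats, by the recursion
-- μ(∅,∅) = 1,  μ(∅,F) = - Σ_{∅ ⊆ Z ⊊ F, Z flat} μ(∅,Z),
-- computed with a fuel parameter (fuel ≥ m+1 is always sufficient,
-- since a strict chain of subsets of Fin m has at most m+1 members).
μ₀ : ∀ {m} → ℕ → RankData m → Subset m → Z.ℤ
μ₀ zero     N F = Z.0ℤ
μ₀ (suc f) N F =
  if F ≡ᵇ ∅ˢ then Z.1ℤ
  else Z.- sumℤ (map (μ₀ f N) (filterᵇ (λ Z → Z ⊊ᵇ F) (flats N)))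

β : ∀ {m} → RankData m → Z.ℤ
β {m} (S , ρ) =
  if loopyᵇ (S , ρ) then Z.0ℤ
  else sgn (ρ S) Z.* sumℤ (map (λ F → μ₀ (suc m) (S , ρ) F Z.* Z.+ (ρ F)) (flats (S , ρ)))

minor : ∀ {m} → Matroid m → Subset m → Subset m → RankData m
minor M F G = (F ∖ G , λ A → rk M (A ∪ G) ∸ rk M G)

asRankData : ∀ {m} → Matroid m → RankData m
asRankData M = (Eˢ , rk M)

-- csm_k(M), represented as a weight function on k-chains.
-- The cone spanned by e_{F_1},...,e_{F_k} (mod 1) for a chain
-- ∅ ⊊ F_1 ⊊ ... ⊊ F_k ⊊ E is a cone of the braid fan, determined by the
-- chain; every csm_k(M) is supported on such cones, so a cycle is the
-- weight it assigns to each chain (vector (F_1,...,F_k)); weight 0 = not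
-- in the support.

consecPairs : ∀ {A : Set} → List A → List (A × A)
consecPairs []           = []
consecPairs (x ∷ [])     = []
consecPairs (x ∷ y ∷ xs) = (x , y) ∷ consecPairs (y ∷ xs)

fullChain : ∀ {m k} → Vec (Subset m) k → List (Subset m)
fullChain c = ∅ˢ ∷ (V.toList c L.++ (Eˢ ∷ []))

isFlagOfFlatsᵇ : ∀ {m k} → Matroid m → Vec (Subset m) k → Bool
isFlagOfFlatsᵇ M c =
  all (λ p → proj₁ p ⊊ᵇ proj₂ p) (consecPairs (fullChain c))
  ∧ all (isFlatᵇ (asRankData M)) (V.toList c)

-- weight of csm_k(M) on the cone of the chain c
-- (-1)^{d-k} with d = r(M) - 1 is computed as (-1)^{d+k} (same parity)
csm : ∀ {m} (k : ℕ) → Matroid m → Vec (Subset m) k → Z.ℤ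
csm k M c =
  if loopyᵇ (asRankData M) then Z.0ℤ
  else if isFlagOfFlatsᵇ M c
       then sgn ((rk M Eˢ ∸ 1) N.+ k) Z.*
            prodℤ (map (λ p → β (minor M (proj₂ p) (proj₁ p))) (consecPairs (fullChain c)))
       else Z.0ℤ

-- Polytopes with 0/1 vertices.  Points are rational (all polytopes here
-- are rational, so their rational points are dense in them).

Point : ℕ → Set
Point m = Fin m → Q.ℚ

e : ∀ {m} → Subset m → Point m
e B i = if mem i B then Q.1ℚ else Q.0ℚ

sumℚ : List Q.ℚ → Q.ℚ
sumℚ = foldr Q._+_ Q.0ℚ

-- a set of vertices, given as a predicate on subsets B (vertex e_B)
VSet : ℕ → Set₁
VSet m = Subset m → Set

basesOf : ∀ {m} → Matroid m → VSet m
basesOf M B = isBasis M B ≡ true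

InConv : ∀ {m} → VSet m → Point m → Set
InConv {m} V p = Σ (Subset m → Q.ℚ) λ c →
  (∀ B → c B ≢ Q.0ℚ → V B) ×
  (∀ B → Q.0ℚ Q.≤ c B) ×
  (sumℚ (map c (allSubsets m)) ≡ Q.1ℚ) ×
  (∀ i → sumℚ (map (λ B → c B Q.* e B i) (allSubsets m)) ≡ p i)

_·e_ : ∀ {m} → Point m → Subset m → Q.ℚ
_·e_ {m} w B = sumℚ (map (λ i → w i Q.* e B i) (allFin m))

ArgMax : ∀ {m} → Point m → VSet m → VSet m
ArgMax w V B = V B × (∀ B' → V B' → (w ·e B') Q.≤ (w ·e B))

IsFaceOf : ∀ {m} → VSet m → VSet m → Set
IsFaceOf {m} V W = Σ (Point m) λ w → ∀ B → W B ⇔ ArgMax w V B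

IsProperFaceOf : ∀ {m} → VSet m → VSet m → Set
IsProperFaceOf V W = IsFaceOf V W × ∃ λ B → V B × ¬ W B

sumFin : ∀ r → (Fin r → Q.ℚ) → Q.ℚ
sumFin r f = sumℚ (map f (allFin r))

AffIndep : ∀ {m r} → Vec (Subset m) r → Set
AffIndep {m} {r} vs = ∀ (c : Fin r → Q.ℚ) →
  sumFin r c ≡ Q.0ℚ →
  (∀ i → sumFin r (λ j → c j Q.* e (lookup vs j) i) ≡ Q.0ℚ) →
  ∀ j → c j ≡ Q.0ℚ

IsDim : ∀ {m} → VSet m → ℕ → Set
IsDim {m} V d =
  (∃ λ (vs : Vec (Subset m) (suc d)) → (∀ j → V (lookup vs j)) × AffIndep vs) ×
  (∀ (vs : Vec (Subset m) (suc (suc d))) → (∀ j → V (lookup vs j)) → ¬ AffIndep vs)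

IsMatroidSubdivision : ∀ {m} → Matroid m → List (Matroid m) → Set₁
IsMatroidSubdivision {m} M S =
  (∃ λ D → IsDim (basesOf M) D × All (λ N → IsDim (basesOf N) D) S) ×
  All (λ N → ∀ B → basesOf N B → basesOf M B) S ×
  (∀ p → InConv (basesOf M) p → Any (λ N → InConv (basesOf N) p) S) ×
  (∀ (i j : Fin (length S)) → i ≢ j →
     let Pi = basesOf (L.lookup S i) ; Pj = basesOf (L.lookup S j) in
     (∃ λ p → InConv Pi p × InConv Pj p) →
     Σ (VSet m) λ W →
       IsProperFaceOf Pi W × IsProperFaceOf Pj W ×
       (∀ p → InConv W p ⇔ (InConv Pi p × InConv Pj p)))

InBoundary : ∀ {m} → Matroid m → VSet m → Set₁
InBoundary {m} M W = ∀ p → InConv W p →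
  Σ (VSet m) λ G → IsProperFaceOf (basesOf M) G × InConv G p

InInt : ∀ {m} → Matroid m → List (Matroid m) → Matroid m → Set₁
InInt M S N =
  Any (λ P → IsFaceOf (basesOf P) (basesOf N)) S × ¬ InBoundary M (basesOf N)

EnumeratesInt : ∀ {m} → Matroid m → List (Matroid m) → List (Matroid m × ℕ) → Set₁
EnumeratesInt M S Ls =
  All (λ q → InInt M S (proj₁ q) × IsDim (basesOf (proj₁ q)) (proj₂ q)) Ls ×
  (∀ N → InInt M S N → Any (λ q → SameBases N (proj₁ q)) Ls) ×
  AllPairs (λ q q' → ¬ SameBases (proj₁ q) (proj₁ q')) Ls

{-# OPTIONS --safe #-}
module Submission where

-- For loopless M one has β(M) = (-1)^r(M) Σ_A (-1)^|A| r(A).  A loop of M, or a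
-- point witnessing that some Fᵢ is not a flat, is a loop of one of the minors
-- M|Fᵢ₊₁/Fᵢ and makes its signed sum vanish, so on a fixed chain the weight of
-- csm_k(M) is, up to a sign that depends only on the rank,
-- Πᵢ Σ (-1)^|A| r(A ∪ Fᵢ), summed over A ⊆ Fᵢ₊₁ ∖ Fᵢ.  Writing
-- r(A) = Σₐ [a < r(A)] leaves the functions M ↦ Πᵢ [aᵢ < r(Aᵢ)] for chains of
-- sets Aᵢ.  A single basis attains all the ranks of a chain, hence this
-- indicator tells whether the relative interior of Q(M) meets the open set
-- { x(Aᵢ) > aᵢ for all i }.  The relative interiors of the faces in int(S)
-- partition the relative interior of Q, and the theorem becomes the additivity
-- of the compactly supported Euler characteristic: (-1)^dim for a nonempty
-- relatively open convex set, 0 for the empty one.  Additivity follows by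
-- cutting with the hyperplanes that describe the cells, one at a time, until
-- every piece lies in a single face.  The conclusion is an equality of
-- integers, so finitely many classical case distinctions are harmless.

open import Defs
open import Data.Bool using (Bool; true; false; _∧_; _∨_; not; if_then_else_)
open import Data.Bool.Properties using (T-≡)
open import Data.Empty using (⊥; ⊥-elim)
open import Data.Fin using (Fin; zero; suc; toℕ)
import Data.Fin.Properties as F
open import Data.Fin.Subset using (Subset; ⁅_⁆; _∪_; _∩_; ∣_∣; ∁) renaming (⊥ to ∅ˢ; ⊤ to Eˢ)
open import Data.List as L using (List; []; _∷_; _++_; map; filter; filterᵇ; length; allFin)
import Data.List.Properties as L
open import Data.List.Membership.Propositional using (_∈_)
open import Data.List.Membership.Propositional.Properties
open import Data.List.Relation.Unary.All as All using (All; []; _∷_)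
open import Data.List.Relation.Unary.AllPairs using (AllPairs; []; _∷_)
open import Data.List.Relation.Unary.Any using (Any; here; there)
open import Data.Nat as ℕ using (ℕ; zero; suc; _∸_)
import Data.Nat.Properties as ℕ
open import Data.Product using (∃; _×_; _,_; proj₁; proj₂)
open import Data.Sum using (_⊎_; inj₁; inj₂)
open import Data.Unit using (⊤; tt)
open import Data.Vec as V using (Vec; []; _∷_; lookup; _[_]≔_; tabulate)
open import Function using (_∘_; id)
open import Function.Bundles using (mk⇔; Equivalence)
open import Relation.Binary using (tri<; tri≈; tri>)
open import Relation.Binary.PropositionalEquality
open import Relation.Nullary using (¬_; Dec; yes; no; does)

-- The operations are made opaque because unification would otherwise try to
-- invert their definitions by pattern matching on fractions.

-- The faces in int(S) need not share the loops or the flats of M, so the case distinctions in `csm`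
-- cannot be summed over the subdivision as they stand. The signed sums over all subsets absorb
-- them: they vanish by themselves in the degenerate cases and refer to the matroid through its
-- ranks alone. Rank indicators may be multiplied because the sets involved are nested: A ∪ Fᵢ
-- contains the sets of all earlier steps and lies in Fᵢ₊₁. Open half-spaces make the signs right:
-- they either miss a relatively open convex set or preserve its dimension, so the Euler
-- characteristic is (-1)^dim times the indicator, and multiplication by (-1)^dim Q gives the
-- exponents of the theorem. No topology enters: a relatively open convex set carries its dimension
-- as the length of a basis of its span, and additivity has to be known for one hyperplane only.
-- Matroid theory returns at one point of the geometry: the minimal face of a cell around a point
-- has to be presented as a matroid, and this takes symmetric basis exchange.

module OpaqueRational where

  open import Data.Rational using (ℚ; 0ℚ; 1ℚ; _≤_; _<_; 1/_; ≢-nonZero; positive; nonNegative)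
  import Data.Rational as Q
  import Data.Rational.Properties as Q
  open import Algebra.Bundles using (CommutativeRing)
  open import Algebra.Structures using (IsCommutativeRing)
  import Algebra.Solver.Ring as Solver
  open import Algebra.Solver.Ring.AlmostCommutativeRing
  open import Data.Maybe using (Maybe; just; nothing)
  open import Level using (0ℓ)

  infixl 7 _*_
  infixl 6 _+_ _-_
  infix 8 -_

  opaque

    _+_ _*_ : ℚ → ℚ → ℚ
    _+_ = Q._+_
    _*_ = Q._*_

    -_ : ℚ → ℚ
    -_ = Q.-_

  _-_ : ℚ → ℚ → ℚ
  p - q = p + - q

  opaque
    unfolding _+_ _*_ -_

    isCommutativeRing : IsCommutativeRing _≡_ _+_ _*_ -_ 0ℚ 1ℚ
    isCommutativeRing = Q.+-*-isCommutativeRing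

    +-unfold : ∀ p q → p + q ≡ p Q.+ q
    +-unfold _ _ = refl

    *-unfold : ∀ p q → p * q ≡ p Q.* q
    *-unfold _ _ = refl

    neg-unfold : ∀ p → - p ≡ Q.- p
    neg-unfold _ = refl

    +-mono-≤ : ∀ {p q r s} → p ≤ q → r ≤ s → p + r ≤ q + s
    +-mono-≤ = Q.+-mono-≤

    +-mono-< : ∀ {p q r s} → p < q → r < s → p + r < q + s
    +-mono-< = Q.+-mono-<

    +-monoˡ-≤ : ∀ r {p q} → p ≤ q → p + r ≤ q + r
    +-monoˡ-≤ = Q.+-monoˡ-≤

    +-monoʳ-≤ : ∀ r {p q} → p ≤ q → r + p ≤ r + q
    +-monoʳ-≤ = Q.+-monoʳ-≤

    +-monoˡ-< : ∀ r {p q} → p < q → p + r < q + r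
    +-monoˡ-< = Q.+-monoˡ-<

    *-monoˡ-≤ : ∀ {r p q} → 0ℚ ≤ r → p ≤ q → r * p ≤ r * q
    *-monoˡ-≤ {r} h = Q.*-monoˡ-≤-nonNeg r {{nonNegative h}}

    *-monoʳ-≤ : ∀ {r p q} → 0ℚ ≤ r → p ≤ q → p * r ≤ q * r
    *-monoʳ-≤ {r} h = Q.*-monoʳ-≤-nonNeg r {{nonNegative h}}

    *-monoˡ-< : ∀ {r p q} → 0ℚ < r → p < q → r * p < r * q
    *-monoˡ-< {r} h = Q.*-monoʳ-<-pos r {{positive h}}

    *-monoʳ-< : ∀ {r p q} → 0ℚ < r → p < q → p * r < q * r
    *-monoʳ-< {r} h = Q.*-monoˡ-<-pos r {{positive h}}

    *-cancelˡ-≤ : ∀ {r p q} → 0ℚ < r → r * p ≤ r * q → p ≤ q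
    *-cancelˡ-≤ {r} h = Q.*-cancelˡ-≤-pos r {{positive h}}

    *-cancelˡ-< : ∀ {r p q} → 0ℚ < r → r * p < r * q → p < q
    *-cancelˡ-< {r} h = Q.*-cancelˡ-<-nonNeg r {{nonNegative (Q.<⇒≤ h)}}

    neg-antimono-≤ : ∀ {p q} → p ≤ q → - q ≤ - p
    neg-antimono-≤ = Q.neg-antimono-≤

    neg⇒pos : ∀ {p} → p < 0ℚ → 0ℚ < - p
    neg⇒pos h = Q.neg-antimono-< h

    pos⇒neg : ∀ {p} → 0ℚ < p → - p < 0ℚ
    pos⇒neg h = Q.neg-antimono-< h

    inv : ∀ p → p ≢ 0ℚ → ℚ
    inv p h = 1/_ p {{≢-nonZero h}}

    inv-* : ∀ p (h : p ≢ 0ℚ) → inv p h * p ≡ 1ℚ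
    inv-* p h = Q.*-inverseˡ p {{≢-nonZero h}}

  commutativeRing : CommutativeRing 0ℓ 0ℓ
  commutativeRing = record { isCommutativeRing = isCommutativeRing }

  open CommutativeRing commutativeRing public
    using (+-identityˡ; +-identityʳ; *-identityˡ; *-identityʳ; *-comm; *-assoc)
    renaming (zeroˡ to *-zeroˡ; zeroʳ to *-zeroʳ; -‿inverseʳ to +-inverseʳ)

  -- Coefficients are taken in the transparent rationals, where they can be evaluated and compared,
  -- while the identities are proved for the opaque operations. The homomorphism between the two is
  -- the identity on elements.
  fromLiteral : AlmostCommutativeRing.rawRing (fromCommutativeRing Q.+-*-commutativeRing)
                  -Raw-AlmostCommutative⟶ fromCommutativeRing commutativeRing
  fromLiteral = record
    { ⟦_⟧ = λ p → p ; +-homo = λ p q → sym (+-unfold p q) ; *-homo = λ p q → sym (*-unfold p q)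
    ; -‿homo = λ p → sym (neg-unfold p) ; 0-homo = refl ; 1-homo = refl }

  decideEq : (p q : ℚ) → Maybe (p ≡ q)
  decideEq p q with p Q.≟ q
  ... | yes e = just e
  ... | no _  = nothing

  open Solver (AlmostCommutativeRing.rawRing (fromCommutativeRing Q.+-*-commutativeRing))
    (fromCommutativeRing commutativeRing) fromLiteral decideEq public
    using (solve; con; _:+_; _:*_; _:-_; :-_; _:=_)

-- Linear algebra and finitely generated cones over the rationals.

module Cones where

  open import Data.Rational using (ℚ; 0ℚ; 1ℚ; _≤_; _<_; _≤?_; _<?_)
  open import Data.Rational.Properties using (_≟_; ≤-refl; ≤-trans; ≤-reflexive; ≤-antisym; ≤-total; <⇒≤; <-irrefl; <-≤-trans; <-cmp; <-dense; ≰⇒>; positive⁻¹)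
  open OpaqueRational
  open import Data.List.Relation.Binary.Pointwise using (Pointwise; []; _∷_)

  infix 4 _≐_
  infixl 6 _⊕_
  infixl 7 _⊙_
  infixl 8 _∙_

  _≐_ : ∀ {n} → Point n → Point n → Set
  x ≐ y = ∀ i → x i ≡ y i

  tl : ∀ {n} → Point (suc n) → Point n
  tl x i = x (suc i)

  𝟎 : ∀ {n} → Point n
  𝟎 _ = 0ℚ

  _⊕_ : ∀ {n} → Point n → Point n → Point n
  (x ⊕ y) i = x i + y i

  _⊙_ : ∀ {n} → ℚ → Point n → Point n
  (t ⊙ x) i = t * x i

  infix 6 _-[_]_
  _-[_]_ : ∀ {n} → Point n → ℚ → Point n → Point n
  (x -[ t ] g) i = x i - t * g i

  opaque

    _∙_ : ∀ {n} → Point n → Point n → ℚ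
    _∙_ {zero}  a x = 0ℚ
    _∙_ {suc n} a x = a zero * x zero + (tl a) ∙ (tl x)

    ∙-cong : ∀ {n} {a b x y : Point n} → a ≐ b → x ≐ y → a ∙ x ≡ b ∙ y
    ∙-cong {zero}  p q = refl
    ∙-cong {suc n} p q = cong₂ _+_ (cong₂ _*_ (p zero) (q zero)) (∙-cong (λ i → p (suc i)) (λ i → q (suc i)))

  ∙-congʳ : ∀ {n} (a : Point n) {x y} → x ≐ y → a ∙ x ≡ a ∙ y
  ∙-congʳ a = ∙-cong (λ _ → refl)

  opaque
    unfolding _∙_

    ∙-comm : ∀ {n} (a x : Point n) → a ∙ x ≡ x ∙ a
    ∙-comm {zero}  a x = refl
    ∙-comm {suc n} a x = cong₂ _+_ (*-comm (a zero) (x zero)) (∙-comm (tl a) (tl x))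

    ∙-linear : ∀ {n} (a x y : Point n) s t → a ∙ (s ⊙ x ⊕ t ⊙ y) ≡ s * (a ∙ x) + t * (a ∙ y)
    ∙-linear {zero}  a x y s t = solve 2 (λ s t → con 0ℚ := s :* con 0ℚ :+ t :* con 0ℚ) refl s t
    ∙-linear {suc n} a x y s t = trans (cong (a zero * (s * x zero + t * y zero) +_) (∙-linear (tl a) (tl x) (tl y) s t))
      (solve 7 (λ a x y s t p q → a :* (s :* x :+ t :* y) :+ (s :* p :+ t :* q) := s :* (a :* x :+ p) :+ t :* (a :* y :+ q)) refl
        (a zero) (x zero) (y zero) s t _ _)

  ∙-⊕ : ∀ {n} (a x y : Point n) → a ∙ (x ⊕ y) ≡ a ∙ x + a ∙ y
  ∙-⊕ a x y = trans (∙-congʳ a (λ i → solve 2 (λ x y → x :+ y := con 1ℚ :* x :+ con 1ℚ :* y) refl (x i) (y i)))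
    (trans (∙-linear a x y 1ℚ 1ℚ) (cong₂ _+_ (*-identityˡ _) (*-identityˡ _)))

  ∙-⊙ : ∀ {n} (a x : Point n) t → a ∙ (t ⊙ x) ≡ t * (a ∙ x)
  ∙-⊙ a x t = trans (∙-congʳ a (λ i → solve 2 (λ x t → t :* x := t :* x :+ con 0ℚ :* x) refl (x i) t))
    (trans (∙-linear a x x t 0ℚ) (solve 2 (λ p t → t :* p :+ con 0ℚ :* p := t :* p) refl (a ∙ x) t))

  ∙-sub : ∀ {n} (a x : Point n) t g → a ∙ (x -[ t ] g) ≡ a ∙ x - t * (a ∙ g)
  ∙-sub a x t g = trans (∙-congʳ a (λ i → solve 3 (λ x t g → x :- t :* g := con 1ℚ :* x :+ (:- t) :* g) refl (x i) t (g i)))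
    (trans (∙-linear a x g 1ℚ (- t)) (solve 3 (λ x t g → con 1ℚ :* x :+ (:- t) :* g := x :- t :* g) refl (a ∙ x) t (a ∙ g)))

  opaque
    unfolding _∙_

    ∙-suc : ∀ {n} (a x : Point (suc n)) → a ∙ x ≡ a zero * x zero + (tl a) ∙ (tl x)
    ∙-suc a x = refl

    ∙-𝟎 : ∀ {n} (a : Point n) → a ∙ 𝟎 ≡ 0ℚ
    ∙-𝟎 {zero} a = refl
    ∙-𝟎 {suc n} a = trans (cong₂ _+_ (*-zeroʳ (a zero)) (∙-𝟎 (tl a))) (+-identityʳ 0ℚ)

  𝟎-∙ : ∀ {n} (a : Point n) → 𝟎 ∙ a ≡ 0ℚ
  𝟎-∙ a = trans (∙-comm 𝟎 a) (∙-𝟎 a)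

  opp : ∀ {n} → Point n → Point n
  opp a i = - a i

  opaque
    unfolding _∙_

    opp-∙ : ∀ {n} (a x : Point n) → opp a ∙ x ≡ - (a ∙ x)
    opp-∙ {zero}  a x = solve 0 (con 0ℚ := :- con 0ℚ) refl
    opp-∙ {suc n} a x = trans (cong (- a zero * x zero +_) (opp-∙ (tl a) (tl x)))
       (solve 3 (λ a x p → (:- a) :* x :+ (:- p) := :- (a :* x :+ p)) refl (a zero) (x zero) _)

  0<* : ∀ {p q} → 0ℚ < p → 0ℚ < q → 0ℚ < p * q
  0<* {p} {q} hp hq = subst (_< p * q) (*-zeroʳ p) (*-monoˡ-< hp hq)

  0≤+ : ∀ {p q} → 0ℚ ≤ p → 0ℚ ≤ q → 0ℚ ≤ p + q
  0≤+ {p} {q} hp hq = subst (_≤ p + q) (+-identityʳ 0ℚ) (+-mono-≤ hp hq)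

  0<+ : ∀ {p q} → 0ℚ < p → 0ℚ < q → 0ℚ < p + q
  0<+ {p} {q} hp hq = subst (_< p + q) (+-identityʳ 0ℚ) (+-mono-< hp hq)

  nonpos-+ : ∀ {p q} → p ≤ 0ℚ → q ≤ 0ℚ → p + q ≤ 0ℚ
  nonpos-+ {p} {q} hp hq = subst (p + q ≤_) (+-identityʳ 0ℚ) (+-mono-≤ hp hq)

  ≤⇒0≤- : ∀ {p q} → p ≤ q → 0ℚ ≤ q - p
  ≤⇒0≤- {p} {q} h = subst (_≤ q - p) (+-inverseʳ p) (+-monoˡ-≤ (- p) h)

  <⇒0<- : ∀ {p q} → p < q → 0ℚ < q - p
  <⇒0<- {p} {q} h = subst (_< q - p) (+-inverseʳ p) (+-monoˡ-< (- p) h)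

  0<-⇒< : ∀ {p q} → 0ℚ < q - p → p < q
  0<-⇒< {p} {q} h = subst₂ _<_ (+-identityˡ p) (solve 2 (λ p q → (q :- p) :+ p := q) refl p q) (+-monoˡ-< p h)

  pos⇒≢0 : ∀ {p} → 0ℚ < p → p ≢ 0ℚ
  pos⇒≢0 h refl = <-irrefl refl h

  nonpos⇒0≤ : ∀ {p} → p ≤ 0ℚ → 0ℚ ≤ - p
  nonpos⇒0≤ {p} h = subst (0ℚ ≤_) (+-identityˡ (- p)) (≤⇒0≤- h)

  0<1 : 0ℚ < 1ℚ
  0<1 = positive⁻¹ 1ℚ

  0<inv : ∀ {p} (h : 0ℚ < p) → 0ℚ < inv p (pos⇒≢0 h)
  0<inv {p} h = *-cancelˡ-< h (subst₂ _<_ (sym (*-zeroʳ p)) (trans (sym (inv-* p _)) (*-comm _ p)) 0<1)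

  quotient : ∀ p (h : p ≢ 0ℚ) q → q * inv p h * p ≡ q
  quotient p h q = trans (*-assoc q _ p) (trans (cong (q *_) (inv-* p h)) (*-identityʳ q))

  *-zero-product : ∀ {p q} → p ≢ 0ℚ → p * q ≡ 0ℚ → q ≡ 0ℚ
  *-zero-product {p} {q} h e = trans (sym (*-identityˡ q)) (trans (cong (_* q) (sym (inv-* p h)))
    (trans (*-assoc _ p q) (trans (cong (inv p h *_) e) (*-zeroʳ (inv p h)))))

  sum-nonpos-zero : ∀ {p q} → p ≤ 0ℚ → q ≤ 0ℚ → p + q ≡ 0ℚ → p ≡ 0ℚ × q ≡ 0ℚ
  sum-nonpos-zero {p} {q} hp hq e =
      ≤-antisym hp (subst₂ _≤_ e (+-identityʳ p) (+-monoʳ-≤ p hq))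
    , ≤-antisym hq (subst₂ _≤_ e (+-identityˡ q) (+-monoˡ-≤ q hp))

  *-nonneg-nonpos : ∀ {p q} → 0ℚ ≤ p → q ≤ 0ℚ → p * q ≤ 0ℚ
  *-nonneg-nonpos {p} {q} hp hq = subst (p * q ≤_) (*-zeroʳ p) (*-monoˡ-≤ hp hq)

  -- Replaces limits: the property holds for all sufficiently small positive δ. Unlike the mere
  -- existence of some δ, this passes to finite conjunctions.
  Small : (ℚ → Set) → Set
  Small P = ∃ λ ε → 0ℚ < ε × (∀ δ → 0ℚ < δ → δ ≤ ε → P δ)

  small-map : ∀ {P Q : ℚ → Set} → (∀ δ → 0ℚ < δ → P δ → Q δ) → Small P → Small Q
  small-map f (ε , h , p) = ε , h , λ δ h₁ h₂ → f δ h₁ (p δ h₁ h₂)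

  small-× : ∀ {P Q : ℚ → Set} → Small P → Small Q → Small (λ δ → P δ × Q δ)
  small-× (ε , h , p) (ε′ , h′ , p′) with ≤-total ε ε′
  ... | inj₁ l = ε  , h  , λ δ h₁ h₂ → p δ h₁ h₂ , p′ δ h₁ (≤-trans h₂ l)
  ... | inj₂ l = ε′ , h′ , λ δ h₁ h₂ → p δ h₁ (≤-trans h₂ l) , p′ δ h₁ h₂

  small-all : ∀ {A : Set} {P : A → ℚ → Set} xs → All (λ x → Small (P x)) xs →
              Small (λ δ → All (λ x → P x δ) xs)
  small-all []       []       = 1ℚ , 0<1 , λ _ _ _ → []
  small-all (x ∷ xs) (p ∷ ps) = small-map (λ _ _ (q , qs) → q ∷ qs) (small-× p (small-all xs ps))

  small-witness : ∀ {P : ℚ → Set} → Small P → ∃ λ δ → 0ℚ < δ × P δ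
  small-witness (ε , h , p) = ε , h , p ε h ≤-refl

  small-pos : ∀ p q → 0ℚ < p → Small (λ δ → 0ℚ < p + δ * q)
  small-pos p q hp with <-cmp q 0ℚ
  ... | tri≈ _ refl _ = 1ℚ , 0<1 , λ δ _ _ → subst (0ℚ <_) (solve 2 (λ p δ → p := p :+ δ :* con 0ℚ) refl p δ) hp
  ... | tri> _ _ hq   = 1ℚ , 0<1 , λ δ hδ _ → 0<+ hp (0<* hδ hq)
  -- Here p + δq decreases in δ and has the root p/(-q); any ε strictly between 0 and this root will
  -- do.
  ... | tri< hq _ _   with <-dense (0<* hp (0<inv (neg⇒pos hq)))
  ... | ε , 0<ε , ε<  = ε , 0<ε , λ δ hδ hδε → <-≤-trans
          (subst (0ℚ <_) (solve 3 (λ p ε q → p :- ε :* (:- q) := p :+ ε :* q) refl p ε q)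
             (<⇒0<- (subst (ε * - q <_) (quotient (- q) _ p) (*-monoʳ-< (neg⇒pos hq) ε<))))
          (+-monoʳ-≤ p (subst₂ _≤_ (solve 2 (λ ε q → (:- q) :* (:- ε) := ε :* q) refl ε q) (solve 2 (λ ε q → (:- q) :* (:- ε) := ε :* q) refl δ q)
             (*-monoˡ-≤ (<⇒≤ (neg⇒pos hq)) (neg-antimono-≤ hδε))))

  -- One coefficient is peeled off per generator, so that cones, their relative interiors and linear
  -- spans differ only in the condition `P` on the coefficients and share their closure properties.
  Comb : ∀ {n} → (ℚ → Set) → List (Point n) → Point n → Set
  Comb P []       x = x ≐ 𝟎
  Comb P (g ∷ gs) x = ∃ λ t → P t × Comb P gs (x -[ t ] g)

  -- Pos gs is the relative interior of Cone gs.
  Cone Pos Span : ∀ {n} → List (Point n) → Point n → Set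
  Cone = Comb (0ℚ ≤_)
  Pos  = Comb (0ℚ <_)
  Span = Comb (λ _ → ⊤)

  module _ {n : ℕ} {P : ℚ → Set} where

    comb-resp : ∀ (gs : List (Point n)) {x y} → x ≐ y → Comb P gs x → Comb P gs y
    comb-resp []       e h           i = trans (sym (e i)) (h i)
    comb-resp (g ∷ gs) e (t , p , h) = t , p , comb-resp gs (λ i → cong (_- t * g i) (e i)) h

    comb-respˡ : ∀ {gs gs′ : List (Point n)} {x} → Pointwise _≐_ gs gs′ → Comb P gs x → Comb P gs′ x
    comb-respˡ []       h           = h
    comb-respˡ {g ∷ gs} {g′ ∷ gs′} {x} (e ∷ es) (t , p , h) =
      t , p , comb-resp gs′ (λ i → cong (λ z → x i - t * z) (e i)) (comb-respˡ es h)

    comb-weaken : ∀ {Q : ℚ → Set} → (∀ {t} → P t → Q t) → ∀ (gs : List (Point n)) {x} → Comb P gs x → Comb Q gs x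
    comb-weaken f []       h           = h
    comb-weaken f (g ∷ gs) (t , p , h) = t , f p , comb-weaken f gs h

    comb-0 : P 0ℚ → ∀ (gs : List (Point n)) {x} → x ≐ 𝟎 → Comb P gs x
    comb-0 p []       h = h
    comb-0 p (g ∷ gs) h = 0ℚ , p , comb-0 p gs (λ i → trans (solve 2 (λ x g → x :- con 0ℚ :* g := x) refl _ (g i)) (h i))

    comb-scale : ∀ {Q : ℚ → Set} s → (∀ {t} → P t → Q (s * t)) → ∀ (gs : List (Point n)) {x} → Comb P gs x → Comb Q gs (s ⊙ x)
    comb-scale s f []       h i         = trans (cong (s *_) (h i)) (*-zeroʳ s)
    comb-scale s f (g ∷ gs) {x} (t , p , h) = s * t , f p ,
      comb-resp′ gs (λ i → solve 4 (λ s x t g → s :* (x :- t :* g) := s :* x :- s :* t :* g) refl s (x i) t (g i)) (comb-scale s f gs h)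
      where
      comb-resp′ : ∀ {Q : ℚ → Set} (gs : List (Point n)) {x y} → x ≐ y → Comb Q gs x → Comb Q gs y
      comb-resp′ []       e h           i = trans (sym (e i)) (h i)
      comb-resp′ (g ∷ gs) e (t , p , h) = t , p , comb-resp′ gs (λ i → cong (_- t * g i) (e i)) h

  comb-⊕ : ∀ {n} {P Q R : ℚ → Set} → (∀ {s t} → P s → Q t → R (s + t)) → ∀ (gs : List (Point n)) {x y} →
           Comb P gs x → Comb Q gs y → Comb R gs (x ⊕ y)
  comb-⊕ f []       h k i = trans (cong₂ _+_ (h i) (k i)) (+-identityʳ 0ℚ)
  comb-⊕ f (g ∷ gs) {x} {y} (s , p , h) (t , q , k) = s + t , f p q ,
    comb-resp gs (λ i → solve 5 (λ x s y t g → (x :- s :* g) :+ (y :- t :* g) := (x :+ y) :- (s :+ t) :* g) refl (x i) s (y i) t (g i))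
      (comb-⊕ f gs h k)

  record Linear {n k} (T : Point n → Point k) : Set where
    field
      T-resp : ∀ {x y} → x ≐ y → T x ≐ T y
      T-𝟎    : T 𝟎 ≐ 𝟎
      T-sub  : ∀ x t g → T (x -[ t ] g) ≐ T x -[ t ] T g
  open Linear

  comb-map : ∀ {n k} {P} {T : Point n → Point k} → Linear T → ∀ gs {x} → Comb P gs x → Comb P (map T gs) (T x)
  comb-map L []       h i = trans (T-resp L h i) (T-𝟎 L i)
  comb-map L (g ∷ gs) (t , p , h) = t , p , comb-resp (map _ gs) (T-sub L _ t g) (comb-map L gs h)

  span-⊕ : ∀ {n} (gs : List (Point n)) {x y} → Span gs x → Span gs y → Span gs (x ⊕ y)
  span-⊕ = comb-⊕ (λ _ _ → tt)

  span-⊙ : ∀ {n} (gs : List (Point n)) t {x} → Span gs x → Span gs (t ⊙ x)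
  span-⊙ gs t = comb-scale t (λ _ → tt) gs

  span-sub : ∀ {n} (gs : List (Point n)) {x} t {g} → Span gs x → Span gs g → Span gs (x -[ t ] g)
  span-sub gs t {g} h k = comb-resp gs (λ i → solve 3 (λ x t g → x :+ (:- t) :* g := x :- t :* g) refl _ t (g i))
    (span-⊕ gs h (span-⊙ gs (- t) k))

  comb-∷ : ∀ {n} {P} → P 0ℚ → ∀ (g : Point n) gs {x} → Comb P gs x → Comb P (g ∷ gs) x
  comb-∷ p g gs h = 0ℚ , p , comb-resp gs (λ i → solve 2 (λ x g → x := x :- con 0ℚ :* g) refl _ (g i)) h

  span-∷ : ∀ {n} (g : Point n) gs {x} → Span gs x → Span (g ∷ gs) x
  span-∷ = comb-∷ tt

  span-head : ∀ {n} (g : Point n) gs → Span (g ∷ gs) g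
  span-head g gs = 1ℚ , tt , comb-0 tt gs (λ i → solve 1 (λ g → g :- con 1ℚ :* g := con 0ℚ) refl (g i))

  span-self : ∀ {n} (gs : List (Point n)) → All (Span gs) gs
  span-self []       = []
  span-self (g ∷ gs) = span-head g gs ∷ All.map (span-∷ g gs) (span-self gs)

  span-trans : ∀ {n} (gs hs : List (Point n)) → All (Span hs) gs → ∀ {x} → Span gs x → Span hs x
  span-trans []       hs []       h = comb-0 tt hs h
  span-trans (g ∷ gs) hs (p ∷ ps) {x} (t , _ , h) =
    comb-resp hs (λ i → solve 3 (λ x t g → (x :- t :* g) :+ t :* g := x) refl (x i) t (g i))
      (span-⊕ hs (span-trans gs hs ps h) (span-⊙ hs t p))

  vanish-span : ∀ {n} (a : Point n) gs → All (λ g → a ∙ g ≡ 0ℚ) gs → ∀ {x} → Span gs x → a ∙ x ≡ 0ℚ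
  vanish-span a []       []       h = trans (∙-congʳ a h) (∙-𝟎 a)
  vanish-span a (g ∷ gs) (p ∷ ps) {x} (t , _ , h) = trans
    (solve 3 (λ x t g → x := (x :- t :* g) :+ t :* g) refl (a ∙ x) t (a ∙ g))
    (trans (cong₂ _+_ (trans (sym (∙-sub a x t g)) (vanish-span a gs ps h)) (trans (cong (t *_) p) (*-zeroʳ t))) (+-identityʳ 0ℚ))

  Indep : ∀ {n} → List (Point n) → Set
  Indep []       = ⊤
  Indep (u ∷ us) = ¬ Span us u × Indep us

  indep-resp : ∀ {n} {us vs : List (Point n)} → Pointwise _≐_ us vs → Indep us → Indep vs
  indep-resp []       h       = tt
  indep-resp {us = u ∷ us} {v ∷ vs} (e ∷ es) (h , k) =
    (λ s → h (comb-resp us (λ i → sym (e i)) (comb-respˡ (sym-pw es) s))) , indep-resp es k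
    where
    sym-pw : ∀ {n} {us vs : List (Point n)} → Pointwise _≐_ us vs → Pointwise _≐_ vs us
    sym-pw []       = []
    sym-pw (e ∷ es) = (λ i → sym (e i)) ∷ sym-pw es

  indep-map⁻ : ∀ {n k} {T : Point n → Point k} → Linear T → ∀ us → Indep (map T us) → Indep us
  indep-map⁻ L []       h       = tt
  indep-map⁻ L (u ∷ us) (h , k) = (λ s → h (comb-map L us s)) , indep-map⁻ L us k

  -- Projection along `u` onto the hyperplane where `a` vanishes; with `u` as pivot it is one step
  -- of Gaussian elimination.
  module Project {n : ℕ} (a u : Point n) (h : a ∙ u ≢ 0ℚ) where

    proj : Point n → Point n
    proj x = x -[ (a ∙ x) * inv (a ∙ u) h ] u

    proj-linear : Linear proj
    proj-linear = record
      { T-resp = λ e i → cong₂ (λ p q → p - q * inv (a ∙ u) h * u i) (e i) (∙-congʳ a e)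
      ; T-𝟎 = λ i → trans (cong (λ p → 0ℚ - p * inv (a ∙ u) h * u i) (∙-𝟎 a))
                      (solve 2 (λ p u → con 0ℚ :- con 0ℚ :* p :* u := con 0ℚ) refl (inv (a ∙ u) h) (u i))
      ; T-sub = λ x t g i → trans (cong (λ p → (x i - t * g i) - p * inv (a ∙ u) h * u i) (∙-sub a x t g))
                      (solve 7 (λ x t g p q v u → (x :- t :* g) :- (p :- t :* q) :* v :* u := (x :- p :* v :* u) :- t :* (g :- q :* v :* u)) refl
                         (x i) t (g i) (a ∙ x) (a ∙ g) (inv (a ∙ u) h) (u i))
      }

    proj-kernel : ∀ x → a ∙ proj x ≡ 0ℚ
    proj-kernel x = trans (∙-sub a x _ u) (trans (cong (λ p → a ∙ x - p) (quotient (a ∙ u) h (a ∙ x))) (+-inverseʳ (a ∙ x)))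

    proj-fix : ∀ x → a ∙ x ≡ 0ℚ → proj x ≐ x
    proj-fix x e i = trans (cong (λ p → x i - p * inv (a ∙ u) h * u i) e)
      (solve 3 (λ x v u → x :- con 0ℚ :* v :* u := x) refl (x i) (inv (a ∙ u) h) (u i))

    proj-u : ∀ t x → proj (x -[ t ] u) ≐ proj x
    proj-u t x i = trans (cong (λ p → (x i - t * u i) - p * inv (a ∙ u) h * u i) (∙-sub a x t u))
      (trans (solve 6 (λ x t u p q v → (x :- t :* u) :- (p :- t :* q) :* v :* u := (x :- p :* v :* u) :+ t :* u :* (q :* v :- con 1ℚ)) refl
               (x i) t (u i) (a ∙ x) (a ∙ u) (inv (a ∙ u) h))
        (trans (cong (λ p → (x i - a ∙ x * inv (a ∙ u) h * u i) + t * u i * (p - 1ℚ)) (trans (*-comm (a ∙ u) _) (inv-* (a ∙ u) h)))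
          (solve 3 (λ y t u → y :+ t :* u :* (con 1ℚ :- con 1ℚ) := y) refl _ t (u i))))

    unproj : ∀ us {x} → Span (map proj us) x → Span (u ∷ us) x
    unproj us = span-trans (map proj us) (u ∷ us) (go us)
      where
      go : ∀ vs → All (Span (u ∷ vs)) (map proj vs)
      go []       = []
      go (v ∷ vs) = span-sub (u ∷ v ∷ vs) _ (span-∷ u (v ∷ vs) (span-head v vs)) (span-head u (v ∷ vs))
                  ∷ All.map (λ (t , _ , k) → t , tt , span-∷ v vs k) (go vs)

    indep-proj : ∀ us → Indep (u ∷ us) → Indep (map proj us)
    indep-proj []       h = tt
    indep-proj (v ∷ us) (hu , hv , ih) = (λ s → bad (unproj us s)) , indep-proj us ((λ s → hu (span-∷ v us s)) , ih)
      where
      c₀ = (a ∙ v) * inv (a ∙ u) h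
      bad : ¬ Span (u ∷ us) (proj v)
      -- The assumed relation puts v - (c₀ + c)u into the span of `us`. A zero coefficient would
      -- place `v` there; a nonzero one can be divided by, which expresses `u` through `v` and `us`.
      bad (c , _ , s) with c₀ + c ≟ 0ℚ
      ... | yes e = hv (comb-resp us (λ i → trans (solve 4 (λ v c₀ c u → (v :- c₀ :* u) :- c :* u := v :- (c₀ :+ c) :* u) refl (v i) c₀ c (u i))
                       (trans (cong (λ p → v i - p * u i) e) (solve 2 (λ v u → v :- con 0ℚ :* u := v) refl (v i) (u i)))) s)
      ... | no e = hu (d , tt , comb-resp us (λ i → trans
                      (solve 5 (λ v c₀ c u d → (:- d) :* ((v :- c₀ :* u) :- c :* u) := (d :* (c₀ :+ c)) :* u :- d :* v) refl (v i) c₀ c (u i) d)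
                      (cong (_- d * v i) (trans (cong (_* u i) (inv-* (c₀ + c) e)) (*-identityˡ (u i)))))
                    (span-⊙ us (- d) s))
        where d = inv (c₀ + c) e

  -- The intersection of the span with the hyperplane of `a`: vectors before the first pivot already
  -- lie on it, the pivot is dropped, and the later ones are projected along it.
  ker : ∀ {n} → Point n → List (Point n) → List (Point n)
  ker a []       = []
  ker a (u ∷ us) with a ∙ u ≟ 0ℚ
  ... | yes _ = u ∷ ker a us
  ... | no h  = map (Project.proj a u h) us

  ker-vanish : ∀ {n} (a : Point n) us → All (λ k → a ∙ k ≡ 0ℚ) (ker a us)
  ker-vanish a []       = []
  ker-vanish a (u ∷ us) with a ∙ u ≟ 0ℚ
  ... | yes e = e ∷ ker-vanish a us
  ... | no h  = go us
    where
    go : ∀ vs → All (λ k → a ∙ k ≡ 0ℚ) (map (Project.proj a u h) vs)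
    go []       = []
    go (v ∷ vs) = Project.proj-kernel a u h v ∷ go vs

  ker-⊆ : ∀ {n} (a : Point n) us {x} → Span (ker a us) x → Span us x
  ker-⊆ a []       s = s
  ker-⊆ a (u ∷ us) s with a ∙ u ≟ 0ℚ
  ker-⊆ a (u ∷ us) (t , _ , s) | yes e = t , tt , ker-⊆ a us s
  ... | no h  = Project.unproj a u h us s

  ker-⊇ : ∀ {n} (a : Point n) us {x} → a ∙ x ≡ 0ℚ → Span us x → Span (ker a us) x
  ker-⊇ a []       _ s = s
  ker-⊇ a (u ∷ us) {x} ex (t , _ , s) with a ∙ u ≟ 0ℚ
  ... | yes e = t , tt , ker-⊇ a us (trans (∙-sub a x t u) (trans (cong₂ (λ p q → p - t * q) ex e)
                  (solve 1 (λ t → con 0ℚ :- t :* con 0ℚ := con 0ℚ) refl t))) s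
  ... | no h  = comb-resp (map proj us) (λ i → trans (proj-u t x i) (proj-fix x ex i)) (comb-map proj-linear us s)
    where open Project a u h

  ker-indep : ∀ {n} (a : Point n) us → Indep us → Indep (ker a us)
  ker-indep a []       h = tt
  ker-indep a (u ∷ us) (h , k) with a ∙ u ≟ 0ℚ
  ... | yes e = (λ s → h (ker-⊆ a us s)) , ker-indep a us k
  ... | no e  = Project.indep-proj a u e us (h , k)

  -- At most one pivot is removed. The dimension drops by exactly one when the hyperplane does not
  -- contain the span, and the change of sign in `cut` comes from here.
  ker-length : ∀ {n} (a : Point n) us →
    (All (λ u → a ∙ u ≡ 0ℚ) us × ker a us ≡ us) ⊎
    ((∃ λ u → Span us u × a ∙ u ≢ 0ℚ) × length us ≡ suc (length (ker a us)))
  ker-length a []       = inj₁ ([] , refl)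
  ker-length a (u ∷ us) with a ∙ u ≟ 0ℚ
  ... | no h = inj₂ ((u , span-head u us , h) , cong suc (sym (L.length-map _ us)))
  ... | yes e with ker-length a us
  ... | inj₁ (p , q) = inj₁ (e ∷ p , cong (u ∷_) q)
  ... | inj₂ ((v , s , h) , l) = inj₂ ((v , span-∷ u us s , h) , cong suc l)

  pad : ∀ {n} → Point n → Point (suc n)
  pad x zero    = 0ℚ
  pad x (suc i) = x i

  pad-linear : ∀ {n} → Linear (pad {n})
  pad-linear = record
    { T-resp = λ { e zero → refl ; e (suc i) → e i }
    ; T-𝟎 = λ { zero → refl ; (suc i) → refl }
    ; T-sub = λ { x t g zero → solve 1 (λ t → con 0ℚ := con 0ℚ :- t :* con 0ℚ) refl t ; x t g (suc i) → refl } }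

  unit₀ : ∀ {n} → Point (suc n)
  unit₀ zero    = 1ℚ
  unit₀ (suc i) = 0ℚ

  unit₀-∙ : ∀ {n} (x : Point (suc n)) → unit₀ ∙ x ≡ x zero
  unit₀-∙ x = trans (∙-suc unit₀ x) (trans (cong₂ _+_ (*-identityˡ (x zero)) (𝟎-∙ (tl x))) (+-identityʳ _))

  -- Induction on the dimension: passing to the kernel of the first coordinate costs at most one
  -- vector, and the vectors left can be read in one dimension less.
  indep-length : ∀ {n} (us : List (Point n)) → Indep us → length us ℕ.≤ n
  indep-length []       h = ℕ.z≤n
  indep-length {zero}  (u ∷ us) (h , _) = ⊥-elim (h (comb-0 tt us (λ ())))
  indep-length {suc n} us@(_ ∷ _) h = ℕ.≤-trans bound (ℕ.s≤s (subst (ℕ._≤ n) (L.length-map tl ks)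
      (indep-length (map tl ks) (indep-map⁻ pad-linear (map tl ks) (indep-resp (repad ks (ker-vanish unit₀ us)) (ker-indep unit₀ us h))))))
    where
    ks = ker unit₀ us
    repad : ∀ ks → All (λ k → unit₀ ∙ k ≡ 0ℚ) ks → Pointwise _≐_ ks (map pad (map tl ks))
    repad []       []       = []
    repad (k ∷ ks) (e ∷ es) = (λ { zero → trans (sym (unit₀-∙ k)) e ; (suc i) → refl }) ∷ repad ks es
    bound : length us ℕ.≤ suc (length ks)
    bound with ker-length unit₀ us
    ... | inj₁ (_ , q) = ℕ.m≤n⇒m≤1+n (ℕ.≤-reflexive (cong length (sym q)))
    ... | inj₂ (_ , l) = ℕ.≤-reflexive l

  combine : ∀ {n} (ws : List (Point n)) → Point (length ws) → Point n
  combine []       k = 𝟎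
  combine (w ∷ ws) k = k zero ⊙ w ⊕ combine ws (tl k)

  combine-linear : ∀ {n} (ws : List (Point n)) → Linear (combine ws)
  combine-linear ws = record { T-resp = rsp ws ; T-𝟎 = z ws ; T-sub = sub ws }
    where
    rsp : ∀ ws {x y} → x ≐ y → combine ws x ≐ combine ws y
    rsp []       e i = refl
    rsp (w ∷ ws) e i = cong₂ (λ p q → p * w i + q) (e zero) (rsp ws (λ j → e (suc j)) i)
    z : ∀ ws → combine ws 𝟎 ≐ 𝟎
    z []       i = refl
    z (w ∷ ws) i = trans (cong (0ℚ * w i +_) (z ws i)) (solve 1 (λ w → con 0ℚ :* w :+ con 0ℚ := con 0ℚ) refl (w i))
    sub : ∀ ws x t g → combine ws (x -[ t ] g) ≐ combine ws x -[ t ] combine ws g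
    sub []       x t g i = solve 1 (λ t → con 0ℚ := con 0ℚ :- t :* con 0ℚ) refl t
    sub (w ∷ ws) x t g i = trans (cong ((x zero - t * g zero) * w i +_) (sub ws (λ j → x (suc j)) t (λ j → g (suc j)) i))
      (solve 6 (λ x t g w p q → (x :- t :* g) :* w :+ (p :- t :* q) := (x :* w :+ p) :- t :* (g :* w :+ q)) refl
         (x zero) t (g zero) (w i) _ _)

  coords : ∀ {n} (ws : List (Point n)) {u} → Span ws u → ∃ λ k → u ≐ combine ws k
  coords []       s = (λ ()) , s
  coords (w ∷ ws) {u} (t , _ , s) with coords ws s
  ... | k , e = (λ { zero → t ; (suc i) → k i }) ,
     λ i → trans (solve 3 (λ u t w → u := t :* w :+ (u :- t :* w)) refl (u i) t (w i)) (cong (t * w i +_) (e i))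

  -- A linear map cannot make dependent vectors independent, so the coefficient vectors of `us` with
  -- respect to `ws` are independent too; these live in dimension `length ws`.
  indep-≤ : ∀ {n} (us ws : List (Point n)) → Indep us → All (Span ws) us → length us ℕ.≤ length ws
  indep-≤ us ws h ss with pull us ss
    where
    pull : ∀ us → All (Span ws) us → ∃ λ ks → Pointwise _≐_ us (map (combine ws) ks) × length ks ≡ length us
    pull []       []       = [] , [] , refl
    pull (u ∷ us) (s ∷ ss) with coords ws s | pull us ss
    ... | k , e | ks , es , l = k ∷ ks , e ∷ es , cong suc l
  ... | ks , es , l = subst (ℕ._≤ length ws) l
         (indep-length ks (indep-map⁻ (combine-linear ws) ks (indep-resp es h)))

  -- Fourier–Motzkin elimination of the coefficient of g.
  module _ {n : ℕ} (g : Point n) (as : List (Point n)) where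

    nonposRows posRows : List (Point n)
    nonposRows = filter (λ a → a ∙ g ≤? 0ℚ) as
    posRows    = filter (λ a → 0ℚ <? a ∙ g) as

    -- Combines a positive row `a` with a nonpositive row `b` so that `g` drops out; both
    -- coefficients are then nonnegative.
    row : Point n → Point n → Point n
    row a b = (a ∙ g) ⊙ b ⊕ (- (b ∙ g)) ⊙ a

    row-∙ : ∀ a b x → row a b ∙ x ≡ (a ∙ g) * (b ∙ x) - (b ∙ g) * (a ∙ x)
    row-∙ a b x = trans (∙-comm (row a b) x) (trans (∙-linear x b a (a ∙ g) (- (b ∙ g)))
      (trans (cong₂ (λ p q → (a ∙ g) * p + (- (b ∙ g)) * q) (∙-comm x b) (∙-comm x a))
        (solve 4 (λ p q r s → p :* q :+ (:- r) :* s := p :* q :- r :* s) refl (a ∙ g) (b ∙ x) (b ∙ g) (a ∙ x))))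

    eliminate : List (Point n)
    eliminate = nonposRows ++ L.cartesianProductWith row posRows nonposRows

    Sat : List (Point n) → Point n → Set
    Sat rs x = All (λ a → a ∙ x ≤ 0ℚ) rs

    eliminate-sound : ∀ x t → 0ℚ ≤ t → Sat as (x -[ t ] g) → Sat eliminate x
    eliminate-sound x t 0≤t sat = All.tabulate λ r∈ → go (∈-++⁻ nonposRows r∈)
      where
      bound : ∀ {a} → a ∈ as → a ∙ x - t * (a ∙ g) ≤ 0ℚ
      bound {a} a∈ = subst (_≤ 0ℚ) (∙-sub a x t g) (All.lookup sat a∈)
      go : ∀ {r} → (r ∈ nonposRows) ⊎ (r ∈ L.cartesianProductWith row posRows nonposRows) → r ∙ x ≤ 0ℚ
      go {r} (inj₁ r∈) with ∈-filter⁻ (λ a → a ∙ g ≤? 0ℚ) {xs = as} r∈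
      ... | r∈as , r≤ = subst (_≤ 0ℚ) (solve 3 (λ x t g → (x :- t :* g) :+ t :* g := x) refl (r ∙ x) t (r ∙ g))
            (nonpos-+ (bound r∈as) (*-nonneg-nonpos 0≤t r≤))
      go (inj₂ r∈) with ∈-cartesianProductWith⁻ row posRows nonposRows r∈
      ... | a , b , a∈ , b∈ , refl with ∈-filter⁻ (λ a → 0ℚ <? a ∙ g) {xs = as} a∈ | ∈-filter⁻ (λ a → a ∙ g ≤? 0ℚ) {xs = as} b∈
      ... | a∈as , a> | b∈as , b≤ = subst (_≤ 0ℚ)
            (trans (solve 5 (λ p q r s t → p :* (q :- t :* r) :+ (:- r) :* (s :- t :* p) := p :* q :- r :* s) refl (a ∙ g) (b ∙ x) (b ∙ g) (a ∙ x) t)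
                   (sym (row-∙ a b x)))
            (nonpos-+ (*-nonneg-nonpos (<⇒≤ a>) (bound b∈as)) (*-nonneg-nonpos (nonpos⇒0≤ b≤) (bound a∈as)))

    -- The smallest admissible coefficient of `g`. The final alternative keeps a row that forces
    -- this value, because that is the row with which the nonpositive rows have to be paired.
    maxBound : ∀ x rs → All (λ a → 0ℚ < a ∙ g) rs → ∃ λ t → 0ℚ ≤ t × All (λ a → a ∙ x ≤ t * (a ∙ g)) rs ×
               ((t ≡ 0ℚ) ⊎ ∃ λ a → (a ∈ rs) × a ∙ x ≡ t * (a ∙ g))
    maxBound x []       []       = 0ℚ , ≤-refl , [] , inj₁ refl
    maxBound x (a ∷ rs) (h ∷ hs) with maxBound x rs hs
    ... | t , 0≤t , bs , w with a ∙ x ≤? t * (a ∙ g)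
    ... | yes le = t , 0≤t , le ∷ bs , (case w)
      where
      case : (t ≡ 0ℚ) ⊎ (∃ λ b → (b ∈ rs) × b ∙ x ≡ t * (b ∙ g)) → (t ≡ 0ℚ) ⊎ (∃ λ b → (b ∈ a ∷ rs) × b ∙ x ≡ t * (b ∙ g))
      case (inj₁ e)            = inj₁ e
      case (inj₂ (b , b∈ , e)) = inj₂ (b , there b∈ , e)
    ... | no nle = t′ , ≤-trans 0≤t t≤t′ , ≤-reflexive (sym t′a) ∷ raise rs hs bs , inj₂ (a , here refl , sym t′a)
      where
      t′ = (a ∙ x) * inv (a ∙ g) (pos⇒≢0 h)
      t′a : t′ * (a ∙ g) ≡ a ∙ x
      t′a = quotient (a ∙ g) (pos⇒≢0 h) (a ∙ x)
      t≤t′ : t ≤ t′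
      t≤t′ = *-cancelˡ-≤ h (subst₂ _≤_ (*-comm t _) (trans (sym t′a) (*-comm t′ _)) (<⇒≤ (≰⇒> nle)))
      raise : ∀ rs → All (λ a → 0ℚ < a ∙ g) rs → All (λ a → a ∙ x ≤ t * (a ∙ g)) rs → All (λ a → a ∙ x ≤ t′ * (a ∙ g)) rs
      raise []       []       []       = []
      raise (b ∷ rs) (h ∷ hs) (l ∷ ls) = ≤-trans l (*-monoʳ-≤ (<⇒≤ h) t≤t′) ∷ raise rs hs ls

    eliminate-complete : ∀ x → Sat eliminate x → ∃ λ t → 0ℚ ≤ t × Sat as (x -[ t ] g)
    eliminate-complete x sat with maxBound x posRows (All.tabulate (λ a∈ → proj₂ (∈-filter⁻ (λ a → 0ℚ <? a ∙ g) {xs = as} a∈)))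
    ... | t , 0≤t , bs , w = t , 0≤t , All.tabulate λ {a} a∈ → subst (_≤ 0ℚ) (sym (∙-sub a x t g)) (go a a∈ w)
      where
      shift : ∀ p q → p ≤ q → p - q ≤ 0ℚ
      shift p q h = subst (p - q ≤_) (+-inverseʳ q) (+-monoˡ-≤ (- q) h)
      go : ∀ a → a ∈ as → (t ≡ 0ℚ) ⊎ (∃ λ b → (b ∈ posRows) × b ∙ x ≡ t * (b ∙ g)) → a ∙ x - t * (a ∙ g) ≤ 0ℚ
      go a a∈ w with a ∙ g ≤? 0ℚ
      ... | no nle = shift _ _ (All.lookup bs (∈-filter⁺ (λ a → 0ℚ <? a ∙ g) a∈ (≰⇒> nle)))
      go a a∈ (inj₁ refl) | yes le = subst (_≤ 0ℚ) (solve 2 (λ x g → x := x :- con 0ℚ :* g) refl (a ∙ x) (a ∙ g))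
        (All.lookup sat (∈-++⁺ˡ (∈-filter⁺ (λ a → a ∙ g ≤? 0ℚ) a∈ le)))
      -- Since `b` is tight at `t`, the eliminated row of `b` and `a` is the positive factor `b ∙ g`
      -- times the wanted inequality.
      go a a∈ (inj₂ (b , b∈ , e)) | yes le = *-cancelˡ-≤ bg>0 (subst₂ _≤_ eq (sym (*-zeroʳ (b ∙ g)))
          (All.lookup sat (∈-++⁺ʳ nonposRows (∈-cartesianProductWith⁺ row b∈ (∈-filter⁺ (λ a → a ∙ g ≤? 0ℚ) a∈ le)))))
        where
        bg>0 : 0ℚ < b ∙ g
        bg>0 = proj₂ (∈-filter⁻ (λ a → 0ℚ <? a ∙ g) {xs = as} b∈)
        eq : row b a ∙ x ≡ (b ∙ g) * (a ∙ x - t * (a ∙ g))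
        eq = trans (row-∙ b a x) (trans (cong (λ p → (b ∙ g) * (a ∙ x) - (a ∙ g) * p) e)
          (solve 4 (λ p q r t → p :* q :- r :* (t :* p) := p :* (q :- t :* r)) refl (b ∙ g) (a ∙ x) (a ∙ g) t))

  unit : ∀ {n} → Fin n → Point n
  unit zero    zero    = 1ℚ
  unit zero    (suc j) = 0ℚ
  unit (suc i) zero    = 0ℚ
  unit (suc i) (suc j) = unit i j

  opaque
    unfolding _∙_

    unit-∙ : ∀ {n} (i : Fin n) x → unit i ∙ x ≡ x i
    unit-∙ zero    x = trans (cong₂ _+_ (*-identityˡ (x zero)) (𝟎-∙ (tl x))) (+-identityʳ _)
    unit-∙ (suc i) x = trans (cong₂ _+_ (*-zeroˡ (x zero)) (unit-∙ i (λ j → x (suc j)))) (+-identityˡ _)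

  -- One half of the Minkowski-Weyl theorem: generators are traded for inequalities by eliminating
  -- their coefficients one after another. The cone without generators is the origin, hence the two
  -- families of rows that bound each coordinate by zero from both sides. The same rows later serve
  -- as the hyperplanes used for cutting.
  rows : ∀ {n} → List (Point n) → List (Point n)
  rows {n} []   = map unit (allFin n) ++ map (λ i → opp (unit i)) (allFin n)
  rows (g ∷ gs) = eliminate g (rows gs)

  Satisfies : ∀ {n} → List (Point n) → Point n → Set
  Satisfies rs x = All (λ a → a ∙ x ≤ 0ℚ) rs

  cone⇒rows : ∀ {n} (gs : List (Point n)) {x} → Cone gs x → Satisfies (rows gs) x
  cone⇒rows []       h           = All.tabulate λ {r} _ → ≤-reflexive (trans (∙-congʳ r h) (∙-𝟎 r))
  cone⇒rows (g ∷ gs) {x} (t , p , h) = eliminate-sound g (rows gs) x t p (cone⇒rows gs h)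

  rows⇒cone : ∀ {n} (gs : List (Point n)) {x} → Satisfies (rows gs) x → Cone gs x
  rows⇒cone {n} [] {x} h i = ≤-antisym x≤0 0≤x
    where
    us vs : List (Point n)
    us = map unit (allFin n)
    vs = map (λ i → opp (unit i)) (allFin n)
    u∈ : unit i ∈ us ++ vs
    u∈ = ∈-++⁺ˡ {xs = us} {ys = vs} (∈-map⁺ unit (∈-allFin i))
    v∈ : opp (unit i) ∈ us ++ vs
    v∈ = ∈-++⁺ʳ us {ys = vs} (∈-map⁺ (λ i → opp (unit i)) (∈-allFin i))
    x≤0 : x i ≤ 0ℚ
    x≤0 = subst (_≤ 0ℚ) (unit-∙ i x) (All.lookup h u∈)
    -x≤0 : - x i ≤ 0ℚ
    -x≤0 = subst (_≤ 0ℚ) (trans (opp-∙ (unit i) x) (cong -_ (unit-∙ i x))) (All.lookup h v∈)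
    0≤x : 0ℚ ≤ x i
    0≤x = subst (0ℚ ≤_) (solve 1 (λ p → con 0ℚ :- (:- p) := p) refl (x i)) (≤⇒0≤- -x≤0)
  rows⇒cone (g ∷ gs) {x} h = let t , p , k = eliminate-complete g (rows gs) x h in t , p , rows⇒cone gs k

-- Compactly supported Euler characteristic of relatively open convex cones.

module Euler where

  open import Data.Integer as ℤ using (ℤ; 0ℤ)
  import Data.Integer.Properties as ℤ
  import Data.Integer.Solver as ℤS
  open import Data.Rational using (ℚ; 0ℚ; 1ℚ; _<_)
  open import Data.Rational.Properties using (<-cmp; <-irrefl)
  open OpaqueRational
  open Cones
  open import Relation.Nullary.Decidable using (¬¬-excluded-middle)

  infixl 1 _>>=_

  _>>=_ : ∀ {a b} {A : Set a} {B : Set b} → ¬ ¬ A → (A → ¬ ¬ B) → ¬ ¬ B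
  (m >>= f) k = m λ a → f a k

  return : ∀ {a} {A : Set a} → A → ¬ ¬ A
  return a k = k a

  ¬¬-fin : ∀ {r} {A : Fin r → Set} → (∀ i → ¬ ¬ A i) → ¬ ¬ (∀ i → A i)
  ¬¬-fin {zero}  h = return λ ()
  ¬¬-fin {suc r} h = do
    a  ← h zero
    as ← ¬¬-fin (λ i → h (suc i))
    return λ { zero → a ; (suc i) → as i }

  ΣF : ∀ r → (Fin r → ℤ) → ℤ
  ΣF zero    z = 0ℤ
  ΣF (suc r) z = z zero ℤ.+ ΣF r (λ i → z (suc i))

  ΣF-cong : ∀ r {y z : Fin r → ℤ} → (∀ i → y i ≡ z i) → ΣF r y ≡ ΣF r z
  ΣF-cong zero    e = refl
  ΣF-cong (suc r) e = cong₂ ℤ._+_ (e zero) (ΣF-cong r (λ i → e (suc i)))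

  ΣF-+ : ∀ r (y z : Fin r → ℤ) → ΣF r (λ i → y i ℤ.+ z i) ≡ ΣF r y ℤ.+ ΣF r z
  ΣF-+ zero    y z = refl
  ΣF-+ (suc r) y z = trans (cong (λ s → (y zero ℤ.+ z zero) ℤ.+ s) (ΣF-+ r (λ i → y (suc i)) (λ i → z (suc i))))
    (solve′ 4 (λ a b c d → a :+′ b :+′ (c :+′ d) :=′ a :+′ c :+′ (b :+′ d)) refl (y zero) (z zero) (ΣF r (λ i → y (suc i))) (ΣF r (λ i → z (suc i))))
    where open ℤS.+-*-Solver renaming (solve to solve′; _:+_ to _:+′_; _:=_ to _:=′_)

  ΣF-* : ∀ r s (z : Fin r → ℤ) → ΣF r (λ i → s ℤ.* z i) ≡ s ℤ.* ΣF r z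
  ΣF-* zero    s z = sym (ℤ.*-zeroʳ s)
  ΣF-* (suc r) s z = trans (cong (λ t → s ℤ.* z zero ℤ.+ t) (ΣF-* r s (λ i → z (suc i)))) (sym (ℤ.*-distribˡ-+ s (z zero) _))

  ΣF-0 : ∀ r (z : Fin r → ℤ) → (∀ i → z i ≡ 0ℤ) → ΣF r z ≡ 0ℤ
  ΣF-0 zero    z e = refl
  ΣF-0 (suc r) z e = cong₂ ℤ._+_ (e zero) (ΣF-0 r (λ i → z (suc i)) (λ i → e (suc i)))

  ΣF-single : ∀ r (z : Fin r → ℤ) i → (∀ j → j ≢ i → z j ≡ 0ℤ) → ΣF r z ≡ z i
  ΣF-single (suc r) z zero    e = trans (cong (λ s → z zero ℤ.+ s) (ΣF-0 r (λ i → z (suc i)) (λ i → e (suc i) (λ ())))) (ℤ.+-identityʳ _)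
  ΣF-single (suc r) z (suc i) e = trans (cong₂ ℤ._+_ (e zero (λ ()))
    (ΣF-single r (λ i → z (suc i)) i (λ j h → e (suc j) (λ e → h (F.suc-injective e))))) (ℤ.+-identityˡ _)

  -- A convex cone that is open in the span of `us`, openness being `nudge`. The set may be empty,
  -- and then `us` says nothing about it; this keeps the structure stable under open half-spaces
  -- before it is known whether they are met.
  record RelOpen {n} (X : Point n → Set) (us : List (Point n)) : Set where
    field
      indep  : Indep us
      respX  : ∀ {x y} → x ≐ y → X x → X y
      addX   : ∀ {x y} → X x → X y → X (x ⊕ y)
      scaleX : ∀ {x} t → 0ℚ < t → X x → X (t ⊙ x)
      inSpan : ∀ {x} → X x → Span us x
      nudge  : ∀ {x v} → X x → Span us v → Small (λ δ → X (x ⊕ δ ⊙ v))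
  open RelOpen public

  _∩⁺_ _∩⁰_ : ∀ {n} → (Point n → Set) → Point n → Point n → Set
  (X ∩⁺ a) x = X x × 0ℚ < a ∙ x
  (X ∩⁰ a) x = X x × a ∙ x ≡ 0ℚ

  ∙-nudge : ∀ {n} (a x : Point n) δ v → a ∙ (x ⊕ δ ⊙ v) ≡ a ∙ x + δ * (a ∙ v)
  ∙-nudge a x δ v = trans (∙-⊕ a x (δ ⊙ v)) (cong (λ s → a ∙ x + s) (∙-⊙ a v δ))

  relOpen-∩⁺ : ∀ {n} {X : Point n → Set} {us} a → RelOpen X us → RelOpen (X ∩⁺ a) us
  relOpen-∩⁺ a R = record
    { indep  = indep R
    ; respX  = λ e (p , q) → respX R e p , subst (0ℚ <_) (∙-congʳ a e) q
    ; addX   = λ {x} {y} (p , q) (p′ , q′) → addX R p p′ , subst (0ℚ <_) (sym (∙-⊕ a x y)) (0<+ q q′)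
    ; scaleX = λ {x} t h (p , q) → scaleX R t h p , subst (0ℚ <_) (sym (∙-⊙ a x t)) (0<* h q)
    ; inSpan = λ (p , q) → inSpan R p
    ; nudge  = λ {x} {v} (p , q) s → small-map (λ δ _ (k , l) → k , subst (0ℚ <_) (sym (∙-nudge a x δ v)) l)
                 (small-× (nudge R p s) (small-pos (a ∙ x) (a ∙ v) q))
    }

  relOpen-∩⁰ : ∀ {n} {X : Point n → Set} {us} a → RelOpen X us → RelOpen (X ∩⁰ a) (ker a us)
  relOpen-∩⁰ {us = us} a R = record
    { indep  = ker-indep a us (indep R)
    ; respX  = λ e (p , q) → respX R e p , trans (sym (∙-congʳ a e)) q
    ; addX   = λ {x} {y} (p , q) (p′ , q′) → addX R p p′ , trans (∙-⊕ a x y) (trans (cong₂ _+_ q q′) (+-identityʳ 0ℚ))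
    ; scaleX = λ {x} t h (p , q) → scaleX R t h p , trans (∙-⊙ a x t) (trans (cong (t *_) q) (*-zeroʳ t))
    ; inSpan = λ (p , q) → ker-⊇ a us q (inSpan R p)
    ; nudge  = λ {x} {v} (p , q) s → small-map (λ δ _ k → k , trans (∙-nudge a x δ v)
                   (trans (cong₂ (λ p q → p + δ * q) q (vanish-span a (ker a us) (ker-vanish a us) s)) (trans (cong (0ℚ +_) (*-zeroʳ δ)) (+-identityʳ 0ℚ))))
                 (nudge R p (ker-⊆ a us s))
    }

  -- z is the compactly supported Euler characteristic of X.
  HasEuler : ∀ {n} → (Point n → Set) → ℤ → Set
  HasEuler X z = ∃ λ us → RelOpen X us × ((∃ X × z ≡ sgn (length us)) ⊎ ((∀ x → ¬ X x) × z ≡ 0ℤ))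

  -- An inhabited relatively open set determines its span: each direction is, up to scaling, the
  -- difference of two of its points. Both bases therefore span each other and have the same length.
  euler-unique : ∀ {n} {X Y : Point n → Set} {y z} → (∀ {x} → X x → Y x) → (∀ {x} → Y x → X x) →
                 HasEuler X y → HasEuler Y z → y ≡ z
  euler-unique f g (us , R , inj₂ (_ , e)) (vs , S , inj₂ (_ , e′)) = trans e (sym e′)
  euler-unique f g (us , R , inj₁ ((x , p) , _)) (vs , S , inj₂ (h , _)) = ⊥-elim (h x (f p))
  euler-unique f g (us , R , inj₂ (h , _)) (vs , S , inj₁ ((x , p) , _)) = ⊥-elim (h x (g p))
  euler-unique f g (us , R , inj₁ ((x , p) , e)) (vs , S , inj₁ ((y , q) , e′)) =
    trans e (trans (cong sgn (ℕ.≤-antisym (indep-≤ us vs (indep R) (spans R S f x p us (span-self us)))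
                                         (indep-≤ vs us (indep S) (spans S R g y q vs (span-self vs))))) (sym e′))
    where
    spans : ∀ {n} {X Y : Point n → Set} {us vs} → RelOpen X us → RelOpen Y vs → (∀ {x} → X x → Y x) → ∀ x → X x →
            ∀ ws → All (Span us) ws → All (Span vs) ws
    spans R S f x p []       []       = []
    spans {vs = vs} R S f x p (w ∷ ws) (s ∷ ss) with small-witness (nudge R p s)
    ... | δ , hδ , k = comb-resp vs (λ i → trans
             (solve 4 (λ v x δ w → v :* ((x :+ δ :* w) :- con 1ℚ :* x) := (v :* δ) :* w) refl (inv δ (pos⇒≢0 hδ)) (x i) δ (w i))
             (trans (cong (_* w i) (inv-* δ (pos⇒≢0 hδ))) (*-identityˡ (w i))))
           (span-⊙ vs (inv δ (pos⇒≢0 hδ)) (span-sub vs 1ℚ (inSpan S (f k)) (inSpan S (f p))))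
         ∷ spans R S f x p ws ss

  0<square : ∀ p → p ≢ 0ℚ → 0ℚ < p * p
  0<square p h with <-cmp p 0ℚ
  ... | tri< l _ _ = subst (0ℚ <_) (solve 1 (λ p → (:- p) :* (:- p) := p :* p) refl p) (0<* (neg⇒pos l) (neg⇒pos l))
  ... | tri≈ _ e _ = ⊥-elim (h e)
  ... | tri> _ _ g = 0<* g g

  opp-pos : ∀ {n} (a x : Point n) → a ∙ x < 0ℚ → 0ℚ < opp a ∙ x
  opp-pos a x h = subst (0ℚ <_) (sym (opp-∙ a x)) (neg⇒pos h)

  opp-pos⁻ : ∀ {n} (a x : Point n) → 0ℚ < opp a ∙ x → a ∙ x < 0ℚ
  opp-pos⁻ a x h = subst (_< 0ℚ) (trans (cong -_ (opp-∙ a x)) (solve 1 (λ p → :- (:- p) := p) refl (a ∙ x))) (pos⇒neg h)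

  module _ {n : ℕ} {X : Point n → Set} (a : Point n) where

    -- Moving along `u` scaled by `a ∙ u` changes the value of `a` by a positive multiple of a
    -- square, whatever the sign of `a ∙ u`.
    zero⇒pos : ∀ {us} → RelOpen X us → (∃ λ u → Span us u × a ∙ u ≢ 0ℚ) → ∃ (X ∩⁰ a) → ∃ (X ∩⁺ a)
    zero⇒pos {us} R (u , s , h) (x , p , e) with small-witness (nudge R p (span-⊙ us (a ∙ u) s))
    ... | δ , hδ , k = _ , k , subst (0ℚ <_)
          (trans (trans (solve 3 (λ δ p e → δ :* (p :* p) := con 0ℚ :+ δ :* (p :* p)) refl δ (a ∙ u) 0ℚ) (cong₂ (λ p q → p + δ * q) (sym e) (sym (∙-⊙ a u (a ∙ u)))))
                 (sym (∙-nudge a x δ _))) (0<* hδ (0<square (a ∙ u) h))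

    -- The weights, minus the value of `a` at the second point and its value at the first, are
    -- positive and make the two contributions cancel.
    pos-neg⇒zero : ∀ {us} → RelOpen X us → ∃ (X ∩⁺ a) → ∃ (X ∩⁺ opp a) → ∃ (X ∩⁰ a)
    pos-neg⇒zero R (x , p , h) (y , q , k) = _ , addX R (scaleX R (opp a ∙ y) k p) (scaleX R (a ∙ x) h q) ,
      trans (∙-linear a x y (opp a ∙ y) (a ∙ x)) (trans (cong (λ r → r * (a ∙ x) + (a ∙ x) * (a ∙ y)) (opp-∙ a y))
        (solve 2 (λ p q → (:- q) :* p :+ p :* q := con 0ℚ) refl (a ∙ x) (a ∙ y)))

  -- If `a` vanishes on the span, nothing is cut. Otherwise a point on the hyperplane can be pushed
  -- to both sides, and points on both sides give one between them. So either a single open side is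
  -- inhabited and carries everything, or all three parts are inhabited, the middle one in one
  -- dimension less, and its sign cancels that of one side.
  cut : ∀ {n} {X : Point n → Set} {z} (a : Point n) → HasEuler X z →
        ¬ ¬ (∃ λ z⁺ → ∃ λ z⁰ → ∃ λ z⁻ → HasEuler (X ∩⁺ a) z⁺ × HasEuler (X ∩⁰ a) z⁰ × HasEuler (X ∩⁺ opp a) z⁻ ×
             z ≡ z⁺ ℤ.+ (z⁰ ℤ.+ z⁻))
  cut a (us , R , inj₂ (h , refl)) = return (0ℤ , 0ℤ , 0ℤ , (us , relOpen-∩⁺ a R , inj₂ ((λ x p → h x (proj₁ p)) , refl))
    , (_ , relOpen-∩⁰ a R , inj₂ ((λ x p → h x (proj₁ p)) , refl)) , (us , relOpen-∩⁺ (opp a) R , inj₂ ((λ x p → h x (proj₁ p)) , refl)) , refl)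
  cut {X = X} a (us , R , inj₁ ((x , p) , refl)) with ker-length a us
  ... | inj₁ (vanish , e) = return (0ℤ , _ , 0ℤ
      , (us , relOpen-∩⁺ a R , inj₂ ((λ y (q , h) → <-irrefl (sym (on y q)) h) , refl))
      , (ker a us , relOpen-∩⁰ a R , inj₁ ((x , p , on x p) , refl))
      , (us , relOpen-∩⁺ (opp a) R , inj₂ ((λ y (q , h) → <-irrefl (on y q) (opp-pos⁻ a y h)) , refl))
      , trans (cong (λ us → sgn (length us)) (sym e)) (trans (sym (ℤ.+-identityʳ _)) (sym (ℤ.+-identityˡ _))))
    where
    on : ∀ y → X y → a ∙ y ≡ 0ℚ
    on y q = vanish-span a us vanish (inSpan R q)
  ... | inj₂ (w@(u , s , h) , len) = do
      d⁺ ← ¬¬-excluded-middle {A = ∃ (X ∩⁺ a)}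
      d⁻ ← ¬¬-excluded-middle {A = ∃ (X ∩⁺ opp a)}
      return (decide d⁺ d⁻)
    where
    w⁻ : ∃ λ u → Span us u × opp a ∙ u ≢ 0ℚ
    w⁻ = u , s , λ e → h (trans (solve 1 (λ p → p := :- (:- p)) refl (a ∙ u)) (trans (cong -_ (trans (sym (opp-∙ a u)) e)) (solve 0 (:- con 0ℚ := con 0ℚ) refl)))
    zero⇒neg : ∃ (X ∩⁰ a) → ∃ (X ∩⁺ opp a)
    zero⇒neg (y , q , e) = zero⇒pos (opp a) R w⁻ (y , q , trans (opp-∙ a y) (trans (cong -_ e) (solve 0 (:- con 0ℚ := con 0ℚ) refl)))
    none : ∀ {Y : Point _ → Set} → ¬ ∃ Y → ∀ y → ¬ Y y
    none h y k = h (y , k)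
    decide : Dec (∃ (X ∩⁺ a)) → Dec (∃ (X ∩⁺ opp a)) → _
    decide (yes p) (yes q) = _ , _ , _ , (us , relOpen-∩⁺ a R , inj₁ (p , refl))
      , (ker a us , relOpen-∩⁰ a R , inj₁ (pos-neg⇒zero a R p q , refl)) , (us , relOpen-∩⁺ (opp a) R , inj₁ (q , refl))
      , trans (sym (ℤ.+-identityʳ _)) (cong (λ s → sgn (length us) ℤ.+ s) (sym (trans (cong (λ l → sgn (length (ker a us)) ℤ.+ sgn l) len) (ℤ.+-inverseʳ (sgn (length (ker a us)))))))
    decide (yes p) (no q) = _ , 0ℤ , 0ℤ , (us , relOpen-∩⁺ a R , inj₁ (p , refl))
      , (ker a us , relOpen-∩⁰ a R , inj₂ (none (λ e → q (zero⇒neg e)) , refl)) , (us , relOpen-∩⁺ (opp a) R , inj₂ (none q , refl))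
      , sym (ℤ.+-identityʳ _)
    decide (no p) (yes q) = 0ℤ , 0ℤ , _ , (us , relOpen-∩⁺ a R , inj₂ (none p , refl))
      , (ker a us , relOpen-∩⁰ a R , inj₂ (none (λ e → p (zero⇒pos a R w e)) , refl)) , (us , relOpen-∩⁺ (opp a) R , inj₁ (q , refl))
      , sym (trans (ℤ.+-identityˡ _) (ℤ.+-identityˡ _))
    decide (no r) (no q) with <-cmp (a ∙ x) 0ℚ
    ... | tri< l _ _ = ⊥-elim (q (x , p , opp-pos a x l))
    ... | tri≈ _ e _ = ⊥-elim (q (zero⇒neg (x , p , e)))
    ... | tri> _ _ g = ⊥-elim (r (x , p , g))

  data SameSign (p q : ℚ) : Set where
    both-pos  : 0ℚ < p → 0ℚ < q → SameSign p q
    both-zero : p ≡ 0ℚ → q ≡ 0ℚ → SameSign p q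
    both-neg  : p < 0ℚ → q < 0ℚ → SameSign p q

  SameSigns : ∀ {n} → List (Point n) → Point n → Point n → Set
  SameSigns as x y = All (λ a → SameSign (a ∙ x) (a ∙ y)) as

  -- The last hypothesis says that the pieces cannot tell apart two points of the whole set with
  -- equal signs on `as`. Each cut consumes one functional by making its sign constant, until none
  -- remains and one piece must be everything.
  euler-partition : ∀ {n} (as : List (Point n)) {X₀ : Point n → Set} {z₀ r} (X : Fin r → Point n → Set) (z : Fin r → ℤ) →
    HasEuler X₀ z₀ → (∀ i → HasEuler (X i) (z i)) →
    (∀ i {x} → X i x → X₀ x) →
    (∀ i j {x} → X i x → X j x → i ≡ j) →
    (∀ {x} → X₀ x → ¬ ¬ (∃ λ i → X i x)) →
    (∀ i {x y} → X₀ x → X₀ y → SameSigns as x y → X i x → X i y) →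
    ¬ ¬ (z₀ ≡ ΣF r z)
  euler-partition [] {r = r} X z (us , R , inj₂ (h , refl)) E sub disj cover inv =
    return (sym (ΣF-0 r z (λ i → zero-value i (E i))))
    where
    zero-value : ∀ i → HasEuler (X i) (z i) → z i ≡ 0ℤ
    zero-value i (_ , _ , inj₁ ((x , p) , _)) = ⊥-elim (h x (sub i p))
    zero-value i (_ , _ , inj₂ (_ , e)) = e
  -- No functional is left to separate points: the piece containing `x` is the whole set, and by
  -- disjointness the other pieces are empty.
  euler-partition [] {X₀} {r = r} X z E₀@(us , R , inj₁ ((x , p) , e)) E sub disj cover inv = do
    i , q ← cover p
    return (trans (euler-unique (λ p′ → inv i p p′ [] q) (sub i) E₀ (E i)) (sym (ΣF-single r z i (λ j ne → zero-value i q j ne (E j)))))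
    where
    zero-value : ∀ i → X i x → ∀ j → j ≢ i → HasEuler (X j) (z j) → z j ≡ 0ℤ
    zero-value i q j ne (_ , _ , inj₁ ((y , k) , _)) = ⊥-elim (ne (disj j i k (inv i p (sub j k) [] q)))
    zero-value i q j ne (_ , _ , inj₂ (_ , e)) = e
  euler-partition (a ∷ as) {X₀} {z₀} {r} X z E₀ E sub disj cover inv = do
    z₀⁺ , z₀⁰ , z₀⁻ , E₀⁺ , E₀⁰ , E₀⁻ , e₀ ← cut a E₀
    c ← ¬¬-fin (λ i → cut a (E i))
    e⁺ ← euler-partition as (λ i → X i ∩⁺ a) (λ i → proj₁ (c i)) E₀⁺ (λ i → proj₁ (proj₂ (proj₂ (proj₂ (c i)))))
           (λ i (p , h) → sub i p , h) (λ i j (p , _) (q , _) → disj i j p q)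
           (λ (p , h) → cover p >>= λ (i , q) → return (i , q , h))
           (λ i (p , h) (q , k) s (r , _) → inv i p q (both-pos h k ∷ s) r , k)
    e⁰ ← euler-partition as (λ i → X i ∩⁰ a) (λ i → proj₁ (proj₂ (c i))) E₀⁰ (λ i → proj₁ (proj₂ (proj₂ (proj₂ (proj₂ (c i))))))
           (λ i (p , h) → sub i p , h) (λ i j (p , _) (q , _) → disj i j p q)
           (λ (p , h) → cover p >>= λ (i , q) → return (i , q , h))
           (λ i (p , h) (q , k) s (r , _) → inv i p q (both-zero h k ∷ s) r , k)
    e⁻ ← euler-partition as (λ i → X i ∩⁺ opp a) (λ i → proj₁ (proj₂ (proj₂ (c i)))) E₀⁻ (λ i → proj₁ (proj₂ (proj₂ (proj₂ (proj₂ (proj₂ (c i)))))))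
           (λ i (p , h) → sub i p , h) (λ i j (p , _) (q , _) → disj i j p q)
           (λ (p , h) → cover p >>= λ (i , q) → return (i , q , h))
           (λ i {x} {y} (p , h) (q , k) s (r , _) → inv i p q (both-neg (opp-pos⁻ a x h) (opp-pos⁻ a y k) ∷ s) r , k)
    return (trans e₀ (trans (cong₂ ℤ._+_ e⁺ (cong₂ ℤ._+_ e⁰ e⁻)) (sym
      (trans (ΣF-cong r (λ i → proj₂ (proj₂ (proj₂ (proj₂ (proj₂ (proj₂ (c i))))))))
        (trans (ΣF-+ r _ _) (cong (λ s → ΣF r (λ i → proj₁ (c i)) ℤ.+ s) (ΣF-+ r _ _)))))))

-- Finite subsets as Boolean vectors: membership, cardinality and swaps.

module Subsets where

  open import Data.Nat using (_+_; _≤_; _<_; z≤n; s≤s)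
  open import Data.Nat.Properties
  open import Data.Vec.Properties
  open import Relation.Nullary.Decidable using (T?)

  infix 4 _∈ˢ_ _∉ˢ_ _≼_

  _∈ˢ_ _∉ˢ_ : ∀ {m} → Fin m → Subset m → Set
  x ∈ˢ A = mem x A ≡ true
  x ∉ˢ A = mem x A ≡ false

  _≼_ : ∀ {m} → Subset m → Subset m → Set
  A ≼ B = ∀ x → x ∈ˢ A → x ∈ˢ B

  bool? : ∀ b → (b ≡ true) ⊎ (b ≡ false)
  bool? true  = inj₁ refl
  bool? false = inj₂ refl

  true≢false : ∀ {a} {A : Set a} {b} → b ≡ true → b ≡ false → A
  true≢false refl ()

  ¬true⇒false : ∀ {b} → ¬ (b ≡ true) → b ≡ false
  ¬true⇒false {true}  h = ⊥-elim (h refl)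
  ¬true⇒false {false} h = refl

  ∧-elim : ∀ {a b} → a ∧ b ≡ true → a ≡ true × b ≡ true
  ∧-elim {true} {true} e = refl , refl

  ∧-intro : ∀ {a b} → a ≡ true → b ≡ true → a ∧ b ≡ true
  ∧-intro refl refl = refl

  not-false : ∀ {b} → not b ≡ true → b ≡ false
  not-false {false} e = refl

  <ᵇ⁻ : ∀ a b → (a ℕ.<ᵇ b) ≡ true → a < b
  <ᵇ⁻ a b h = <ᵇ⇒< a b (Equivalence.from T-≡ h)

  <ᵇ⁺ : ∀ {a b} → a < b → (a ℕ.<ᵇ b) ≡ true
  <ᵇ⁺ h = Equivalence.to T-≡ (<⇒<ᵇ h)

  bool-ext : ∀ {a b} → (a ≡ true → b ≡ true) → (b ≡ true → a ≡ true) → a ≡ b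
  bool-ext {true}  {true}  f g = refl
  bool-ext {true}  {false} f g = sym (f refl)
  bool-ext {false} {true}  f g = g refl
  bool-ext {false} {false} f g = refl

  search : ∀ {m} (p : Fin m → Bool) → (∃ λ x → p x ≡ true) ⊎ (∀ x → p x ≡ false)
  search {zero}  p = inj₂ λ ()
  search {suc m} p with bool? (p zero) | search (λ x → p (suc x))
  ... | inj₁ e | _            = inj₁ (zero , e)
  ... | inj₂ e | inj₁ (x , h) = inj₁ (suc x , h)
  ... | inj₂ e | inj₂ h       = inj₂ λ { zero → e ; (suc x) → h x }

  subset-ext : ∀ {m} {A B : Subset m} → (∀ x → mem x A ≡ mem x B) → A ≡ B
  subset-ext {A = A} {B} h = trans (sym (tabulate∘lookup A)) (trans (tabulate-cong h) (tabulate∘lookup B))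

  ≼-antisym : ∀ {m} {A B : Subset m} → A ≼ B → B ≼ A → A ≡ B
  ≼-antisym f g = subset-ext λ x → bool-ext (f x) (g x)

  ≼-trans : ∀ {m} {A B C : Subset m} → A ≼ B → B ≼ C → A ≼ C
  ≼-trans f g x h = g x (f x h)

  module _ {m : ℕ} {x : Fin m} {A B : Subset m} where

    ∈∩⁺ : x ∈ˢ A → x ∈ˢ B → x ∈ˢ A ∩ B
    ∈∩⁺ p q = trans (lookup-zipWith _∧_ x A B) (∧-intro p q)

    ∈∩⁻ : x ∈ˢ A ∩ B → x ∈ˢ A × x ∈ˢ B
    ∈∩⁻ h = ∧-elim (trans (sym (lookup-zipWith _∧_ x A B)) h)

    ∈∪⁺ˡ : x ∈ˢ A → x ∈ˢ A ∪ B
    ∈∪⁺ˡ p = trans (lookup-zipWith _∨_ x A B) (cong (_∨ mem x B) p)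

    ∈∪⁺ʳ : x ∈ˢ B → x ∈ˢ A ∪ B
    ∈∪⁺ʳ p with mem x A in e
    ... | true  = ∈∪⁺ˡ e
    ... | false = trans (lookup-zipWith _∨_ x A B) (trans (cong (_∨ mem x B) e) p)

    ∈∪⁻ : x ∈ˢ A ∪ B → x ∈ˢ A ⊎ x ∈ˢ B
    ∈∪⁻ h with mem x A in e
    ... | true  = inj₁ refl
    ... | false = inj₂ (trans (sym (trans (lookup-zipWith _∨_ x A B) (cong (_∨ mem x B) e))) h)

    ∈∖⁺ : x ∈ˢ A → x ∉ˢ B → x ∈ˢ A ∖ B
    ∈∖⁺ p q = trans (lookup-zipWith _∧_ x A (∁ B)) (∧-intro p (trans (lookup-map x not B) (cong not q)))

    ∈∖⁻ : x ∈ˢ A ∖ B → x ∈ˢ A × x ∉ˢ B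
    ∈∖⁻ h with ∧-elim (trans (sym (lookup-zipWith _∧_ x A (∁ B))) h)
    ... | p , q = p , not-false (trans (sym (lookup-map x not B)) q)

  ∉∅ : ∀ {m} (x : Fin m) → x ∉ˢ ∅ˢ
  ∉∅ x = lookup-replicate x false

  ∈E : ∀ {m} (x : Fin m) → x ∈ˢ Eˢ
  ∈E x = lookup-replicate x true

  ∈⁅⁆ : ∀ {m} (x : Fin m) → x ∈ˢ ⁅ x ⁆
  ∈⁅⁆ zero    = refl
  ∈⁅⁆ (suc x) = ∈⁅⁆ x

  ∈⁅⁆⁻ : ∀ {m} (x y : Fin m) → y ∈ˢ ⁅ x ⁆ → y ≡ x
  ∈⁅⁆⁻ zero    zero    h = refl
  ∈⁅⁆⁻ zero    (suc y) h = true≢false h (∉∅ y)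
  ∈⁅⁆⁻ (suc x) (suc y) h = cong suc (∈⁅⁆⁻ x y h)

  ∩-mono : ∀ {m} {A A′ B B′ : Subset m} → A ≼ A′ → B ≼ B′ → A ∩ B ≼ A′ ∩ B′
  ∩-mono {A = A} {A′} {B} {B′} f g x h = let p , q = ∈∩⁻ {A = A} {B} h in ∈∩⁺ {A = A′} {B′} (f x p) (g x q)

  ∪-mono : ∀ {m} {A A′ B B′ : Subset m} → A ≼ A′ → B ≼ B′ → A ∪ B ≼ A′ ∪ B′
  ∪-mono {A = A} {A′} {B} {B′} f g x h with ∈∪⁻ {A = A} {B} h
  ... | inj₁ p = ∈∪⁺ˡ {A = A′} {B′} (f x p)
  ... | inj₂ q = ∈∪⁺ʳ {A = A′} {B′} (g x q)

  card-mono : ∀ {m} {A B : Subset m} → A ≼ B → ∣ A ∣ ≤ ∣ B ∣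
  card-mono {A = []}        {[]}        h = z≤n
  card-mono {A = false ∷ A} {false ∷ B} h = card-mono {A = A} {B} (λ x → h (suc x))
  card-mono {A = false ∷ A} {true  ∷ B} h = m≤n⇒m≤1+n (card-mono {A = A} {B} (λ x → h (suc x)))
  card-mono {A = true  ∷ A} {true  ∷ B} h = s≤s (card-mono {A = A} {B} (λ x → h (suc x)))
  card-mono {A = true  ∷ A} {false ∷ B} h with h zero refl
  ... | ()

  card-strict : ∀ {m} {A B : Subset m} x → A ≼ B → x ∈ˢ B → x ∉ˢ A → ∣ A ∣ < ∣ B ∣
  card-strict {A = false ∷ A} {true  ∷ B} zero    h p q = s≤s (card-mono {A = A} {B} (λ x → h (suc x)))
  card-strict {A = false ∷ A} {false ∷ B} (suc x) h p q = card-strict {A = A} {B} x (λ x → h (suc x)) p q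
  card-strict {A = false ∷ A} {true  ∷ B} (suc x) h p q = m≤n⇒m≤1+n (card-strict {A = A} {B} x (λ x → h (suc x)) p q)
  card-strict {A = true  ∷ A} {true  ∷ B} (suc x) h p q = s≤s (card-strict {A = A} {B} x (λ x → h (suc x)) p q)
  card-strict {A = true  ∷ A} {false ∷ B} (suc x) h p q with h zero refl
  ... | ()

  card-≥ : ∀ {m} {A B : Subset m} → A ≼ B → ∣ B ∣ ≤ ∣ A ∣ → B ≼ A
  card-≥ {A = A} {B} h c x p with bool? (mem x A)
  ... | inj₁ q = q
  ... | inj₂ q = ⊥-elim (<⇒≱ (card-strict {A = A} {B} x h p q) c)

  card-∖ : ∀ {m} (A B : Subset m) → ∣ A ∩ B ∣ + ∣ B ∖ A ∣ ≡ ∣ B ∣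
  card-∖ []          []          = refl
  card-∖ (true  ∷ A) (true  ∷ B) = cong suc (card-∖ A B)
  card-∖ (true  ∷ A) (false ∷ B) = card-∖ A B
  card-∖ (false ∷ A) (true  ∷ B) = trans (+-suc _ _) (cong suc (card-∖ A B))
  card-∖ (false ∷ A) (false ∷ B) = card-∖ A B

  card-∅ : ∀ {m} → ∣ ∅ˢ {m} ∣ ≡ 0
  card-∅ {zero}  = refl
  card-∅ {suc m} = card-∅ {m}

  card-∪⁅⁆ : ∀ {m} (A : Subset m) x → ∣ A ∪ ⁅ x ⁆ ∣ ≤ suc ∣ A ∣
  card-∪⁅⁆ (true  ∷ A) zero    = s≤s (≤-trans (card-mono {A = A ∪ ∅ˢ} {A} (λ z h → case z h)) (n≤1+n _))
    where
    case : A ∪ ∅ˢ ≼ A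
    case z h with ∈∪⁻ {A = A} {∅ˢ} h
    ... | inj₁ p = p
    ... | inj₂ q = true≢false q (∉∅ z)
  card-∪⁅⁆ (false ∷ A) zero    = s≤s (card-mono {A = A ∪ ∅ˢ} {A} (λ z h → case z h))
    where
    case : A ∪ ∅ˢ ≼ A
    case z h with ∈∪⁻ {A = A} {∅ˢ} h
    ... | inj₁ p = p
    ... | inj₂ q = true≢false q (∉∅ z)
  card-∪⁅⁆ (true  ∷ A) (suc x) = s≤s (card-∪⁅⁆ A x)
  card-∪⁅⁆ (false ∷ A) (suc x) = card-∪⁅⁆ A x

  swap : ∀ {m} → Fin m → Fin m → Subset m → Subset m
  swap x y B = (B [ x ]≔ false) [ y ]≔ true

  card-add : ∀ {m} (A : Subset m) y → y ∉ˢ A → ∣ A [ y ]≔ true ∣ ≡ suc ∣ A ∣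
  card-add (false ∷ A) zero    h = refl
  card-add (true  ∷ A) (suc y) h = cong suc (card-add A y h)
  card-add (false ∷ A) (suc y) h = card-add A y h

  card-remove : ∀ {m} (A : Subset m) x → x ∈ˢ A → suc ∣ A [ x ]≔ false ∣ ≡ ∣ A ∣
  card-remove (true  ∷ A) zero    h = refl
  card-remove (true  ∷ A) (suc y) h = cong suc (card-remove A y h)
  card-remove (false ∷ A) (suc y) h = card-remove A y h

  module _ {m : ℕ} {x y : Fin m} {B : Subset m} where

    remove-∈⁻ : ∀ {z} → z ∈ˢ B [ x ]≔ false → z ≢ x × z ∈ˢ B
    remove-∈⁻ {z} h with z F.≟ x
    ... | yes refl = true≢false h (lookup∘update z B false)
    ... | no ne    = ne , trans (sym (lookup∘update′ ne B false)) h

    remove-∈⁺ : ∀ {z} → z ≢ x → z ∈ˢ B → z ∈ˢ B [ x ]≔ false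
    remove-∈⁺ ne h = trans (lookup∘update′ ne B false) h

    swap-new : y ∈ˢ swap x y B
    swap-new = lookup∘update y (B [ x ]≔ false) true

    swap-∈⁻ : ∀ {z} → z ∈ˢ swap x y B → z ≡ y ⊎ (z ≢ x × z ∈ˢ B)
    swap-∈⁻ {z} h with z F.≟ y
    ... | yes e = inj₁ e
    ... | no ne = inj₂ (remove-∈⁻ (trans (sym (lookup∘update′ ne (B [ x ]≔ false) true)) h))

    swap-∈⁺ : ∀ {z} → z ≢ x → z ∈ˢ B → z ∈ˢ swap x y B
    swap-∈⁺ {z} nx h with z F.≟ y
    ... | yes refl = lookup∘update y (B [ x ]≔ false) true
    ... | no ne = trans (lookup∘update′ ne (B [ x ]≔ false) true) (remove-∈⁺ nx h)

    card-swap : x ∈ˢ B → y ∉ˢ B → ∣ swap x y B ∣ ≡ ∣ B ∣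
    card-swap h k = trans (card-add (B [ x ]≔ false) y y∉) (card-remove B x h)
      where
      y∉ : y ∉ˢ B [ x ]≔ false
      y∉ = ¬true⇒false λ e → true≢false (proj₂ (remove-∈⁻ e)) k

  ∈-allSubsets : ∀ {m} (A : Subset m) → A ∈ allSubsets m
  ∈-allSubsets []          = here refl
  ∈-allSubsets {suc m} (false ∷ A) = ∈-++⁺ˡ (∈-map⁺ (false ∷_) (∈-allSubsets A))
  ∈-allSubsets {suc m} (true  ∷ A) = ∈-++⁺ʳ (L.map (false ∷_) (allSubsets m)) (∈-map⁺ (true ∷_) (∈-allSubsets A))

  ∈-filterᵇ⁺ : ∀ {A : Set} (p : A → Bool) {x xs} → x ∈ xs → p x ≡ true → x ∈ filterᵇ p xs
  ∈-filterᵇ⁺ p x∈ e = ∈-filter⁺ (T? ∘ p) x∈ (Equivalence.from T-≡ e)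

  ∈-filterᵇ⁻ : ∀ {A : Set} (p : A → Bool) {x} xs → x ∈ filterᵇ p xs → x ∈ xs × p x ≡ true
  ∈-filterᵇ⁻ p xs x∈ = let q , t = ∈-filter⁻ (T? ∘ p) {xs = xs} x∈ in q , Equivalence.to T-≡ t

-- Matroid ranks, bases adapted to chains, and symmetric exchange.

module Matroids where

  open import Data.Nat using (_≤_; _<_; z≤n; _⊔_)
  open import Data.Nat.Properties
  open import Data.Vec.Properties using (lookup∘tabulate)
  open Subsets

  max-ub : ∀ {A : Set} (f : A → ℕ) {x} xs → x ∈ xs → f x ≤ maxℕ (map f xs)
  max-ub f (x ∷ xs) (here refl) = m≤m⊔n (f x) _
  max-ub f (x ∷ xs) (there h)   = ≤-trans (max-ub f xs h) (m≤n⊔m (f x) _)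

  max-attained : ∀ {A : Set} (f : A → ℕ) {x} xs → x ∈ xs → ∃ λ y → y ∈ xs × f y ≡ maxℕ (map f xs)
  max-attained f (x ∷ []) _ = x , here refl , sym (⊔-identityʳ (f x))
  max-attained f (x ∷ xs@(z ∷ _)) _ with max-attained f xs (here refl)
  ... | y , y∈ , e with ≤-total (f x) (f y)
  ... | inj₁ le = y , there y∈ , trans (sym (m≤n⇒m⊔n≡n le)) (cong (f x ⊔_) e)
  ... | inj₂ le = x , here refl , trans (sym (m≥n⇒m⊔n≡m le)) (cong (f x ⊔_) e)

  module _ {m : ℕ} (M : Matroid m) where

    IsBasis : Subset m → Set
    IsBasis B = isBasis M B ≡ true

    -- Opaque, since rk would be unfolded to a maximum over all subsets.
    opaque

      rank : Subset m → ℕ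
      rank = rk M

      rank-unfold : ∀ A → rank A ≡ rk M A
      rank-unfold A = refl

      rank-ub : ∀ A {B} → IsBasis B → ∣ A ∩ B ∣ ≤ rank A
      rank-ub A {B} b = max-ub (λ B → ∣ A ∩ B ∣) _ (∈-filterᵇ⁺ (isBasis M) (∈-allSubsets B) b)

      rank-attained : ∀ A → ∃ λ B → IsBasis B × ∣ A ∩ B ∣ ≡ rank A
      rank-attained A with nonempty M
      ... | B , b with max-attained (λ B → ∣ A ∩ B ∣) _ (∈-filterᵇ⁺ (isBasis M) (∈-allSubsets B) b)
      ... | C , c∈ , e = C , proj₂ (∈-filterᵇ⁻ (isBasis M) (allSubsets m) c∈) , e

    rank-least : ∀ A n → (∀ B → IsBasis B → ∣ A ∩ B ∣ ≤ n) → rank A ≤ n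
    rank-least A n h = let B , b , e = rank-attained A in subst (_≤ n) e (h B b)

    rank-mono : ∀ {A A′} → A ≼ A′ → rank A ≤ rank A′
    rank-mono {A} {A′} h = rank-least A _ λ B b → ≤-trans (card-mono {A = A ∩ B} {A′ ∩ B} (∩-mono {A = A} {A′} {B} {B} h (λ _ p → p))) (rank-ub A′ b)

    -- Exchanging against C only elements outside A ∪ C moves B into A ∪ C
    -- without losing anything of A ∩ B.
    exchange-into : ∀ n A B C → IsBasis B → IsBasis C → ∣ B ∖ C ∣ ≤ n →
      ∃ λ B′ → IsBasis B′ × A ∩ B ≼ B′ × (∀ x → x ∈ˢ B′ → x ∈ˢ A ⊎ x ∈ˢ C) × ∣ B′ ∣ ≡ ∣ B ∣
    exchange-into n A B C b c l with search (λ x → mem x B ∧ (not (mem x C) ∧ not (mem x A)))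
    ... | inj₂ none = B , b , (λ x h → proj₂ (∈∩⁻ {A = A} {B} h)) , inside , refl
      where
      inside : ∀ x → x ∈ˢ B → x ∈ˢ A ⊎ x ∈ˢ C
      inside x h with bool? (mem x A) | bool? (mem x C)
      ... | inj₁ p | _      = inj₁ p
      ... | inj₂ _ | inj₁ q = inj₂ q
      ... | inj₂ p | inj₂ q = true≢false (∧-intro h (∧-intro (cong not q) (cong not p))) (none x)
    ... | inj₁ (x , e) with ∧-elim e
    ... | x∈B , e′ with ∧-elim {not (mem x C)} e′
    ... | nC , nA with not-false nC | not-false nA
    ... | x∉C | x∉A with exchange M B C b c x x∈B x∉C
    ... | y , y∈C , y∉B , b″ with n
    ... | zero = ⊥-elim (<⇒≱ (card-strict {A = ∅ˢ} {B ∖ C} x (λ z h → true≢false h (∉∅ z)) (∈∖⁺ {A = B} {C} x∈B x∉C) (∉∅ x)) (≤-trans l z≤n))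
    ... | suc n = let B′ , b′ , keep , into , size = exchange-into n A (swap x y B) C b″ c (≤-pred (≤-trans smaller l))
                  in B′ , b′ , (λ z h → keep z (kept z h)) , into , trans size (card-swap {B = B} x∈B y∉B)
      where
      smaller : ∣ swap x y B ∖ C ∣ < ∣ B ∖ C ∣
      smaller = card-strict {A = swap x y B ∖ C} {B ∖ C} x sub (∈∖⁺ {A = B} {C} x∈B x∉C)
                  (¬true⇒false λ h → gone (proj₁ (∈∖⁻ {A = swap x y B} {C} h)))
        where
        gone : ¬ (x ∈ˢ swap x y B)
        gone h with swap-∈⁻ {x = x} {y} {B} h
        ... | inj₁ refl = true≢false y∈C x∉C
        ... | inj₂ (ne , _) = ne refl
        sub : swap x y B ∖ C ≼ B ∖ C
        sub z h with ∈∖⁻ {A = swap x y B} {C} h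
        ... | p , q with swap-∈⁻ {x = x} {y} {B} p
        ... | inj₁ refl = true≢false y∈C q
        ... | inj₂ (_ , r) = ∈∖⁺ {A = B} {C} r q
      kept : A ∩ B ≼ A ∩ swap x y B
      kept z h with ∈∩⁻ {A = A} {B} h
      ... | p , q = ∈∩⁺ {A = A} {swap x y B} p (swap-∈⁺ {x = x} {y} {B} (λ { refl → true≢false p x∉A }) q)

    basis-maximal : ∀ {B C} → IsBasis B → IsBasis C → B ≼ C → C ≼ B
    basis-maximal {B} {C} b c h x x∈C with bool? (mem x B)
    ... | inj₁ p = p
    ... | inj₂ q with exchange M C B c b x x∈C q
    ... | y , y∈B , y∉C , _ = true≢false (h y y∈B) y∉C

    -- With an empty set to be kept, the exchanges carry `B` into `C` at constant cardinality, and
    -- no basis contains another properly.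
    basis-card : ∀ {B C} → IsBasis B → IsBasis C → ∣ B ∣ ≡ ∣ C ∣
    basis-card {B} {C} b c with exchange-into ∣ B ∖ C ∣ ∅ˢ B C b c ≤-refl
    ... | B′ , b′ , _ , into , size = trans (sym size) (cong ∣_∣ (≼-antisym {A = B′} {C} sub (basis-maximal b′ c sub)))
      where
      sub : B′ ≼ C
      sub x h with into x h
      ... | inj₁ p = true≢false p (∉∅ x)
      ... | inj₂ q = q

    -- All of `B′` outside `A` comes from `C`, and `B′` is as large as `C`, so its part inside `A`
    -- cannot be smaller than that of `C`. Thus what `B` has in `A` is combined with the size that
    -- `C` attains there.
    augment : ∀ A {B C} → IsBasis B → IsBasis C →
      ∃ λ B′ → IsBasis B′ × A ∩ B ≼ B′ × (∀ x → x ∈ˢ B′ → x ∈ˢ A ⊎ x ∈ˢ C) × ∣ A ∩ C ∣ ≤ ∣ A ∩ B′ ∣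
    augment A {B} {C} b c with exchange-into ∣ B ∖ C ∣ A B C b c ≤-refl
    ... | B′ , b′ , keep , into , _ = B′ , b′ , keep , into ,
          +-cancelʳ-≤ ∣ B′ ∖ A ∣ _ _ (≤-trans (+-monoʳ-≤ ∣ A ∩ C ∣ (card-mono {A = B′ ∖ A} {C ∖ A} outside))
            (≤-reflexive (trans (card-∖ A C) (trans (basis-card c b′) (sym (card-∖ A B′))))))
      where
      outside : B′ ∖ A ≼ C ∖ A
      outside x h with ∈∖⁻ {A = B′} {A} h
      ... | p , q with into x p
      ... | inj₁ r = true≢false r q
      ... | inj₂ r = ∈∖⁺ {A = C} {A} r q

    Descending : List (Subset m) → Set
    Descending []       = ⊤
    Descending (A ∷ As) = All (_≼ A) As × Descending As

    -- Greedy from the smallest set upwards: augmenting inside the next larger set keeps the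
    -- intersection of the basis with it, hence with every smaller set, where the rank is already
    -- attained.
    chain-basis : ∀ As → Descending As → ∃ λ B → IsBasis B × All (λ A → ∣ A ∩ B ∣ ≡ rank A) As
    chain-basis []       _       = let B , b = nonempty M in B , b , []
    chain-basis (A ∷ As) (h , d) with chain-basis As d | rank-attained A
    ... | B , b , es | C , c , e with augment A b c
    ... | B′ , b′ , keep , _ , le = B′ , b′ , ≤-antisym (rank-ub A b′) (subst (_≤ ∣ A ∩ B′ ∣) e le) ∷ lower As h es
      where
      lower : ∀ As → All (_≼ A) As → All (λ A → ∣ A ∩ B ∣ ≡ rank A) As → All (λ A → ∣ A ∩ B′ ∣ ≡ rank A) As
      lower []       []       []       = []
      lower (A₁ ∷ As) (h ∷ hs) (e ∷ es) = ≤-antisym (rank-ub A₁ b′) (subst (_≤ ∣ A₁ ∩ B′ ∣) e (card-mono {A = A₁ ∩ B} {A₁ ∩ B′} sub)) ∷ lower As hs es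
        where
        sub : A₁ ∩ B ≼ A₁ ∩ B′
        sub z p = let q , r = ∈∩⁻ {A = A₁} {B} p in ∈∩⁺ {A = A₁} {B′} q (keep z (∈∩⁺ {A = A} {B} (h z q) r))

    -- Take a basis attaining the ranks of A, A′ and A′ ∪ x at once. If the last step grows, the
    -- basis contains `x`, and then it meets A ∪ x in one element more than the rank of `A`.
    rank-closure : ∀ {A A′} x → A ≼ A′ → rank (A ∪ ⁅ x ⁆) ≡ rank A → rank (A′ ∪ ⁅ x ⁆) ≡ rank A′
    rank-closure {A} {A′} x h e with rank (A′ ∪ ⁅ x ⁆) ≤? rank A′
    ... | yes le = ≤-antisym le (rank-mono λ z → ∈∪⁺ˡ {A = A′})
    ... | no nle with chain-basis (A′ ∪ ⁅ x ⁆ ∷ A′ ∷ A ∷ []) (((λ z → ∈∪⁺ˡ {A = A′}) ∷ (λ z p → ∈∪⁺ˡ {A = A′} (h z p)) ∷ []) , (h ∷ []) , [] , tt)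
    ... | B , b , e₁ ∷ e₂ ∷ e₃ ∷ [] = ⊥-elim (<-irrefl refl (<-≤-trans grow (≤-trans (rank-ub (A ∪ ⁅ x ⁆) b) (≤-reflexive (trans e (sym e₃))))))
      where
      x∈B : x ∈ˢ B
      x∈B with bool? (mem x B)
      ... | inj₁ p = p
      ... | inj₂ q = ⊥-elim (nle (subst₂ _≤_ e₁ e₂ (card-mono {A = (A′ ∪ ⁅ x ⁆) ∩ B} {A′ ∩ B} sub)))
        where
        sub : (A′ ∪ ⁅ x ⁆) ∩ B ≼ A′ ∩ B
        sub z k with ∈∩⁻ {A = A′ ∪ ⁅ x ⁆} {B} k
        ... | u , v with ∈∪⁻ {A = A′} u
        ... | inj₁ w = ∈∩⁺ {A = A′} {B} w v
        ... | inj₂ w with ∈⁅⁆⁻ x z w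
        ... | refl = true≢false v q
      x∉A : x ∉ˢ A
      x∉A with bool? (mem x A)
      ... | inj₂ q = q
      ... | inj₁ p = ⊥-elim (nle (≤-reflexive (cong rank (≼-antisym sub (λ z → ∈∪⁺ˡ {A = A′})))))
        where
        sub : A′ ∪ ⁅ x ⁆ ≼ A′
        sub z k with ∈∪⁻ {A = A′} k
        ... | inj₁ w = w
        ... | inj₂ w with ∈⁅⁆⁻ x z w
        ... | refl = h x p
      grow : ∣ A ∩ B ∣ < ∣ (A ∪ ⁅ x ⁆) ∩ B ∣
      grow = card-strict {A = A ∩ B} {(A ∪ ⁅ x ⁆) ∩ B} x (∩-mono {A = A} {A ∪ ⁅ x ⁆} {B} {B} (λ z → ∈∪⁺ˡ {A = A}) (λ _ p → p))
        (∈∩⁺ {A = A ∪ ⁅ x ⁆} {B} (∈∪⁺ʳ {A = A} (∈⁅⁆ x)) x∈B) (¬true⇒false λ k → true≢false (proj₁ (∈∩⁻ {A = A} {B} k)) x∉A)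

    -- Suppose that no y works. The point `x` lies in the closure of `C`, so D ∪ C has full rank,
    -- where `D` is `B₁` without `x`. Extending `D` to a basis inside D ∪ C adds an element y of
    -- `C`, and this y serves for both exchanges. The symmetric form is needed for the faces of
    -- matroid polytopes.
    symmetric-exchange : ∀ B₁ B₂ → IsBasis B₁ → IsBasis B₂ → ∀ x → x ∈ˢ B₁ → x ∉ˢ B₂ →
      ∃ λ y → y ∈ˢ B₂ × y ∉ˢ B₁ × IsBasis (swap x y B₁) × IsBasis (swap y x B₂)
    symmetric-exchange B₁ B₂ b₁ b₂ x x∈B₁ x∉B₂ with search (λ y → (mem y B₂ ∧ isBasis M (swap y x B₂)) ∧ (not (mem y B₁) ∧ isBasis M (swap x y B₁)))
    ... | inj₁ (y , e) with ∧-elim {mem y B₂ ∧ isBasis M (swap y x B₂)} e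
    ... | e₁ , e₂ with ∧-elim {mem y B₂} e₁ | ∧-elim {not (mem y B₁)} e₂
    ... | p , q | r , s = y , p , not-false r , s , q
    symmetric-exchange B₁ B₂ b₁ b₂ x x∈B₁ x∉B₂ | inj₂ none = ⊥-elim (<-irrefl refl (<-≤-trans rank-D (≤-trans full (≤-reflexive closed))))
      where
      -- C is the fundamental circuit of x in B₂, with x removed.
      inC : Fin m → Bool
      inC y = mem y B₂ ∧ isBasis M (swap y x B₂)
      C D : Subset m
      C = tabulate inC
      D = B₁ [ x ]≔ false
      C∋ : ∀ {y} → y ∈ˢ C → y ∈ˢ B₂ × IsBasis (swap y x B₂)
      C∋ {y} h = ∧-elim {mem y B₂} (trans (sym (lookup∘tabulate inC y)) h)
      C∌x : ∀ {y} → y ∈ˢ C → y ≢ x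
      C∌x h refl = true≢false (proj₁ (C∋ h)) x∉B₂
      card-C : ∣ C ∣ ≤ rank C
      card-C = ≤-trans (card-mono {A = C} {C ∩ B₂} (λ z h → ∈∩⁺ {A = C} {B₂} h (proj₁ (C∋ h)))) (rank-ub C b₂)
      -- Such a basis could be moved into B₂ ∪ x while keeping C ∪ x. There it has to omit some y of
      -- `B₂`, which makes it the very swap that puts y into `C`; but `C` was kept.
      dependent : ∀ E → IsBasis E → ¬ (C ∪ ⁅ x ⁆ ≼ E)
      dependent E e h with augment (B₂ ∪ ⁅ x ⁆) e b₂
      ... | B , b , keep , into , _ with search (λ y → mem y B₂ ∧ not (mem y B))
      ... | inj₂ all-in = <-irrefl refl (subst (∣ B₂ ∣ <_) (basis-card b b₂) (card-strict {A = B₂} {B} x B₂≼B x∈B x∉B₂))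
        where
        x∈B : x ∈ˢ B
        x∈B = keep x (∈∩⁺ {A = B₂ ∪ ⁅ x ⁆} {E} (∈∪⁺ʳ {A = B₂} (∈⁅⁆ x)) (h x (∈∪⁺ʳ {A = C} (∈⁅⁆ x))))
        B₂≼B : B₂ ≼ B
        B₂≼B y p with bool? (mem y B)
        ... | inj₁ q = q
        ... | inj₂ q = true≢false (∧-intro p (cong not q)) (all-in y)
      ... | inj₁ (y , k) with ∧-elim {mem y B₂} k
      ... | y∈B₂ , k′ with bool? (mem y B)
      ... | inj₁ q = true≢false k′ (cong not q)
      ... | inj₂ y∉B = true≢false (keep y (∈∩⁺ {A = B₂ ∪ ⁅ x ⁆} {E} (∈∪⁺ˡ {A = B₂} y∈B₂) (h y (∈∪⁺ˡ {A = C} y∈C)))) y∉B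
        where
        sub : B ≼ swap y x B₂
        sub z p with into z p
        ... | inj₂ q = swap-∈⁺ {x = y} {x} {B₂} (λ { refl → true≢false p y∉B }) q
        ... | inj₁ q with ∈∪⁻ {A = B₂} q
        ... | inj₁ r = swap-∈⁺ {x = y} {x} {B₂} (λ { refl → true≢false p y∉B }) r
        ... | inj₂ r with ∈⁅⁆⁻ x z r
        ... | refl = swap-new {x = y} {x} {B₂}
        swapped : IsBasis (swap y x B₂)
        swapped = subst IsBasis (≼-antisym sub (card-≥ {A = B} {swap y x B₂} sub (≤-reflexive (trans (card-swap {B = B₂} y∈B₂ x∉B₂) (basis-card b₂ b))))) b
        y∈C : y ∈ˢ C
        y∈C = trans (lookup∘tabulate inC y) (∧-intro y∈B₂ swapped)
      circuit : rank (C ∪ ⁅ x ⁆) ≡ rank C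
      circuit = ≤-antisym (rank-least (C ∪ ⁅ x ⁆) _ λ E e → bound E e) (rank-mono λ z → ∈∪⁺ˡ {A = C})
        where
        bound : ∀ E → IsBasis E → ∣ (C ∪ ⁅ x ⁆) ∩ E ∣ ≤ rank C
        bound E e with search (λ z → mem z (C ∪ ⁅ x ⁆) ∧ not (mem z E))
        ... | inj₂ none = ⊥-elim (dependent E e λ z p → go z p)
          where
          go : C ∪ ⁅ x ⁆ ≼ E
          go z p with bool? (mem z E)
          ... | inj₁ q = q
          ... | inj₂ q = true≢false (∧-intro p (cong not q)) (none z)
        ... | inj₁ (z , k) with ∧-elim {mem z (C ∪ ⁅ x ⁆)} k
        ... | p , q = ≤-trans (≤-pred (≤-trans (card-strict {A = (C ∪ ⁅ x ⁆) ∩ E} {C ∪ ⁅ x ⁆} z (λ w r → proj₁ (∈∩⁻ {A = C ∪ ⁅ x ⁆} {E} r)) p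
               (¬true⇒false λ r → true≢false q (cong not (proj₂ (∈∩⁻ {A = C ∪ ⁅ x ⁆} {E} r))))) (card-∪⁅⁆ C x))) card-C
      rank-D : rank (D ∪ C) < ∣ B₁ ∣
      rank-D with ∣ B₁ ∣ ≤? rank (D ∪ C)
      ... | no nle = ≰⇒> nle
      ... | yes le with chain-basis (D ∪ C ∷ D ∷ []) (((λ z → ∈∪⁺ˡ {A = D}) ∷ []) , [] , tt)
      ... | E , e , e₁ ∷ e₂ ∷ [] with search (λ y → mem y E ∧ not (mem y D))
      ... | inj₂ all-in = ⊥-elim (<-irrefl refl (≤-trans (≤-reflexive (card-remove B₁ x x∈B₁)) (≤-trans (≤-reflexive (basis-card b₁ e)) (card-mono {A = E} {D} sub))))
        where
        sub : E ≼ D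
        sub z p with bool? (mem z D)
        ... | inj₁ q = q
        ... | inj₂ q = true≢false (∧-intro p (cong not q)) (all-in z)
      ... | inj₁ (y , k) with ∧-elim {mem y E} k
      ... | y∈E , k′ with bool? (mem y D)
      ... | inj₁ q = true≢false k′ (cong not q)
      ... | inj₂ y∉D = true≢false (∧-intro (∧-intro (proj₁ (C∋ y∈C)) (proj₂ (C∋ y∈C))) (∧-intro (cong not y∉B₁) swapped)) (none y)
        where
        D≼E : D ≼ E
        D≼E z p = proj₂ (∈∩⁻ {A = D} {E} (card-≥ {A = D ∩ E} {D} (λ w r → proj₁ (∈∩⁻ {A = D} {E} r)) le-D z p))
          where
          le-D : ∣ D ∣ ≤ ∣ D ∩ E ∣
          le-D = ≤-trans (≤-trans (card-mono {A = D} {D ∩ B₁} (λ w r → ∈∩⁺ {A = D} {B₁} r (proj₂ (remove-∈⁻ {x = x} {y} {B₁} r)))) (rank-ub D b₁)) (≤-reflexive (sym e₂))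
        E≼DC : E ≼ D ∪ C
        E≼DC z p = proj₁ (∈∩⁻ {A = D ∪ C} {E} (card-≥ {A = (D ∪ C) ∩ E} {E} (λ w r → proj₂ (∈∩⁻ {A = D ∪ C} {E} r))
                     (≤-trans (≤-reflexive (basis-card e b₁)) (≤-trans le (≤-reflexive (sym e₁)))) z p))
        y∈C : y ∈ˢ C
        y∈C with ∈∪⁻ {A = D} (E≼DC y y∈E)
        ... | inj₁ p = true≢false p y∉D
        ... | inj₂ p = p
        y∉B₁ : y ∉ˢ B₁
        y∉B₁ = ¬true⇒false λ p → true≢false (remove-∈⁺ {x = x} {y} {B₁} (C∌x y∈C) p) y∉D
        sub : swap x y B₁ ≼ E
        sub z p with swap-∈⁻ {x = x} {y} {B₁} p
        ... | inj₁ refl = y∈E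
        ... | inj₂ (ne , q) = D≼E z (remove-∈⁺ {x = x} {y} {B₁} ne q)
        swapped : IsBasis (swap x y B₁)
        swapped = subst IsBasis (sym (≼-antisym sub (card-≥ {A = swap x y B₁} {E} sub (≤-reflexive (trans (basis-card e b₁) (sym (card-swap {B = B₁} x∈B₁ y∉B₁))))))) e
      closed : rank ((D ∪ C) ∪ ⁅ x ⁆) ≡ rank (D ∪ C)
      closed = rank-closure x (λ z → ∈∪⁺ʳ {A = D}) circuit
      full : ∣ B₁ ∣ ≤ rank ((D ∪ C) ∪ ⁅ x ⁆)
      full = ≤-trans (card-mono {A = B₁} {((D ∪ C) ∪ ⁅ x ⁆) ∩ B₁} (λ z p → ∈∩⁺ {A = (D ∪ C) ∪ ⁅ x ⁆} {B₁} (go z p) p)) (rank-ub _ b₁)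
        where
        go : B₁ ≼ (D ∪ C) ∪ ⁅ x ⁆
        go z p with z F.≟ x
        ... | yes refl = ∈∪⁺ʳ {A = D ∪ C} (∈⁅⁆ x)
        ... | no ne    = ∈∪⁺ˡ {A = D ∪ C} (∈∪⁺ˡ {A = D} (remove-∈⁺ {x = x} {x} {B₁} ne p))

-- Faces of 0/1 polytopes and their relative interiors.

module Faces where

  open import Data.Rational as Q using (ℚ; 0ℚ; 1ℚ; _≤_; _<_)
  open import Data.Rational.Properties using (_≟_; ≤-refl; ≤-reflexive; ≤-antisym; <⇒≤; <-irrefl; <-≤-trans; <-cmp; ≰⇒>)
  open OpaqueRational
  open Cones
  open Euler
  open Subsets
  open Matroids
  open import Relation.Nullary.Decidable using (dec-true)

  -- Polytopes are handled as cones over {1} × Q; coordinate zero is the height.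
  ê : ∀ {m} → Subset m → Point (suc m)
  ê B zero    = 1ℚ
  ê B (suc i) = e B i

  select : ∀ {m} → (Subset m → Bool) → List (Subset m) → List (Point (suc m))
  select p []       = []
  select p (B ∷ Bs) = if p B then ê B ∷ select p Bs else select p Bs

  verts : ∀ {m} → (Subset m → Bool) → List (Point (suc m))
  verts p = select p (allSubsets _)

  ≤∧≢⇒< : ∀ {p q} → p ≤ q → p ≢ q → p < q
  ≤∧≢⇒< {p} {q} h k with <-cmp p q
  ... | tri< l _ _ = l
  ... | tri≈ _ e _ = ⊥-elim (k e)
  ... | tri> _ _ g = ⊥-elim (<-irrefl refl (<-≤-trans g h))

  opaque

    isZero : ℚ → Bool
    isZero p = does (p ≟ 0ℚ)

    isZero⁺ : ∀ {p} → p ≡ 0ℚ → isZero p ≡ true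
    isZero⁺ {p} = dec-true (p ≟ 0ℚ)

    isZero⁻ : ∀ {p} → isZero p ≡ true → p ≡ 0ℚ
    isZero⁻ {p} h with p ≟ 0ℚ
    ... | yes e = e

  module _ {m : ℕ} where

    all-select⁺ : ∀ {Q : Point (suc m) → Set} (p : Subset m → Bool) Bs → (∀ B → p B ≡ true → Q (ê B)) → All Q (select p Bs)
    all-select⁺ p []       h = []
    all-select⁺ p (B ∷ Bs) h with p B in eq
    ... | true  = h B eq ∷ all-select⁺ p Bs h
    ... | false = all-select⁺ p Bs h

    all-select⁻ : ∀ {Q : Point (suc m) → Set} (p : Subset m → Bool) {B} Bs → All Q (select p Bs) → B ∈ Bs → p B ≡ true → Q (ê B)
    all-select⁻ p (B ∷ Bs) qs B∈ eq with p B in eq′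
    all-select⁻ p (B ∷ Bs) (q ∷ qs) (here refl) eq | true  = q
    all-select⁻ p (B ∷ Bs) (q ∷ qs) (there B∈)  eq | true  = all-select⁻ p Bs qs B∈ eq
    all-select⁻ p (B ∷ Bs) qs       (here refl) eq | false = true≢false eq eq′
    all-select⁻ p (B ∷ Bs) qs       (there B∈)  eq | false = all-select⁻ p Bs qs B∈ eq

    all-verts⁺ : ∀ {Q : Point (suc m) → Set} (p : Subset m → Bool) → (∀ B → p B ≡ true → Q (ê B)) → All Q (verts p)
    all-verts⁺ p = all-select⁺ p (allSubsets m)

    all-verts⁻ : ∀ {Q : Point (suc m) → Set} (p : Subset m → Bool) → All Q (verts p) → ∀ B → p B ≡ true → Q (ê B)
    all-verts⁻ p qs B = all-select⁻ p (allSubsets m) qs (∈-allSubsets B)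

    select-cong : ∀ {p q : Subset m → Bool} → (∀ B → p B ≡ q B) → ∀ Bs → select p Bs ≡ select q Bs
    select-cong h []       = refl
    select-cong h (B ∷ Bs) = cong₂ (λ b gs → if b then ê B ∷ gs else gs) (h B) (select-cong h Bs)

    cone-select : ∀ {p q : Subset m → Bool} → (∀ B → p B ≡ true → q B ≡ true) → ∀ Bs {x} → Cone (select p Bs) x → Cone (select q Bs) x
    cone-select h []       c = c
    cone-select {p} {q} h (B ∷ Bs) c with p B in ep | q B in eq
    cone-select h (B ∷ Bs) (t , 0≤t , c) | true  | true  = t , 0≤t , cone-select h Bs c
    cone-select h (B ∷ Bs) c             | true  | false = true≢false (h B ep) eq
    cone-select h (B ∷ Bs) c             | false | true  = comb-∷ ≤-refl (ê B) _ (cone-select h Bs c)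
    cone-select h (B ∷ Bs) c             | false | false = cone-select h Bs c

    verts-cong : ∀ {p q : Subset m → Bool} → (∀ B → p B ≡ q B) → verts p ≡ verts q
    verts-cong h = select-cong h (allSubsets m)

    cone-verts : ∀ {p q : Subset m → Bool} → (∀ B → p B ≡ true → q B ≡ true) → ∀ {x} → Cone (verts p) x → Cone (verts q) x
    cone-verts h = cone-select h (allSubsets m)

    vertex-cone : ∀ (p : Subset m → Bool) B → p B ≡ true → Cone (verts p) (ê B)
    vertex-cone p B pB = self (allSubsets m) (∈-allSubsets B)
      where
      self : ∀ Bs → B ∈ Bs → Cone (select p Bs) (ê B)
      self (B ∷ Bs) (here refl) rewrite pB = 1ℚ , <⇒≤ 0<1 , comb-0 ≤-refl (select p Bs) (λ i → solve 1 (λ g → g :- con 1ℚ :* g := con 0ℚ) refl (ê B i))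
      self (C ∷ Bs) (there B∈) with p C
      ... | true  = comb-∷ ≤-refl (ê C) _ (self Bs B∈)
      ... | false = self Bs B∈

    -- The terms of the value of `a` are nonpositive and add up to zero, so a generator off the
    -- hyperplane has coefficient zero and may be left out.
    cone-face : ∀ (p : Subset m → Bool) (a : Point (suc m)) Bs → (∀ B → p B ≡ true → a ∙ ê B ≤ 0ℚ) → ∀ {x} →
      Cone (select p Bs) x → a ∙ x ≡ 0ℚ → Cone (select (λ B → p B ∧ isZero (a ∙ ê B)) Bs) x
    cone-nonpos : ∀ (a : Point (suc m)) gs → All (λ g → a ∙ g ≤ 0ℚ) gs → ∀ {x} → Cone gs x → a ∙ x ≤ 0ℚ

    cone-nonpos a []       []       c = ≤-reflexive (trans (∙-congʳ a c) (∙-𝟎 a))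
    cone-nonpos a (g ∷ gs) (h ∷ hs) {x} (t , 0≤t , c) = subst (_≤ 0ℚ)
      (trans (cong (t * (a ∙ g) +_) (∙-sub a x t g)) (solve 3 (λ x t g → t :* g :+ (x :- t :* g) := x) refl (a ∙ x) t (a ∙ g)))
      (nonpos-+ (*-nonneg-nonpos 0≤t h) (cone-nonpos a gs hs c))

    head-tail-zero : ∀ (a x : Point (suc m)) t g → t * (a ∙ g) ≤ 0ℚ → a ∙ (x -[ t ] g) ≤ 0ℚ → a ∙ x ≡ 0ℚ → t * (a ∙ g) ≡ 0ℚ × a ∙ (x -[ t ] g) ≡ 0ℚ
    head-tail-zero a x t g h k ex = sum-nonpos-zero h k
      (trans (cong (t * (a ∙ g) +_) (∙-sub a x t g)) (trans (solve 3 (λ x t g → t :* g :+ (x :- t :* g) := x) refl (a ∙ x) t (a ∙ g)) ex))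

    cone-face p a []       h c ex = c
    cone-face p a (B ∷ Bs) h {x} c ex = go (p B) refl c
      where
      q : Subset m → Bool
      q B = p B ∧ isZero (a ∙ ê B)
      go : ∀ b → p B ≡ b → Cone (if b then ê B ∷ select p Bs else select p Bs) x →
           Cone (if b ∧ isZero (a ∙ ê B) then ê B ∷ select q Bs else select q Bs) x
      go false ep c             = cone-face p a Bs h c ex
      go true  ep (t , 0≤t , c) = go′ (isZero (a ∙ ê B)) refl
        where
        zeros : t * (a ∙ ê B) ≡ 0ℚ × a ∙ (x -[ t ] ê B) ≡ 0ℚ
        zeros = head-tail-zero a x t (ê B) (*-nonneg-nonpos 0≤t (h B ep)) (cone-nonpos a (select p Bs) (all-select⁺ p Bs h) c) ex
        rest : Cone (select q Bs) (x -[ t ] ê B)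
        rest = cone-face p a Bs h c (proj₂ zeros)
        go′ : ∀ z → isZero (a ∙ ê B) ≡ z → Cone (if z then ê B ∷ select q Bs else select q Bs) x
        go′ true  ez = t , 0≤t , rest
        go′ false ez = comb-resp (select q Bs) (λ i → trans (cong (λ s → x i - s * ê B i) t≡0)
            (solve 2 (λ x g → x :- con 0ℚ :* g := x) refl (x i) (ê B i))) rest
          where
          t≡0 : t ≡ 0ℚ
          t≡0 = *-zero-product (λ e → true≢false (isZero⁺ e) ez) (trans (*-comm (a ∙ ê B) t) (proj₁ zeros))

    -- With positive coefficients, nonpositive values can add up to zero only if each of them is
    -- zero. Geometrically, a face that meets the relative interior is the whole cone.
    pos-vanish : ∀ (a : Point (suc m)) gs → All (λ g → a ∙ g ≤ 0ℚ) gs → ∀ {x} → Pos gs x → a ∙ x ≡ 0ℚ → All (λ g → a ∙ g ≡ 0ℚ) gs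
    pos-vanish a []       []       c ex = []
    pos-vanish a (g ∷ gs) (h ∷ hs) {x} (t , 0<t , c) ex =
      let e₁ , e₂ = head-tail-zero a x t g (*-nonneg-nonpos (<⇒≤ 0<t) h) (cone-nonpos a gs hs (comb-weaken <⇒≤ gs c)) ex
      in *-zero-product (pos⇒≢0 0<t) e₁ ∷ pos-vanish a gs hs c e₂

    -- Used in two roles: the sum of generators is a point of the relative interior of their cone,
    -- and a sum of functionals that are nonpositive at a point vanishes there exactly when all of
    -- them do.
    vsum : List (Point (suc m)) → Point (suc m)
    vsum []       = 𝟎
    vsum (g ∷ gs) = g ⊕ vsum gs

    vsum-pos : ∀ gs → Pos gs (vsum gs)
    vsum-pos []       i = refl
    vsum-pos (g ∷ gs) = 1ℚ , 0<1 , comb-resp gs (λ i → solve 2 (λ b g → b := (g :+ b) :- con 1ℚ :* g) refl (vsum gs i) (g i)) (vsum-pos gs)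

    pos⇒cone : ∀ (gs : List (Point (suc m))) {x} → Pos gs x → Cone gs x
    pos⇒cone = comb-weaken <⇒≤

    pos⇒span : ∀ (gs : List (Point (suc m))) {x} → Pos gs x → Span gs x
    pos⇒span = comb-weaken (λ _ → tt)

    pos+cone : ∀ (gs : List (Point (suc m))) {x y} → Pos gs x → Cone gs y → Pos gs (x ⊕ y)
    pos+cone = comb-⊕ (λ {s} {t} p q → <-≤-trans p (subst (_≤ s + t) (+-identityʳ s) (+-monoʳ-≤ s q)))

    pos-⊕ : ∀ (gs : List (Point (suc m))) {x y} → Pos gs x → Pos gs y → Pos gs (x ⊕ y)
    pos-⊕ = comb-⊕ 0<+

    pos-⊙ : ∀ (gs : List (Point (suc m))) {x} t → 0ℚ < t → Pos gs x → Pos gs (t ⊙ x)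
    pos-⊙ gs t h = comb-scale t (0<* h) gs

    pos-nudge : ∀ (gs : List (Point (suc m))) {x v} → Pos gs x → Span gs v → Small (λ δ → Pos gs (x ⊕ δ ⊙ v))
    pos-nudge []       {x} {v} p s = 1ℚ , 0<1 , λ δ _ _ i → trans (cong₂ (λ p q → p + δ * q) (p i) (s i)) (solve 1 (λ δ → con 0ℚ :+ δ :* con 0ℚ := con 0ℚ) refl δ)
    pos-nudge (g ∷ gs) {x} {v} (t , h , p) (c , _ , s) = small-map
      (λ δ _ (k , q) → t + δ * c , k , comb-resp gs (λ i → solve 6 (λ x t g δ v c → (x :- t :* g) :+ δ :* (v :- c :* g) := (x :+ δ :* v) :- (t :+ δ :* c) :* g) refl
           (x i) t (g i) δ (v i) c) q)
      (small-× (small-pos t c h) (pos-nudge gs p s))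

    -- The rows tight at x add up to a functional exposing the face with x
    -- in its relative interior.
    tight : List (Point (suc m)) → Point (suc m) → List (Point (suc m))
    tight rs x = filter (λ r → r ∙ x ≟ 0ℚ) rs

    vsum-vanish : ∀ rs x → All (λ r → r ∙ x ≡ 0ℚ) rs → vsum rs ∙ x ≡ 0ℚ
    vsum-vanish []       x []       = 𝟎-∙ x
    vsum-vanish (r ∷ rs) x (h ∷ hs) = trans (trans (∙-comm (r ⊕ vsum rs) x) (∙-⊕ x r (vsum rs)))
      (trans (cong₂ _+_ (trans (∙-comm x r) h) (trans (∙-comm x (vsum rs)) (vsum-vanish rs x hs))) (+-identityʳ 0ℚ))

    vsum-nonpos : ∀ rs x → Satisfies rs x → vsum rs ∙ x ≤ 0ℚ
    vsum-nonpos []       x []       = ≤-reflexive (𝟎-∙ x)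
    vsum-nonpos (r ∷ rs) x (h ∷ hs) = subst (_≤ 0ℚ) (sym (trans (∙-comm (r ⊕ vsum rs) x) (trans (∙-⊕ x r (vsum rs)) (cong₂ _+_ (∙-comm x r) (∙-comm x (vsum rs))))))
      (nonpos-+ h (vsum-nonpos rs x hs))

    vsum-tight : ∀ rs x → Satisfies rs x → vsum rs ∙ x ≡ 0ℚ → All (λ r → r ∙ x ≡ 0ℚ) rs
    vsum-tight []       x []       ex = []
    vsum-tight (r ∷ rs) x (h ∷ hs) ex with sum-nonpos-zero h (vsum-nonpos rs x hs)
        (trans (cong₂ _+_ (∙-comm r x) (∙-comm (vsum rs) x)) (trans (sym (∙-⊕ x r (vsum rs))) (trans (∙-comm x (r ⊕ vsum rs)) ex)))
    ... | e₁ , e₂ = e₁ ∷ vsum-tight rs x hs e₂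

    faceOn : (Subset m → Bool) → Point (suc m) → Subset m → Bool
    faceOn p a B = p B ∧ isZero (a ∙ ê B)

    -- Homogeneous form of a face: the height coordinate of `normal` absorbs the constant of the
    -- supporting hyperplane. The predicates are Boolean so that lists of vertices can be computed
    -- from them.
    record HFace (p q : Subset m → Bool) : Set where
      field
        normal : Point (suc m)
        below  : ∀ B → p B ≡ true → normal ∙ ê B ≤ 0ℚ
        on⁻    : ∀ B → q B ≡ true → p B ≡ true × normal ∙ ê B ≡ 0ℚ
        on⁺    : ∀ B → p B ≡ true → normal ∙ ê B ≡ 0ℚ → q B ≡ true
    open HFace public

    faceOn-face : ∀ p a → (∀ B → p B ≡ true → a ∙ ê B ≤ 0ℚ) → HFace p (faceOn p a)
    faceOn-face p a h = record
      { normal = a ; below = h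
      ; on⁻ = λ B k → let k₁ , k₂ = ∧-elim {p B} k in k₁ , isZero⁻ k₂
      ; on⁺ = λ B k₁ k₂ → ∧-intro k₁ (isZero⁺ k₂) }

    face-vanish : ∀ {p q} (F : HFace p q) {x} → Cone (verts q) x → normal F ∙ x ≡ 0ℚ
    face-vanish {q = q} F c = vanish-span (normal F) (verts q) (all-verts⁺ q (λ B k → proj₂ (on⁻ F B k))) (comb-weaken (λ _ → tt) (verts q) c)

    pos-in-face : ∀ {p q r} (F : HFace p q) → (∀ B → r B ≡ true → p B ≡ true) → ∀ {x} → Pos (verts r) x → normal F ∙ x ≡ 0ℚ →
                  ∀ B → r B ≡ true → q B ≡ true
    pos-in-face {r = r} F sub pr ex B rB = on⁺ F B (sub B rB)
      (all-verts⁻ r (pos-vanish (normal F) (verts r) (all-verts⁺ r (λ B k → below F B (sub B k))) pr ex) B rB)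

    -- Each of the two faces contains a relatively interior point of the other, and hence all of its
    -- vertices.
    face-unique : ∀ {p q r} → HFace p q → HFace p r → ∀ {x} → Pos (verts q) x → Pos (verts r) x → ∀ B → q B ≡ r B
    face-unique {q = q} {r} F G pq pr B = bool-ext
      (pos-in-face G (λ B k → proj₁ (on⁻ F B k)) pq (face-vanish G (pos⇒cone (verts r) pr)) B)
      (pos-in-face F (λ B k → proj₁ (on⁻ G B k)) pr (face-vanish F (pos⇒cone (verts q) pq)) B)

    module MinFace (p : Subset m → Bool) (x : Point (suc m)) (sat : Satisfies (rows (verts p)) x) where

      rs : List (Point (suc m))
      rs = rows (verts p)

      w : Point (suc m)
      w = vsum (tight rs x)

      tight-∈ : ∀ {r} → r ∈ tight rs x → r ∈ rs × r ∙ x ≡ 0ℚ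
      tight-∈ = ∈-filter⁻ (λ r → r ∙ x ≟ 0ℚ) {xs = rs}

      vertex-sat : ∀ B → p B ≡ true → Satisfies rs (ê B)
      vertex-sat B pB = cone⇒rows (verts p) (vertex-cone p B pB)

      tight-sat : ∀ y → Satisfies rs y → Satisfies (tight rs x) y
      tight-sat y s = All.tabulate λ r∈ → All.lookup s (proj₁ (tight-∈ r∈))

      minFace : HFace p (faceOn p w)
      minFace = faceOn-face p w λ B pB → vsum-nonpos (tight rs x) (ê B) (tight-sat (ê B) (vertex-sat B pB))

      q : Subset m → Bool
      q = faceOn p w

      w∙x : w ∙ x ≡ 0ℚ
      w∙x = vsum-vanish (tight rs x) x (All.tabulate λ r∈ → proj₂ (tight-∈ r∈))

      b : Point (suc m)
      b = vsum (verts q)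

      tight-b : ∀ {r} → r ∈ tight rs x → r ∙ b ≡ 0ℚ
      tight-b {r} r∈ = vanish-span r (verts q) (all-verts⁺ q zero-on) (pos⇒span (verts q) (vsum-pos (verts q)))
        where
        zero-on : ∀ B → q B ≡ true → r ∙ ê B ≡ 0ℚ
        zero-on B qB = let pB , eB = on⁻ minFace B qB in
          All.lookup (vsum-tight (tight rs x) (ê B) (tight-sat (ê B) (vertex-sat B pB)) eB) r∈

      -- Rows tight at `x` vanish on the whole face and so on `b`; the remaining rows are strictly
      -- negative at `x` and stay so for small δ.
      step : Small (λ δ → Satisfies rs (x -[ δ ] b))
      step = small-all rs (All.tabulate λ {r} r∈ → one r r∈)
        where
        one : ∀ r → r ∈ rs → Small (λ δ → r ∙ (x -[ δ ] b) ≤ 0ℚ)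
        one r r∈ with r ∙ x ≟ 0ℚ
        ... | yes e = 1ℚ , 0<1 , λ δ _ _ → ≤-reflexive (trans (∙-sub r x δ b)
                        (trans (cong₂ (λ s t → s - δ * t) e (tight-b (∈-filter⁺ (λ r → r ∙ x ≟ 0ℚ) r∈ e))) (solve 1 (λ δ → con 0ℚ :- δ :* con 0ℚ := con 0ℚ) refl δ)))
        ... | no ne = small-map (λ δ _ h → subst (_≤ 0ℚ) (trans (solve 3 (λ s δ t → :- ((:- s) :+ δ :* t) := s :- δ :* t) refl (r ∙ x) δ (r ∙ b)) (sym (∙-sub r x δ b))) (<⇒≤ (pos⇒neg h)))
                        (small-pos (- (r ∙ x)) (r ∙ b) (neg⇒pos (≤∧≢⇒< (All.lookup sat r∈) ne)))

      -- Writes `x` as δb plus a remainder that is still in the cone and on the hyperplane of `w`,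
      -- hence in the cone of the face. The first summand alone makes all coefficients positive.
      pos-minFace : Pos (verts q) x
      pos-minFace =
        let δ , 0<δ , s = small-witness step
            c  = rows⇒cone (verts p) s
            wz = trans (∙-sub w x δ b) (trans (cong₂ (λ s t → s - δ * t) w∙x (face-vanish minFace (pos⇒cone (verts q) (vsum-pos (verts q)))))
                   (solve 1 (λ δ → con 0ℚ :- δ :* con 0ℚ := con 0ℚ) refl δ))
            c′ = cone-face p w (allSubsets m) (below minFace) c wz
        in comb-resp (verts q) (λ i → solve 3 (λ x δ b → δ :* b :+ (x :- δ :* b) := x) refl (x i) δ (b i))
             (pos+cone (verts q) (pos-⊙ (verts q) δ 0<δ (vsum-pos (verts q))) c′)

    tight-same : ∀ (rs : List (Point (suc m))) {x y} → SameSigns rs x y → tight rs x ≡ tight rs y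
    tight-same []       []       = refl
    tight-same (r ∷ rs) {x} {y} (s ∷ ss) with r ∙ x ≟ 0ℚ | r ∙ y ≟ 0ℚ | s
    ... | yes _ | yes _ | _ = cong (r ∷_) (tight-same rs ss)
    ... | no _  | no _  | _ = tight-same rs ss
    ... | yes e | no _  | both-pos h _  = ⊥-elim (pos⇒≢0 h e)
    ... | yes _ | no k  | both-zero _ e = ⊥-elim (k e)
    ... | yes e | no _  | both-neg h _  = ⊥-elim (<-irrefl e h)
    ... | no _  | yes e | both-pos _ h  = ⊥-elim (pos⇒≢0 h e)
    ... | no k  | yes _ | both-zero e _ = ⊥-elim (k e)
    ... | no _  | yes e | both-neg _ h  = ⊥-elim (<-irrefl e h)

    satisfies-same : ∀ (rs : List (Point (suc m))) {x y} → SameSigns rs x y → Satisfies rs x → Satisfies rs y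
    satisfies-same []       []       []       = []
    satisfies-same (r ∷ rs) (both-pos h _ ∷ ss)  (k ∷ ks) = ⊥-elim (<-irrefl refl (<-≤-trans h k))
    satisfies-same (r ∷ rs) (both-zero _ e ∷ ss) (k ∷ ks) = ≤-reflexive e ∷ satisfies-same rs ss ks
    satisfies-same (r ∷ rs) (both-neg _ h ∷ ss)  (k ∷ ks) = <⇒≤ h ∷ satisfies-same rs ss ks

    -- The face with a given point in its relative interior is exposed by the sum of the rows tight
    -- there, so it depends on the signs of the rows only. This is why the cuts of `euler-partition`
    -- end in single faces.
    face-by-signs : ∀ {p q} → HFace p q → ∀ {x y} → SameSigns (rows (verts p)) x y → Pos (verts q) x → Pos (verts q) y
    face-by-signs {p} {q} F {x} {y} ss pq = subst (λ gs → Pos gs y) (verts-cong (λ B → trans (cong (λ w → faceOn p w B) (cong vsum (sym (tight-same (rows (verts p)) {x} {y} ss))))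
          (sym (face-unique F X.minFace pq X.pos-minFace B)))) Y.pos-minFace
      where
      satx : Satisfies (rows (verts p)) x
      satx = cone⇒rows (verts p) (cone-verts (λ B k → proj₁ (on⁻ F B k)) (pos⇒cone (verts q) pq))
      module X = MinFace p x satx
      saty : Satisfies (rows (verts p)) y
      saty = satisfies-same (rows (verts p)) {x} {y} ss satx
      module Y = MinFace p y saty

    -- Otherwise the negated height, negative on all generators, would vanish at `x` and then at a
    -- vertex, where it is -1.
    pos-height : ∀ (q : Subset m → Bool) {B x} → q B ≡ true → Pos (verts q) x → 0ℚ < x zero
    pos-height q {B} {x} qB px = ≰⇒> λ h → <-irrefl (trans (sym (depth (ê B))) (all-verts⁻ q (pos-vanish (opp unit₀) (verts q) below′ px
        (≤-antisym (cone-nonpos (opp unit₀) (verts q) below′ (pos⇒cone (verts q) px)) (subst (0ℚ ≤_) (sym (depth x)) (nonpos⇒0≤ h)))) B qB)) (pos⇒neg 0<1)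
      where
      depth : ∀ y → opp unit₀ ∙ y ≡ - y zero
      depth y = trans (opp-∙ unit₀ y) (cong -_ (unit₀-∙ y))
      below′ : All (λ g → opp unit₀ ∙ g ≤ 0ℚ) (verts q)
      below′ = all-verts⁺ q λ B _ → subst (_≤ 0ℚ) (sym (depth (ê B))) (<⇒≤ (pos⇒neg 0<1))

    opaque
      unfolding _∙_

      ∙-add : ∀ {n} (a : Point n) (B : Subset n) y → y ∉ˢ B → a ∙ e (B [ y ]≔ true) ≡ a ∙ e B + a y
      ∙-add a (false ∷ B) zero    h = solve 2 (λ a r → a :* con 1ℚ :+ r := (a :* con 0ℚ :+ r) :+ a) refl (a zero) ((tl a) ∙ e B)
      ∙-add a (c ∷ B)     (suc y) h = trans (cong (λ s → a zero * (if c then 1ℚ else 0ℚ) + s) (∙-add (tl a) B y h))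
        (solve 3 (λ p q r → p :+ (q :+ r) := (p :+ q) :+ r) refl (a zero * (if c then 1ℚ else 0ℚ)) ((tl a) ∙ e B) (a (suc y)))

      ∙-remove : ∀ {n} (a : Point n) (B : Subset n) y → y ∈ˢ B → a ∙ e (B [ y ]≔ false) ≡ a ∙ e B - a y
      ∙-remove a (true ∷ B) zero    h = solve 2 (λ a r → a :* con 0ℚ :+ r := (a :* con 1ℚ :+ r) :- a) refl (a zero) ((tl a) ∙ e B)
      ∙-remove a (c ∷ B)    (suc y) h = trans (cong (λ s → a zero * (if c then 1ℚ else 0ℚ) + s) (∙-remove (tl a) B y h))
        (solve 3 (λ p q r → p :+ (q :- r) := (p :+ q) :- r) refl (a zero * (if c then 1ℚ else 0ℚ)) ((tl a) ∙ e B) (a (suc y)))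

    ∙-swap : ∀ (a : Point (suc m)) (B : Subset m) x y → x ∈ˢ B → y ∉ˢ B → a ∙ ê (swap x y B) ≡ a ∙ ê B - a (suc x) + a (suc y)
    ∙-swap a B x y hx hy = trans (trans (∙-suc a (ê (swap x y B))) (cong (a zero * 1ℚ +_) (trans (∙-add (tl a) (B [ x ]≔ false) y y∉) (cong (_+ a (suc y)) (∙-remove (tl a) B x hx)))))
      (trans (solve 4 (λ c r x y → c :+ ((r :- x) :+ y) := ((c :+ r) :- x) :+ y) refl (a zero * 1ℚ) ((tl a) ∙ e B) (a (suc x)) (a (suc y)))
        (cong (λ s → s - a (suc x) + a (suc y)) (sym (∙-suc a (ê B)))))
      where
      y∉ : y ∉ˢ B [ x ]≔ false
      y∉ = ¬true⇒false λ k → true≢false (proj₂ (remove-∈⁻ {x = x} {y} {B} k)) hy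

    -- The two swaps of a symmetric exchange together use the same elements as the two original
    -- bases, so the values of `a` on them add up to zero. Being nonpositive, both vanish, and the
    -- swapped basis stays on the face.
    faceMatroid : (N : Matroid m) (a : Point (suc m)) → (∀ B → isBasis N B ≡ true → a ∙ ê B ≤ 0ℚ) →
                  (∃ λ B → faceOn (isBasis N) a B ≡ true) → Matroid m
    faceMatroid N a h ne = record
      { isBasis = faceOn (isBasis N) a
      ; nonempty = ne
      ; exchange = ex }
      where
      ex : ∀ B₁ B₂ → faceOn (isBasis N) a B₁ ≡ true → faceOn (isBasis N) a B₂ ≡ true → ∀ x → x ∈ˢ B₁ → x ∉ˢ B₂ →
           ∃ λ y → y ∈ˢ B₂ × y ∉ˢ B₁ × faceOn (isBasis N) a (swap x y B₁) ≡ true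
      ex B₁ B₂ f₁ f₂ x x∈ x∉ =
        let F = faceOn-face (isBasis N) a h
            b₁ , e₁ = on⁻ F B₁ f₁
            b₂ , e₂ = on⁻ F B₂ f₂
            y , y∈ , y∉ , c₁ , c₂ = symmetric-exchange N B₁ B₂ b₁ b₂ x x∈ x∉
            sum0 : a ∙ ê (swap x y B₁) + a ∙ ê (swap y x B₂) ≡ 0ℚ
            sum0 = trans (cong₂ _+_ (trans (∙-swap a B₁ x y x∈ y∉) (cong (λ s → s - a (suc x) + a (suc y)) e₁))
                                    (trans (∙-swap a B₂ y x y∈ x∉) (cong (λ s → s - a (suc y) + a (suc x)) e₂)))
                     (solve 2 (λ x y → (con 0ℚ :- x :+ y) :+ (con 0ℚ :- y :+ x) := con 0ℚ) refl (a (suc x)) (a (suc y)))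
        in y , y∈ , y∉ , on⁺ F (swap x y B₁) c₁ (proj₁ (sum-nonpos-zero (h _ c₁) (h _ c₂) sum0))

-- Convex hulls, faces and dimensions translated into cones.

module Polytopes where

  open import Data.Rational as Q using (ℚ; 0ℚ; 1ℚ; _≤_)
  open import Data.Rational.Properties using (_≟_; ≤-refl; ≤-trans; ≤-reflexive; ≤-antisym)
  open OpaqueRational
  open Cones
  open Euler
  open Subsets
  open Matroids
  open Faces
  import Data.Bool.Properties as Bool
  import Data.Vec.Properties as V
  open import Data.List.Relation.Unary.Unique.Propositional using (Unique)
  import Data.List.Relation.Unary.Unique.Propositional.Properties as Unique

  hom : ∀ {m} → Point m → Point (suc m)
  hom p zero    = 1ℚ
  hom p (suc i) = p i

  sum-allFin-suc : ∀ {r} (f : Fin (suc r) → ℚ) → sumFin (suc r) f ≡ f zero + sumFin r (λ i → f (suc i))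
  sum-allFin-suc {r} f = trans (sym (+-unfold (f zero) _)) (cong (λ s → f zero + sumℚ s)
    (trans (L.map-tabulate suc f) (sym (L.map-tabulate id (λ i → f (suc i))))))

  sumFin-dot : ∀ {n} (w x : Point n) → sumFin n (λ i → w i Q.* x i) ≡ w ∙ x
  sumFin-dot {zero}  w x = sym (trans (∙-congʳ w {y = 𝟎} (λ ())) (∙-𝟎 w))
  sumFin-dot {suc n} w x = trans (sum-allFin-suc (λ i → w i Q.* x i))
    (trans (cong₂ _+_ (sym (*-unfold (w zero) (x zero))) (sumFin-dot (tl w) (tl x))) (sym (∙-suc w x)))

  module _ {m : ℕ} where

    comb : (Subset m → ℚ) → List (Subset m) → Point (suc m)
    comb c []       = 𝟎
    comb c (B ∷ Bs) = c B ⊙ ê B ⊕ comb c Bs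

    comb-height : ∀ c Bs → comb c Bs zero ≡ sumℚ (map c Bs)
    comb-height c []       = refl
    comb-height c (B ∷ Bs) = trans (cong₂ _+_ (*-identityʳ (c B)) (comb-height c Bs)) (+-unfold (c B) _)

    comb-coordinate : ∀ c Bs i → comb c Bs (suc i) ≡ sumℚ (map (λ B → c B Q.* e B i) Bs)
    comb-coordinate c []       i = refl
    comb-coordinate c (B ∷ Bs) i = trans (cong₂ _+_ (*-unfold (c B) (e B i)) (comb-coordinate c Bs i)) (+-unfold (c B Q.* e B i) _)

    comb-cong : ∀ {c d} Bs → (∀ B → B ∈ Bs → c B ≡ d B) → comb c Bs ≐ comb d Bs
    comb-cong []       h i = refl
    comb-cong (B ∷ Bs) h i = cong₂ (λ s t → s * ê B i + t) (h B (here refl)) (comb-cong Bs (λ C C∈ → h C (there C∈)) i)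

    comb-cone : ∀ (q : Subset m → Bool) c → (∀ B → c B ≢ 0ℚ → q B ≡ true) → (∀ B → 0ℚ ≤ c B) → ∀ Bs → Cone (select q Bs) (comb c Bs)
    comb-cone q c supp nonneg []       i = refl
    comb-cone q c supp nonneg (B ∷ Bs) = go (q B) refl
      where
      go : ∀ b → q B ≡ b → Cone (if b then ê B ∷ select q Bs else select q Bs) (comb c (B ∷ Bs))
      go true  eq = c B , nonneg B , comb-resp (select q Bs) (λ i → solve 3 (λ s t g → s := (t :* g :+ s) :- t :* g) refl (comb c Bs i) (c B) (ê B i))
                      (comb-cone q c supp nonneg Bs)
      go false eq with c B ≟ 0ℚ
      ... | no ne = true≢false (supp B ne) eq
      ... | yes e = comb-resp (select q Bs) (λ i → trans (solve 2 (λ s g → s := con 0ℚ :* g :+ s) refl (comb c Bs i) (ê B i)) (cong (λ t → t * ê B i + comb c Bs i) (sym e)))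
                      (comb-cone q c supp nonneg Bs)

    inConv⇒cone : ∀ {W : VSet m} (q : Subset m → Bool) → (∀ B → W B → q B ≡ true) → ∀ {p} → InConv W p → Cone (verts q) (hom p)
    inConv⇒cone q W⊆q {p} (c , supp , nonneg , s₁ , sₚ) = comb-resp (verts q)
      (λ { zero → trans (comb-height c (allSubsets m)) s₁ ; (suc i) → trans (comb-coordinate c (allSubsets m) i) (sₚ i) })
      (comb-cone q c (λ B h → W⊆q B (supp B h)) nonneg (allSubsets m))

    inConv-nonempty : ∀ {W : VSet m} {p} → InConv W p → ∃ W
    inConv-nonempty {W} (c , supp , nonneg , s₁ , _) with go (allSubsets m)
      where
      go : ∀ Bs → (∃ λ B → c B ≢ 0ℚ) ⊎ comb c Bs zero ≡ 0ℚ
      go []       = inj₂ refl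
      go (B ∷ Bs) with c B ≟ 0ℚ | go Bs
      ... | no ne | _       = inj₁ (B , ne)
      ... | yes _ | inj₁ w  = inj₁ w
      ... | yes e | inj₂ e′ = inj₂ (trans (cong₂ (λ s t → s * 1ℚ + t) e e′) (solve 0 (con 0ℚ :* con 1ℚ :+ con 0ℚ := con 0ℚ) refl))
    ... | inj₁ (B , ne) = B , supp B ne
    ... | inj₂ z = ⊥-elim (pos⇒≢0 0<1 (trans (sym s₁) (trans (sym (comb-height c (allSubsets m))) z)))

    open import Relation.Binary.Definitions using (DecidableEquality)

    _≟ˢ_ : DecidableEquality (Subset m)
    _≟ˢ_ = V.≡-dec Bool._≟_

    -- Distinctness of the list matters: the coefficient of `B` is stored in a function on subsets,
    -- and a second occurrence of `B` would clash with the first.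
    coefficients : ∀ (q : Subset m → Bool) Bs → Unique Bs → ∀ {x} → Cone (select q Bs) x →
      ∃ λ c → (∀ B → 0ℚ ≤ c B) × (∀ B → c B ≢ 0ℚ → q B ≡ true) × x ≐ comb c Bs
    coefficients q []       u        k = (λ _ → 0ℚ) , (λ _ → ≤-refl) , (λ B h → ⊥-elim (h refl)) , k
    coefficients q (B ∷ Bs) (h ∷ us) {x} k = go (q B) refl k
      where
      go : ∀ b → q B ≡ b → Cone (if b then ê B ∷ select q Bs else select q Bs) x →
           ∃ λ c → (∀ B → 0ℚ ≤ c B) × (∀ B → c B ≢ 0ℚ → q B ≡ true) × x ≐ comb c (B ∷ Bs)
      extend : ∀ t → 0ℚ ≤ t → (t ≢ 0ℚ → q B ≡ true) → Cone (select q Bs) (x -[ t ] ê B) →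
           ∃ λ c → (∀ B → 0ℚ ≤ c B) × (∀ B → c B ≢ 0ℚ → q B ≡ true) × x ≐ comb c (B ∷ Bs)
      extend t 0≤t tq k with coefficients q Bs us k
      ... | c , nonneg , supp , eq = c′ , nonneg′ , supp′ , λ i → trans
             (solve 3 (λ x t g → x := t :* g :+ (x :- t :* g)) refl (x i) t (ê B i))
             (cong₂ (λ s r → s * ê B i + r) (sym at-B) (trans (eq i) (comb-cong Bs (λ C C∈ → sym (off-B C (λ e → All.lookup h C∈ (sym e)))) i)))
        where
        c′ : Subset m → ℚ
        c′ C = if does (C ≟ˢ B) then t else c C
        at-B : c′ B ≡ t
        at-B with B ≟ˢ B
        ... | yes _ = refl
        ... | no ne = ⊥-elim (ne refl)
        off-B : ∀ C → C ≢ B → c′ C ≡ c C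
        off-B C ne with C ≟ˢ B
        ... | yes e = ⊥-elim (ne e)
        ... | no _  = refl
        nonneg′ : ∀ C → 0ℚ ≤ c′ C
        nonneg′ C with C ≟ˢ B
        ... | yes _ = 0≤t
        ... | no _  = nonneg C
        supp′ : ∀ C → c′ C ≢ 0ℚ → q C ≡ true
        supp′ C with C ≟ˢ B
        ... | yes refl = tq
        ... | no _     = supp C
      go true  eq (t , 0≤t , k) = extend t 0≤t (λ _ → eq) k
      go false eq k = extend 0ℚ ≤-refl (λ h → ⊥-elim (h refl)) (comb-resp (select q Bs) (λ i → solve 2 (λ x g → x := x :- con 0ℚ :* g) refl (x i) (ê B i)) k)

  unique-allSubsets : ∀ m → Unique (allSubsets m)
  unique-allSubsets zero    = [] ∷ []
  unique-allSubsets (suc m) = Unique.++⁺ (Unique.map⁺ V.∷-injectiveʳ (unique-allSubsets m)) (Unique.map⁺ V.∷-injectiveʳ (unique-allSubsets m)) disjoint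
    where
    disjoint : ∀ {A} → A ∈ map (false ∷_) (allSubsets m) × A ∈ map (true ∷_) (allSubsets m) → ⊥
    disjoint (p , q) with ∈-map⁻ (false ∷_) p | ∈-map⁻ (true ∷_) q
    ... | _ , _ , refl | _ , _ , ()

  module _ {m : ℕ} where

    cone⇒inConv : ∀ (q : Subset m → Bool) {W : VSet m} → (∀ B → q B ≡ true → W B) → ∀ {x} → x zero ≡ 1ℚ → Cone (verts q) x → InConv W (tl x)
    cone⇒inConv q q⊆W e₀ k with coefficients q (allSubsets m) (unique-allSubsets m) k
    ... | c , nonneg , supp , eq = c , (λ B h → q⊆W B (supp B h)) , nonneg ,
          trans (sym (comb-height c (allSubsets m))) (trans (sym (eq zero)) e₀) ,
          λ i → trans (sym (comb-coordinate c (allSubsets m) i)) (sym (eq (suc i)))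

    hom-affine : ∀ {x : Point (suc m)} → x zero ≡ 1ℚ → hom (tl x) ≐ x
    hom-affine h zero    = sym h
    hom-affine h (suc i) = refl

    ·e-dot : ∀ (w : Point m) B → w ·e B ≡ w ∙ e B
    ·e-dot w B = sumFin-dot w (e B)

    isFace⇒HFace : ∀ (p : Subset m → Bool) {W : VSet m} → IsFaceOf (λ B → p B ≡ true) W → ∃ W →
      ∃ λ q → HFace p q × (∀ B → W B → q B ≡ true) × (∀ B → q B ≡ true → W B)
    isFace⇒HFace p {W} (w , face) (B₀ , w₀) = faceOn p a , F , to , from
      where
      a : Point (suc m)
      -- Minus the maximum of `w` over the polytope, which is attained at every vertex of the face,
      -- in particular at `B₀`.
      a zero    = - (w ∙ e B₀)
      a (suc i) = w i
      a∙ : ∀ B → a ∙ ê B ≡ w ∙ e B - w ∙ e B₀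
      a∙ B = trans (∙-suc a (ê B)) (solve 2 (λ s t → (:- s) :* con 1ℚ :+ t := t :- s) refl (w ∙ e B₀) (w ∙ e B))
      max₀ = Equivalence.to (face B₀) w₀
      le : ∀ B C → (w ·e B) ≤ (w ·e C) → w ∙ e B ≤ w ∙ e C
      le B C = subst₂ _≤_ (·e-dot w B) (·e-dot w C)
      ge : ∀ B C → w ∙ e B ≤ w ∙ e C → (w ·e B) ≤ (w ·e C)
      ge B C = subst₂ _≤_ (sym (·e-dot w B)) (sym (·e-dot w C))
      F : HFace p (faceOn p a)
      F = faceOn-face p a λ B pB → subst (_≤ 0ℚ) (sym (a∙ B))
            (subst (w ∙ e B - w ∙ e B₀ ≤_) (+-inverseʳ (w ∙ e B₀)) (+-monoˡ-≤ (- (w ∙ e B₀)) (le B B₀ (proj₂ max₀ B pB))))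
      to : ∀ B → W B → faceOn p a B ≡ true
      to B wB = let pB , mB = Equivalence.to (face B) wB in
        on⁺ F B pB (trans (a∙ B) (trans (cong (λ s → s - w ∙ e B₀) (≤-antisym (le B B₀ (proj₂ max₀ B pB)) (le B₀ B (mB B₀ (proj₁ max₀))))) (+-inverseʳ (w ∙ e B₀))))
      from : ∀ B → faceOn p a B ≡ true → W B
      from B qB = let pB , eB = on⁻ F B qB
                      same = trans (solve 2 (λ s t → s := (s :- t) :+ t) refl (w ∙ e B) (w ∙ e B₀)) (trans (cong (_+ w ∙ e B₀) (trans (sym (a∙ B)) eB)) (+-identityˡ _))
                  in Equivalence.from (face B) (pB , λ C pC → ge C B (≤-trans (le C B₀ (proj₂ max₀ C pC)) (≤-reflexive (sym same))))

    HFace⇒isFace : ∀ {p q : Subset m → Bool} → HFace p q → (∃ λ B → q B ≡ true) → IsFaceOf (λ B → p B ≡ true) (λ B → q B ≡ true)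
    HFace⇒isFace {p} {q} F (B₀ , q₀) = tl a , λ B → mk⇔ (to B) (from B)
      where
      a = normal F
      e₀ = on⁻ F B₀ q₀
      w∙ : ∀ B → a ∙ ê B ≡ a zero + tl a ∙ e B
      w∙ B = trans (∙-suc a (ê B)) (cong (_+ tl a ∙ e B) (*-identityʳ (a zero)))
      below′ : ∀ B C → a ∙ ê B ≤ a ∙ ê C → (tl a ·e B) ≤ (tl a ·e C)
      below′ B C h = subst₂ _≤_ (trans (strip B) (sym (·e-dot (tl a) B))) (trans (strip C) (sym (·e-dot (tl a) C))) (+-monoʳ-≤ (- a zero) h)
        where
        strip : ∀ B → - a zero + a ∙ ê B ≡ tl a ∙ e B
        strip B = trans (cong (- a zero +_) (w∙ B)) (solve 2 (λ s t → (:- s) :+ (s :+ t) := t) refl (a zero) (tl a ∙ e B))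
      to : ∀ B → q B ≡ true → ArgMax (tl a) (λ B → p B ≡ true) B
      to B qB = let pB , eB = on⁻ F B qB in pB , λ C pC → below′ C B (subst (a ∙ ê C ≤_) (sym eB) (below F C pC))
      from : ∀ B → ArgMax (tl a) (λ B → p B ≡ true) B → q B ≡ true
      from B (pB , mB) = on⁺ F B pB (≤-antisym (below F B pB) (subst₂ _≤_ (trans (sym (w∙ B₀)) (proj₂ e₀)) (sym (w∙ B))
        (+-monoʳ-≤ (a zero) (subst₂ _≤_ (·e-dot (tl a) B₀) (·e-dot (tl a) B) (mB B₀ (proj₁ e₀))))))

    lifts : ∀ {r} → Vec (Subset m) r → List (Point (suc m))
    lifts []       = []
    lifts (B ∷ vs) = ê B ∷ lifts vs

    length-lifts : ∀ {r} (vs : Vec (Subset m) r) → length (lifts vs) ≡ r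
    length-lifts []       = refl
    length-lifts (B ∷ vs) = cong suc (length-lifts vs)

    linComb : ∀ {r} → (Fin r → ℚ) → Vec (Subset m) r → Point (suc m)
    linComb c []       = 𝟎
    linComb c (B ∷ vs) = c zero ⊙ ê B ⊕ linComb (λ j → c (suc j)) vs

    linComb-height : ∀ {r} c (vs : Vec (Subset m) r) → linComb c vs zero ≡ sumFin r c
    linComb-height c []       = refl
    linComb-height c (B ∷ vs) = trans (cong₂ _+_ (*-identityʳ (c zero)) (linComb-height _ vs)) (sym (sum-allFin-suc c))

    linComb-coordinate : ∀ {r} c (vs : Vec (Subset m) r) i → linComb c vs (suc i) ≡ sumFin r (λ j → c j Q.* e (V.lookup vs j) i)
    linComb-coordinate c []       i = refl
    linComb-coordinate c (B ∷ vs) i = trans (cong₂ _+_ (*-unfold (c zero) (e B i)) (linComb-coordinate _ vs i))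
      (sym (sum-allFin-suc (λ j → c j Q.* e (V.lookup (B ∷ vs) j) i)))

    LinIndep : ∀ {r} → Vec (Subset m) r → Set
    LinIndep vs = ∀ c → linComb c vs ≐ 𝟎 → ∀ j → c j ≡ 0ℚ

    -- The height coordinate turns the condition that the coefficients of an affine relation sum to
    -- zero into one more linear equation.
    aff⇒lin : ∀ {r} (vs : Vec (Subset m) r) → AffIndep vs → LinIndep vs
    aff⇒lin vs h c z = h c (trans (sym (linComb-height c vs)) (z zero)) (λ i → trans (sym (linComb-coordinate c vs i)) (z (suc i)))

    lin⇒aff : ∀ {r} (vs : Vec (Subset m) r) → LinIndep vs → AffIndep vs
    lin⇒aff vs h c s₀ s = h c λ { zero → trans (linComb-height c vs) s₀ ; (suc i) → trans (linComb-coordinate c vs i) (s i) }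

    span-linComb : ∀ {r} c (vs : Vec (Subset m) r) → Span (lifts vs) (linComb c vs)
    span-linComb c []       i = refl
    span-linComb c (B ∷ vs) = c zero , tt , comb-resp (lifts vs) (λ i → solve 3 (λ s t g → s := (t :* g :+ s) :- t :* g) refl _ (c zero) (ê B i)) (span-linComb _ vs)

    linComb-span : ∀ {r} (vs : Vec (Subset m) r) {x} → Span (lifts vs) x → ∃ λ c → x ≐ linComb c vs
    linComb-span []       s = (λ ()) , s
    linComb-span (B ∷ vs) {x} (t , _ , s) with linComb-span vs s
    ... | c , eq = (λ { zero → t ; (suc j) → c j }) , λ i → trans (solve 3 (λ x t g → x := t :* g :+ (x :- t :* g)) refl (x i) t (ê B i)) (cong (t * ê B i +_) (eq i))

    lin⇒indep : ∀ {r} (vs : Vec (Subset m) r) → LinIndep vs → Indep (lifts vs)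
    lin⇒indep []       h = tt
    lin⇒indep (B ∷ vs) h = not-span , lin⇒indep vs (λ c z j → h (λ { zero → 0ℚ ; (suc j) → c j })
        (λ i → trans (cong (0ℚ * ê B i +_) (z i)) (solve 1 (λ g → con 0ℚ :* g :+ con 0ℚ := con 0ℚ) refl (ê B i))) (suc j))
      where
      not-span : ¬ Span (lifts vs) (ê B)
      not-span s with linComb-span vs s
      ... | c , eq = pos⇒≢0 0<1 (trans (solve 0 (con 1ℚ := :- (:- con 1ℚ)) refl) (trans (cong -_ minus-one) (solve 0 (:- con 0ℚ := con 0ℚ) refl)))
        where
        minus-one : - 1ℚ ≡ 0ℚ
        minus-one = h (λ { zero → - 1ℚ ; (suc j) → c j })
          (λ i → trans (cong (- 1ℚ * ê B i +_) (sym (eq i))) (solve 1 (λ g → (:- con 1ℚ) :* g :+ g := con 0ℚ) refl (ê B i))) zero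

    indep⇒lin : ∀ {r} (vs : Vec (Subset m) r) → Indep (lifts vs) → LinIndep vs
    indep⇒lin (B ∷ vs) (h , k) c z with c zero ≟ 0ℚ
    ... | yes e₀ = λ { zero → e₀ ; (suc j) → indep⇒lin vs k (λ j → c (suc j))
            (λ i → trans (solve 2 (λ s g → s := con 0ℚ :* g :+ s) refl _ (ê B i)) (trans (cong (λ t → t * ê B i + linComb (λ j → c (suc j)) vs i) (sym e₀)) (z i))) j }
    ... | no ne = ⊥-elim (h (comb-resp (lifts vs) (λ i → scaled i) (span-⊙ (lifts vs) (- d) (span-linComb (λ j → c (suc j)) vs))))
      where
      d = inv (c zero) ne
      scaled : ∀ i → - d * linComb (λ j → c (suc j)) vs i ≡ ê B i
      scaled i = trans (solve 4 (λ d s c g → (:- d) :* s := (d :* c) :* g :- d :* (c :* g :+ s)) refl d (linComb (λ j → c (suc j)) vs i) (c zero) (ê B i))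
        (trans (cong₂ (λ s t → s * ê B i - d * t) (inv-* (c zero) ne) (z i)) (solve 2 (λ g d → con 1ℚ :* g :- d :* con 0ℚ := g) refl (ê B i) d))

    ¬¬-all : ∀ {A : Set} {P : A → Set} xs → (∀ x → ¬ ¬ P x) → ¬ ¬ All P xs
    ¬¬-all []       h = return []
    ¬¬-all (x ∷ xs) h = h x >>= λ p → ¬¬-all xs h >>= λ ps → return (p ∷ ps)

    -- A vertex outside the span of the given family would extend it to d + 2 affinely independent
    -- vertices, so under double negation the family spans. Its d + 1 members give the dimension of
    -- the cone, one more than that of the polytope.
    dim-relOpen : ∀ (q : Subset m → Bool) {d} → IsDim (λ B → q B ≡ true) d →
      ¬ ¬ (∃ λ us → length us ≡ suc d × All (Span (verts q)) us × RelOpen (Pos (verts q)) us)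
    dim-relOpen q {d} ((vs , on-q , aff) , maximal) = do
        spans ← ¬¬-all (allSubsets m) spanned
        return (lifts vs , length-lifts vs , inVerts vs on-q , record
          { indep  = indep-vs
          ; respX  = comb-resp (verts q)
          ; addX   = pos-⊕ (verts q)
          ; scaleX = pos-⊙ (verts q)
          ; inSpan = λ p → span-trans (verts q) (lifts vs) (all-verts⁺ q λ B → All.lookup spans (∈-allSubsets B)) (pos⇒span (verts q) p)
          ; nudge  = λ p s → pos-nudge (verts q) p (span-trans (lifts vs) (verts q) (inVerts vs on-q) s) })
      where
      indep-vs : Indep (lifts vs)
      indep-vs = lin⇒indep vs (aff⇒lin vs aff)
      inVerts : ∀ {r} (vs : Vec (Subset m) r) → (∀ j → q (V.lookup vs j) ≡ true) → All (Span (verts q)) (lifts vs)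
      inVerts []       h = []
      inVerts (B ∷ vs) h = all-verts⁻ q (span-self (verts q)) B (h zero) ∷ inVerts vs (λ j → h (suc j))
      spanned : ∀ B → ¬ ¬ (q B ≡ true → Span (lifts vs) (ê B))
      spanned B k = k λ qB → ⊥-elim (maximal (B ∷ vs) (λ { zero → qB ; (suc j) → on-q j })
        (lin⇒aff (B ∷ vs) (indep⇒lin (B ∷ vs) ((λ s → k (λ _ → s)) , indep-vs))))

-- Rank indicators as Euler characteristics, and the geometry of a subdivision.

module Valuations where

  open import Data.Integer as ℤ using (ℤ; 0ℤ; 1ℤ)
  import Data.Integer.Properties as ℤ
  import Data.Integer.Solver as ℤS
  open import Data.Rational as Q using (ℚ; 0ℚ; 1ℚ; _≤_; _<_)
  open import Data.Rational.Properties using (≤-refl; <⇒≤; <-irrefl; <-≤-trans)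
  open OpaqueRational
  open Cones
  open Euler
  open Subsets
  open Matroids
  open Faces
  open Polytopes
  open import Data.List.Relation.Unary.All.Properties using (++⁻ˡ; ++⁻ʳ)
  open import Relation.Nullary.Decidable using (decidable-stable)

  ι : ℕ → ℚ
  ι zero    = 0ℚ
  ι (suc n) = 1ℚ + ι n

  ι-nonneg : ∀ n → 0ℚ ≤ ι n
  ι-nonneg zero    = ≤-refl
  ι-nonneg (suc n) = 0≤+ (<⇒≤ 0<1) (ι-nonneg n)

  ι-mono-< : ∀ {a b} → a ℕ.< b → ι a < ι b
  ι-mono-< {zero}  {suc b} h = <-≤-trans 0<1 (subst (_≤ 1ℚ + ι b) (+-identityʳ 1ℚ) (+-monoʳ-≤ 1ℚ (ι-nonneg b)))
  ι-mono-< {suc a} {suc b} (ℕ.s≤s h) = 0<-⇒< (subst (0ℚ <_) (solve 2 (λ a b → b :- a := (con 1ℚ :+ b) :- (con 1ℚ :+ a)) refl (ι a) (ι b)) (<⇒0<- (ι-mono-< h)))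

  ι-mono-≤ : ∀ {a b} → a ℕ.≤ b → ι a ≤ ι b
  ι-mono-≤ {b = b} ℕ.z≤n = ι-nonneg b
  ι-mono-≤ (ℕ.s≤s h) = +-monoʳ-≤ 1ℚ (ι-mono-≤ h)

  opaque
    unfolding _∙_

    e-∙-e : ∀ {m} (A B : Subset m) → e A ∙ e B ≡ ι ∣ A ∩ B ∣
    e-∙-e []          []          = refl
    e-∙-e (true  ∷ A) (true  ∷ B) = cong₂ _+_ (*-identityʳ 1ℚ) (e-∙-e A B)
    e-∙-e (true  ∷ A) (false ∷ B) = trans (cong₂ _+_ (*-zeroʳ 1ℚ) (e-∙-e A B)) (+-identityˡ _)
    e-∙-e (false ∷ A) (true  ∷ B) = trans (cong₂ _+_ (*-zeroˡ 1ℚ) (e-∙-e A B)) (+-identityˡ _)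
    e-∙-e (false ∷ A) (false ∷ B) = trans (cong₂ _+_ (*-zeroˡ 0ℚ) (e-∙-e A B)) (+-identityˡ _)

  Cut : ∀ {n} → (Point n → Set) → List (Point n) → Point n → Set
  Cut X os x = X x × All (λ o → 0ℚ < o ∙ x) os

  relOpen-cut : ∀ {n} {X : Point n → Set} {us} os → RelOpen X us → RelOpen (Cut X os) us
  relOpen-cut os R = record
    { indep  = indep R
    ; respX  = λ e (p , qs) → respX R e p , All.map (λ {o} q → subst (0ℚ <_) (∙-congʳ o e) q) qs
    ; addX   = λ {x} {y} (p , qs) (p′ , qs′) → addX R p p′ , All.map (λ {o} (q , q′) → subst (0ℚ <_) (sym (∙-⊕ o x y)) (0<+ q q′)) (All.zip (qs , qs′))
    ; scaleX = λ {x} t h (p , qs) → scaleX R t h p , All.map (λ {o} q → subst (0ℚ <_) (sym (∙-⊙ o x t)) (0<* h q)) qs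
    ; inSpan = λ (p , _) → inSpan R p
    ; nudge  = λ {x} {v} (p , qs) s → small-× (nudge R p s)
        (small-all os (All.map (λ {o} q → small-map (λ δ _ h → subst (0ℚ <_) (sym (∙-nudge o x δ v)) h) (small-pos (o ∙ x) (o ∙ v) q)) qs))
    }

  -- level (A , a) is positive at the height-one point x when x(A) > a.
  level : ∀ {m} → Subset m × ℕ → Point (suc m)
  level (A , a) zero    = - ι a
  level (A , a) (suc i) = e A i

  level-∙ : ∀ {m} (A : Subset m) a B → level (A , a) ∙ ê B ≡ ι ∣ A ∩ B ∣ - ι a
  level-∙ A a B = trans (∙-suc (level (A , a)) (ê B)) (trans (cong (- ι a * 1ℚ +_) (e-∙-e A B)) (solve 2 (λ s t → (:- t) :* con 1ℚ :+ s := s :- t) refl (ι ∣ A ∩ B ∣) (ι a)))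

  hit : ∀ {m} → Matroid m → List (Subset m × ℕ) → Bool
  hit N []              = true
  hit N ((A , a) ∷ acc) = (a ℕ.<ᵇ rank N A) ∧ hit N acc

  <ᵇ-false : ∀ {a b} → (a ℕ.<ᵇ b) ≡ false → b ℕ.≤ a
  <ᵇ-false {a} {b} h = ℕ.≮⇒≥ λ l → true≢false (<ᵇ⁺ l) h

  module _ {m : ℕ} (N : Matroid m) where

    X : List (Subset m × ℕ) → Point (suc m) → Set
    X acc = Cut (Pos (verts (isBasis N))) (map level acc)

    -- A basis attaining all ranks of the chain satisfies the strict inequalities at a vertex.
    -- Adding a small multiple of an interior point enters the relative interior without losing any
    -- of them.
    hit⇒inhabited : ∀ acc → Descending N (map proj₁ acc) → hit N acc ≡ true → ∃ (X acc)
    hit⇒inhabited acc desc h with chain-basis N (map proj₁ acc) desc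
    ... | B , b , es with small-witness (small-all (map level acc) (smalls acc h es))
      where
      gs = verts (isBasis N)
      smalls : ∀ acc → hit N acc ≡ true → All (λ A → ∣ A ∩ B ∣ ≡ rank N A) (map proj₁ acc) →
               All (λ o → Small (λ δ → 0ℚ < o ∙ ê B + δ * (o ∙ vsum gs))) (map level acc)
      smalls []              h []       = []
      smalls ((A , a) ∷ acc) h (e ∷ es) = let h₁ , h₂ = ∧-elim {a ℕ.<ᵇ rank N A} h in
        small-pos _ _ (subst (0ℚ <_) (sym (level-∙ A a B)) (<⇒0<- (ι-mono-< (subst (a ℕ.<_) (sym e) (<ᵇ⁻ a (rank N A) h₁))))) ∷ smalls acc h₂ es
    ... | δ , 0<δ , ps = (ê B ⊕ δ ⊙ vsum gs) ,
          comb-resp gs (λ i → solve 2 (λ s t → s :+ t := t :+ s) refl (δ * vsum gs i) (ê B i)) (pos+cone gs (pos-⊙ gs δ 0<δ (vsum-pos gs)) (vertex-cone (isBasis N) B b)) ,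
          All.map (λ {o} q → subst (0ℚ <_) (sym (∙-nudge o (ê B) δ (vsum gs))) q) ps
      where
      gs = verts (isBasis N)

    -- If the rank of `A` were at most `a`, the level functional would be nonpositive at every
    -- vertex and so on the whole cone.
    inhabited⇒hit : ∀ acc {x} → X acc x → hit N acc ≡ true
    inhabited⇒hit []              _ = refl
    inhabited⇒hit ((A , a) ∷ acc) {x} (p , q ∷ qs) = ∧-intro above (inhabited⇒hit acc (p , qs))
      where
      above : (a ℕ.<ᵇ rank N A) ≡ true
      above with bool? (a ℕ.<ᵇ rank N A)
      ... | inj₁ t = t
      ... | inj₂ f = ⊥-elim (<-irrefl refl (<-≤-trans q (cone-nonpos (level (A , a)) (verts (isBasis N))
              (all-verts⁺ (isBasis N) (λ B b → subst (_≤ 0ℚ) (sym (level-∙ A a B)) (subst (ι ∣ A ∩ B ∣ - ι a ≤_) (+-inverseʳ (ι a))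
                 (+-monoˡ-≤ (- ι a) (ι-mono-≤ (ℕ.≤-trans (rank-ub N A b) (<ᵇ-false f)))))))
              (pos⇒cone (verts (isBasis N)) p))))

    χ : List (Subset m × ℕ) → ℤ
    χ acc = if hit N acc then 1ℤ else 0ℤ

    -- Open half-spaces leave the span unchanged, so an inhabited cut still has the dimension d + 1
    -- of the cone.
    hasEuler : ∀ acc → Descending N (map proj₁ acc) → ∀ {d} → IsDim (basesOf N) d → ¬ ¬ HasEuler (X acc) (sgn (suc d) ℤ.* χ acc)
    hasEuler acc desc {d} dim = do
        us , len , _ , R ← dim-relOpen (isBasis N) dim
        return (us , relOpen-cut (map level acc) R , status us len (hit N acc) refl)
      where
      status : ∀ (us : List (Point (suc m))) → length us ≡ suc d → ∀ b → hit N acc ≡ b →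
               (∃ (X acc) × sgn (suc d) ℤ.* (if b then 1ℤ else 0ℤ) ≡ sgn (length us)) ⊎ ((∀ x → ¬ X acc x) × sgn (suc d) ℤ.* (if b then 1ℤ else 0ℤ) ≡ 0ℤ)
      status us len true  h = inj₁ (hit⇒inhabited acc desc h , trans (ℤ.*-identityʳ (sgn (suc d))) (cong sgn (sym len)))
      status us len false h = inj₂ ((λ x p → true≢false (inhabited⇒hit acc p) h) , ℤ.*-zeroʳ (sgn (suc d)))

  sgn-+ : ∀ a b → sgn (a ℕ.+ b) ≡ sgn a ℤ.* sgn b
  sgn-+ zero    b = sym (ℤ.*-identityˡ (sgn b))
  sgn-+ (suc a) b = trans (cong ℤ.-_ (sgn-+ a b)) (ℤ.neg-distribˡ-* (sgn a) (sgn b))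

  sgn-square : ∀ a → sgn a ℤ.* sgn a ≡ 1ℤ
  sgn-square zero    = refl
  sgn-square (suc a) = trans (solve′ 1 (λ s → (:-′ s) :*′ (:-′ s) :=′ s :*′ s) refl (sgn a)) (sgn-square a)
    where open ℤS.+-*-Solver renaming (solve to solve′; _:*_ to _:*′_; :-_ to :-′_; _:=_ to _:=′_)

  sgn-∸ : ∀ {D d} → d ℕ.≤ D → sgn D ℤ.* sgn d ≡ sgn (D ∸ d)
  sgn-∸ {D} {d} h = trans (cong (λ k → sgn k ℤ.* sgn d) (sym (ℕ.m∸n+n≡m h)))
    (trans (cong (ℤ._* sgn d) (sgn-+ (D ∸ d) d)) (trans (ℤ.*-assoc (sgn (D ∸ d)) (sgn d) (sgn d))
      (trans (cong (sgn (D ∸ d) ℤ.*_) (sgn-square d)) (ℤ.*-identityʳ _))))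

  any-index : ∀ {a p} {A : Set a} {P : A → Set p} {xs} → Any P xs → ∃ λ i → P (L.lookup xs i)
  any-index (here p)  = zero , p
  any-index (there h) = let i , p = any-index h in suc i , p

  index-any : ∀ {a p} {A : Set a} {P : A → Set p} xs i → P (L.lookup xs i) → Any P xs
  index-any (x ∷ xs) zero    p = here p
  index-any (x ∷ xs) (suc i) p = there (index-any xs i p)

  all-index : ∀ {a p} {A : Set a} {P : A → Set p} {xs} → All P xs → ∀ i → P (L.lookup xs i)
  all-index (p ∷ ps) zero    = p
  all-index (p ∷ ps) (suc i) = all-index ps i

  allPairs-index : ∀ {a p} {A : Set a} {R : A → A → Set p} {xs} → (∀ {x y} → R x y → R y x) → AllPairs R xs →
                   ∀ i j → i ≢ j → R (L.lookup xs i) (L.lookup xs j)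
  allPairs-index s (h ∷ hs) zero    zero    ne = ⊥-elim (ne refl)
  allPairs-index s (h ∷ hs) zero    (suc j) ne = all-index h j
  allPairs-index s (h ∷ hs) (suc i) zero    ne = s (all-index h i)
  allPairs-index s (h ∷ hs) (suc i) (suc j) ne = allPairs-index s hs i j (λ e → ne (cong suc e))

  module _ {m : ℕ} where

    searchL : ∀ (p : Subset m → Bool) Bs → (∃ λ B → p B ≡ true) ⊎ (∀ B → B ∈ Bs → p B ≡ false)
    searchL p []       = inj₂ λ B ()
    searchL p (B ∷ Bs) with bool? (p B) | searchL p Bs
    ... | inj₁ h | _      = inj₁ (B , h)
    ... | inj₂ h | inj₁ w = inj₁ w
    ... | inj₂ h | inj₂ k = inj₂ λ { C (here refl) → h ; C (there C∈) → k C C∈ }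

    pos-empty : ∀ (q : Subset m → Bool) Bs → (∀ B → q B ≡ false) → ∀ {y} → Pos (select q Bs) y → y ≐ 𝟎
    pos-empty q []       h k = k
    pos-empty q (B ∷ Bs) h {y} k = pos-empty q Bs h (subst (λ b → Pos (if b then ê B ∷ select q Bs else select q Bs) y) (h B) k)

    pos-member : ∀ (q : Subset m → Bool) {x} → x zero ≡ 1ℚ → Pos (verts q) x → ∃ λ B → q B ≡ true
    pos-member q {x} one p = go (searchL q (allSubsets m))
      where
      go : (∃ λ B → q B ≡ true) ⊎ (∀ B → B ∈ allSubsets m → q B ≡ false) → ∃ λ B → q B ≡ true
      go (inj₁ w)    = w
      go (inj₂ none) = ⊥-elim (pos⇒≢0 0<1 (trans (sym one) (pos-empty q (allSubsets m) (λ B → none B (∈-allSubsets B)) p zero)))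

    off-proper-face : ∀ (p : Subset m → Bool) {x} → x zero ≡ 1ℚ → Pos (verts p) x → ∀ {G} → IsProperFaceOf (λ B → p B ≡ true) G → ¬ InConv G (tl x)
    off-proper-face p {x} one px (f , B , pB , notG) inG =
      let r , H , to , from = isFace⇒HFace p f (inConv-nonempty inG)
      in notG (from B (pos-in-face H (λ B b → b) px
            (trans (∙-congʳ (normal H) (λ i → sym (hom-affine {x = x} one i))) (face-vanish H (inConv⇒cone r to inG))) B pB))

  module Subdivision {m : ℕ} (M : Matroid m) (S : List (Matroid m)) (subdivides : IsMatroidSubdivision M S) where

    cell : Fin (length S) → Matroid m
    cell = L.lookup S

    cell⊆M : ∀ i B → isBasis (cell i) B ≡ true → isBasis M B ≡ true
    cell⊆M = all-index (proj₁ (proj₂ subdivides))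

    FaceOfCell : Matroid m → Set
    FaceOfCell N = ∃ λ i → HFace (isBasis (cell i)) (isBasis N)

    faceOfCell : ∀ N → InInt M S N → FaceOfCell N
    faceOfCell N (faces , _) =
      let i , f = any-index faces
          q , F , to , from = isFace⇒HFace (isBasis (cell i)) f (nonempty N)
      in i , record { normal = normal F ; below = below F ; on⁻ = λ B b → on⁻ F B (to B b) ; on⁺ = λ B b z → from B (on⁺ F B b z) }

    face⊆cell : ∀ N ((i , F) : FaceOfCell N) B → isBasis N B ≡ true → isBasis (cell i) B ≡ true
    face⊆cell N (i , F) B b = proj₁ (on⁻ F B b)

    face⊆M : ∀ N → FaceOfCell N → ∀ B → isBasis N B ≡ true → isBasis M B ≡ true
    face⊆M N F B b = cell⊆M (proj₁ F) B (face⊆cell N F B b)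

    PosOf : Matroid m → Point (suc m) → Set
    PosOf N = Pos (verts (isBasis N))

    height : ∀ N {x} → PosOf N x → 0ℚ < x zero
    height N p = pos-height (isBasis N) (proj₂ (nonempty N)) p

    normalise : ∀ N {x} → PosOf N x → ∃ λ t → 0ℚ < t × (t ⊙ x) zero ≡ 1ℚ
    normalise N {x} p = inv (x zero) (pos⇒≢0 (height N p)) , 0<inv (height N p) , inv-* (x zero) (pos⇒≢0 (height N p))

    -- Two different cells meet in a common face `W` of both. A relatively interior point of `N` in
    -- `W` forces all of `N` into `W` and thus into the other cell, and likewise for `N′`. Then the
    -- faces can be compared inside a single cell.
    same-face : ∀ N N′ → FaceOfCell N → FaceOfCell N′ → ∀ {x} → PosOf N x → PosOf N′ x → SameBases N N′
    same-face N N′ (i , F) (j , F′) {x₀} p₀ p₀′ with i F.≟ j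
    ... | yes refl = face-unique F F′ p₀ p₀′
    ... | no ne = λ B → bool-ext (pos-in-face F′ N⊆j p (face-vanish F′ (pos⇒cone _ p′)) B) (pos-in-face F N′⊆i p′ (face-vanish F (pos⇒cone _ p)) B)
      where
      -- The point is rescaled to height one, because the subdivision speaks of points of the
      -- polytope and not of the cone.
      t = proj₁ (normalise N p₀)
      x = t ⊙ x₀
      one : x zero ≡ 1ℚ
      one = proj₂ (proj₂ (normalise N p₀))
      p : PosOf N x
      p = pos-⊙ _ t (proj₁ (proj₂ (normalise N p₀))) p₀
      p′ : PosOf N′ x
      p′ = pos-⊙ _ t (proj₁ (proj₂ (normalise N p₀))) p₀′
      common = proj₂ (proj₂ (proj₂ subdivides)) i j ne
        (tl x , cone⇒inConv (isBasis N) (λ B b → proj₁ (on⁻ F B b)) one (pos⇒cone _ p)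
                  , cone⇒inConv (isBasis N′) (λ B b → proj₁ (on⁻ F′ B b)) one (pos⇒cone _ p′))
      W = proj₁ common
      Wi = proj₁ (proj₂ common)
      Wj = proj₁ (proj₂ (proj₂ common))
      inW : InConv W (tl x)
      inW = Equivalence.from (proj₂ (proj₂ (proj₂ common)) (tl x))
        (cone⇒inConv (isBasis N) (λ B b → proj₁ (on⁻ F B b)) one (pos⇒cone _ p) , cone⇒inConv (isBasis N′) (λ B b → proj₁ (on⁻ F′ B b)) one (pos⇒cone _ p′))
      in-W : ∀ (c R : Matroid m) → IsFaceOf (basesOf c) W → (∀ B → isBasis R B ≡ true → isBasis c B ≡ true) → PosOf R x → ∀ B → isBasis R B ≡ true → W B
      in-W c R f sub pR B b = let q , G , to , from = isFace⇒HFace (isBasis c) f (inConv-nonempty inW)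
        in from B (pos-in-face G sub pR (trans (∙-congʳ (normal G) (λ i → sym (hom-affine {x = x} one i))) (face-vanish G (inConv⇒cone q to inW))) B b)
      W⊆ : ∀ (c : Matroid m) → IsFaceOf (basesOf c) W → ∀ B → W B → isBasis c B ≡ true
      W⊆ c (w , f) B wB = proj₁ (Equivalence.to (f B) wB)
      N⊆j : ∀ B → isBasis N B ≡ true → isBasis (cell j) B ≡ true
      N⊆j B b = W⊆ (cell j) (proj₁ Wj) B (in-W (cell i) N (proj₁ Wi) (λ B b → proj₁ (on⁻ F B b)) p B b)
      N′⊆i : ∀ B → isBasis N′ B ≡ true → isBasis (cell i) B ≡ true
      N′⊆i B b = W⊆ (cell i) (proj₁ Wi) B (in-W (cell j) N′ (proj₁ Wj) (λ B b → proj₁ (on⁻ F′ B b)) p′ B b)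

    -- The minimal face of Q around the vertex sum `b` of `N` contains all of `N`. A proper one
    -- would put `N` into the boundary, so it is Q itself. Any other relatively interior point of
    -- `N` is a small multiple of `b` plus a point of the cone of `N`.
    interior⊆ : ∀ N → InInt M S N → ∀ {x} → PosOf N x → PosOf M x
    interior⊆ N int {y} py = finish
      where
      F = faceOfCell N int
      sub = face⊆M N F
      gs = verts (isBasis N)
      b = vsum gs
      pb : PosOf N b
      pb = vsum-pos gs
      open MinFace (isBasis M) b (cone⇒rows (verts (isBasis M)) (cone-verts sub (pos⇒cone gs pb))) using (w; q; minFace; pos-minFace; w∙x)
      N⊆q : ∀ B → isBasis N B ≡ true → q B ≡ true
      N⊆q = pos-in-face minFace sub pb w∙x
      pM : PosOf M b
      pM with searchL (λ B → isBasis M B ∧ not (q B)) (allSubsets m)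
      ... | inj₂ none = subst (λ gs → Pos gs b) (verts-cong (λ B → bool-ext (λ h → proj₁ (on⁻ minFace B h)) (all-in B))) pos-minFace
        where
        all-in : ∀ B → isBasis M B ≡ true → q B ≡ true
        all-in B h with bool? (q B)
        ... | inj₁ k = k
        ... | inj₂ k = true≢false (∧-intro h (cong not k)) (none B (∈-allSubsets B))
      ... | inj₁ (B , h) = ⊥-elim (proj₂ int λ p inN → (λ B → q B ≡ true) ,
              (HFace⇒isFace minFace (proj₁ (nonempty N) , N⊆q _ (proj₂ (nonempty N))) , B , proj₁ (∧-elim {isBasis M B} h) , λ k → true≢false (proj₂ (∧-elim {isBasis M B} h)) (cong not k)) ,
              grow inN)
        where
        grow : ∀ {p} → InConv (basesOf N) p → InConv (λ B → q B ≡ true) p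
        grow (c , supp , rest) = c , (λ B h → N⊆q B (supp B h)) , rest
      finish : PosOf M y
      finish = let δ , 0<δ , k = small-witness (pos-nudge gs py (span-⊙ gs (- 1ℚ) (pos⇒span gs pb)))
        in comb-resp (verts (isBasis M)) (λ i → solve 3 (λ y δ b → δ :* b :+ (y :+ δ :* ((:- con 1ℚ) :* b)) := y) refl (y i) δ (b i))
             (pos+cone (verts (isBasis M)) (pos-⊙ _ δ 0<δ pM) (cone-verts sub (pos⇒cone gs k)))

    -- After rescaling, the point lies in some cell, and the face sought is the minimal face of that
    -- cell around it. `faceMatroid` presents this face as a matroid.
    covering : ∀ {x} → PosOf M x → ∃ λ N → InInt M S N × PosOf N x
    covering {x₀} p₀ = N , (index-any S i face-i , not-boundary) , comb-resp (verts q) (λ k → back k) (pos-⊙ (verts q) (x₀ zero) (height M p₀) pos-minFace)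
      where
      t = proj₁ (normalise M p₀)
      x = t ⊙ x₀
      one : x zero ≡ 1ℚ
      one = proj₂ (proj₂ (normalise M p₀))
      p : PosOf M x
      p = pos-⊙ _ t (proj₁ (proj₂ (normalise M p₀))) p₀
      found = any-index (proj₁ (proj₂ (proj₂ subdivides)) (tl x) (cone⇒inConv (isBasis M) (λ B b → b) one (pos⇒cone _ p)))
      i = proj₁ found
      sat : Satisfies (rows (verts (isBasis (cell i)))) x
      sat = cone⇒rows _ (comb-resp _ (hom-affine one) (inConv⇒cone (isBasis (cell i)) (λ B b → b) (proj₂ found)))
      open MinFace (isBasis (cell i)) x sat using (w; q; minFace; pos-minFace)
      cell-pos : ∃ λ B → q B ≡ true
      cell-pos = pos-member q one pos-minFace
      N : Matroid m
      N = faceMatroid (cell i) w (below minFace) cell-pos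
      face-i : IsFaceOf (basesOf (cell i)) (basesOf N)
      face-i = HFace⇒isFace minFace cell-pos
      inN : InConv (basesOf N) (tl x)
      inN = cone⇒inConv q (λ B b → b) one (pos⇒cone (verts q) pos-minFace)
      not-boundary : ¬ InBoundary M (basesOf N)
      -- The rescaled point lies in `N` and is relatively interior to Q, and no proper face of Q
      -- contains such a point.
      not-boundary bd = let G , proper , inG = bd (tl x) inN in off-proper-face (isBasis M) one p proper inG
      back : ∀ k → x₀ zero * (t * x₀ k) ≡ x₀ k
      back k = trans (solve 3 (λ s t u → s :* (t :* u) := (t :* s) :* u) refl (x₀ zero) t (x₀ k)) (trans (cong (_* x₀ k) one) (*-identityˡ (x₀ k)))

    allRows : List (Matroid m) → List (Point (suc m))
    allRows []      = []
    allRows (P ∷ S) = rows (verts (isBasis P)) ++ allRows S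

    cellRows : ∀ S i {x y : Point (suc m)} → SameSigns (allRows S) x y → SameSigns (rows (verts (isBasis (L.lookup S i)))) x y
    cellRows (P ∷ S) zero    ss = ++⁻ˡ (rows (verts (isBasis P))) ss
    cellRows (P ∷ S) (suc i) ss = cellRows S i (++⁻ʳ (rows (verts (isBasis P))) ss)

    module _ {dQ : ℕ} (dimM : IsDim (basesOf M) dQ) (Ls : List (Matroid m × ℕ)) (enum : EnumeratesInt M S Ls) where

      face : Fin (length Ls) → Matroid m
      face i = proj₁ (L.lookup Ls i)

      dimension : Fin (length Ls) → ℕ
      dimension i = proj₂ (L.lookup Ls i)

      interior : ∀ i → InInt M S (face i)
      interior i = proj₁ (all-index (proj₁ enum) i)

      isDim : ∀ i → IsDim (basesOf (face i)) (dimension i)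
      isDim i = proj₂ (all-index (proj₁ enum) i)

      -- Subtraction of natural numbers is truncated; this bound makes the exponent in the sign the
      -- true difference of dimensions.
      dimension-≤ : ∀ i → dimension i ℕ.≤ dQ
      dimension-≤ i = decidable-stable (dimension i ℕ.≤? dQ) do
        us , lu , su , Ru ← dim-relOpen (isBasis (face i)) (isDim i)
        vs , lv , sv , Rv ← dim-relOpen (isBasis M) dimM
        return (ℕ.≤-pred (subst₂ ℕ._≤_ lu lv (indep-≤ us vs (indep Ru)
          (All.map (λ {u} s → span-trans _ vs (spanning Rv) (span-trans (verts (isBasis (face i))) (verts (isBasis M)) sub s)) su))))
        where
        sub : All (Span (verts (isBasis M))) (verts (isBasis (face i)))
        sub = all-verts⁺ (isBasis (face i)) λ B b →
          all-verts⁻ (isBasis M) (span-self (verts (isBasis M))) B (face⊆M (face i) (faceOfCell (face i) (interior i)) B b)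
        spanning : ∀ {vs} → RelOpen (PosOf M) vs → All (Span vs) (verts (isBasis M))
        spanning {vs} R = all-verts⁺ (isBasis M) λ B b →
          let gs = verts (isBasis M)
              pb = vsum-pos gs
              δ , 0<δ , k = small-witness (pos-nudge gs pb (all-verts⁻ (isBasis M) (span-self gs) B b))
          in comb-resp vs (λ i → trans (solve 4 (λ v x δ w → v :* ((x :+ δ :* w) :- con 1ℚ :* x) := (v :* δ) :* w) refl (inv δ (pos⇒≢0 0<δ)) (vsum gs i) δ (ê B i))
                            (trans (cong (_* ê B i) (inv-* δ (pos⇒≢0 0<δ))) (*-identityˡ (ê B i))))
               (span-⊙ vs (inv δ (pos⇒≢0 0<δ)) (span-sub vs 1ℚ (inSpan R k) (inSpan R pb)))

      χ-valuative : ∀ acc → (∀ N → Descending N (map proj₁ acc)) →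
        χ M acc ≡ ΣF (length Ls) (λ i → sgn (dQ ∸ dimension i) ℤ.* χ (face i) acc)
      χ-valuative acc desc = decidable-stable (_ ℤ.≟ _) do
        E₀ ← hasEuler M acc (desc M) dimM
        E  ← ¬¬-fin (λ i → hasEuler (face i) acc (desc (face i)) (isDim i))
        eq ← euler-partition (allRows S) (λ i → X (face i) acc) (λ i → sgn (suc (dimension i)) ℤ.* χ (face i) acc) E₀ E
               (λ i (p , os) → interior⊆ (face i) (interior i) p , os)
               disjoint
               (λ {x} (p , os) → return (covered p os))
               (λ i {x} {y} _ (_ , os) ss (p , _) → let j , F = faceOfCell (face i) (interior i) in face-by-signs F {x} {y} (cellRows S j ss) p , os)
        return (conclude eq)
        where
        disjoint : ∀ i j {x} → X (face i) acc x → X (face j) acc x → i ≡ j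
        disjoint i j (p , _) (p′ , _) with i F.≟ j
        ... | yes e = e
        ... | no ne = ⊥-elim (allPairs-index (λ h k → h (λ B → sym (k B))) (proj₂ (proj₂ enum)) i j ne
                        (same-face (face i) (face j) (faceOfCell (face i) (interior i)) (faceOfCell (face j) (interior j)) p p′))
        covered : ∀ {x} → PosOf M x → All (λ o → 0ℚ < o ∙ x) (map level acc) → ∃ λ i → X (face i) acc x
        covered {x} p os = let N , int , pN = covering p
                               i , same = any-index (proj₁ (proj₂ enum) N int)
          in i , subst (λ gs → Pos gs x) (verts-cong same) pN , os
        -- Additivity yields exponents dim + 1 on both sides, the dimensions of the cones.
        -- Multiplying by the sign of Q, whose square is one, turns them into differences of
        -- dimensions.
        conclude : sgn (suc dQ) ℤ.* χ M acc ≡ ΣF (length Ls) (λ i → sgn (suc (dimension i)) ℤ.* χ (face i) acc) →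
                   χ M acc ≡ ΣF (length Ls) (λ i → sgn (dQ ∸ dimension i) ℤ.* χ (face i) acc)
        conclude eq = trans (sym (trans (sym (ℤ.*-assoc (sgn (suc dQ)) (sgn (suc dQ)) (χ M acc))) (trans (cong (ℤ._* χ M acc) (sgn-square (suc dQ))) (ℤ.*-identityˡ _))))
          (trans (cong (sgn (suc dQ) ℤ.*_) eq) (trans (sym (ΣF-* (length Ls) (sgn (suc dQ)) (λ i → sgn (suc (dimension i)) ℤ.* χ (face i) acc)))
            (ΣF-cong (length Ls) λ i → trans (sym (ℤ.*-assoc (sgn (suc dQ)) (sgn (suc (dimension i))) (χ (face i) acc)))
              (cong (ℤ._* χ (face i) acc) (sgn-∸ {suc dQ} {suc (dimension i)} (ℕ.s≤s (dimension-≤ i)))))))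

-- The beta invariant as a signed sum of ranks over all subsets.

module BetaInvariant where

  open import Data.Bool.ListAction using (all; any)
  open import Data.Integer as ℤ using (ℤ; 0ℤ; 1ℤ; +_; -_; _+_; _*_)
  open import Data.Integer.Properties
  open import Data.Integer.Solver using (module +-*-Solver)
  open import Data.Vec.Properties using (lookup∘tabulate; lookup∘update; lookup∘update′)
  open import Data.Fin.Subset.Properties using (∣p∣≤n)
  open Subsets

  all⁺ : ∀ {A : Set} (p : A → Bool) xs → (∀ x → x ∈ xs → p x ≡ true) → all p xs ≡ true
  all⁺ p []       h = refl
  all⁺ p (x ∷ xs) h = ∧-intro (h x (here refl)) (all⁺ p xs (λ y y∈ → h y (there y∈)))

  all⁻ : ∀ {A : Set} (p : A → Bool) xs → all p xs ≡ true → ∀ {x} → x ∈ xs → p x ≡ true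
  all⁻ p (x ∷ xs) h (here refl) = proj₁ (∧-elim {p x} h)
  all⁻ p (x ∷ xs) h (there x∈)  = all⁻ p xs (proj₂ (∧-elim {p x} h)) x∈

  all-false : ∀ {A : Set} (p : A → Bool) xs → all p xs ≡ false → ∃ λ x → x ∈ xs × p x ≡ false
  all-false p (x ∷ xs) h with p x in e
  ... | false = x , here refl , e
  ... | true  = let y , y∈ , f = all-false p xs h in y , there y∈ , f

  any-true : ∀ {A : Set} (p : A → Bool) xs → any p xs ≡ true → ∃ λ x → p x ≡ true
  any-true p (x ∷ xs) h with p x in e
  ... | true  = x , e
  ... | false = any-true p xs h

  any-false : ∀ {A : Set} (p : A → Bool) xs → any p xs ≡ false → ∀ {x} → x ∈ xs → p x ≡ false
  any-false p (x ∷ xs) h x∈ with p x in e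
  any-false p (x ∷ xs) () x∈          | true
  any-false p (x ∷ xs) h  (here refl) | false = e
  any-false p (x ∷ xs) h  (there x∈)  | false = any-false p xs h x∈

  ⇒-true : ∀ {a b} → (a ≡ true → b ≡ true) → not a ∨ b ≡ true
  ⇒-true {true}  h = h refl
  ⇒-true {false} h = refl

  ⇒-elim : ∀ {a b} → not a ∨ b ≡ true → a ≡ true → b ≡ true
  ⇒-elim {true} h refl = h

  ≡ᵇ-true : ∀ a b → (a ℕ.≡ᵇ b) ≡ true → a ≡ b
  ≡ᵇ-true a b h = ℕ.≡ᵇ⇒≡ a b (Equivalence.from T-≡ h)

  true-≡ᵇ : ∀ {a b} → a ≡ b → (a ℕ.≡ᵇ b) ≡ true
  true-≡ᵇ {a} {b} h = Equivalence.to T-≡ (ℕ.≡⇒≡ᵇ a b h)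

  module _ {m : ℕ} where

    ⊆ᵇ⁺ : ∀ (A B : Subset m) → A ≼ B → (A ⊆ᵇ B) ≡ true
    ⊆ᵇ⁺ A B h = all⁺ (λ x → not (mem x A) ∨ mem x B) (allFin m) (λ x _ → ⇒-true (h x))

    ⊆ᵇ⁻ : ∀ (A B : Subset m) → (A ⊆ᵇ B) ≡ true → A ≼ B
    ⊆ᵇ⁻ A B h x = ⇒-elim (all⁻ (λ x → not (mem x A) ∨ mem x B) (allFin m) h (∈-allFin x))

    ⊊ᵇ⁻ : ∀ (A B : Subset m) → (A ⊊ᵇ B) ≡ true → A ≼ B × ∃ λ x → x ∈ˢ B × x ∉ˢ A
    ⊊ᵇ⁻ A B h with ∧-elim {A ⊆ᵇ B} h
    ... | h₁ , h₂ with all-false (λ x → not (mem x B) ∨ mem x A) (allFin m) (not-false h₂)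
    ... | x , _ , e with bool? (mem x B) | bool? (mem x A)
    ... | _      | inj₁ q = true≢false (⇒-true {mem x B} (λ _ → q)) e
    ... | inj₁ p | inj₂ q = ⊆ᵇ⁻ A B h₁ , x , p , q
    ... | inj₂ p | _      = true≢false (⇒-true {mem x B} (λ t → true≢false t p)) e

    ≡ᵇ⁻ : ∀ (A B : Subset m) → (A ≡ᵇ B) ≡ true → A ≡ B
    ≡ᵇ⁻ A B h = ≼-antisym (⊆ᵇ⁻ A B (proj₁ (∧-elim {A ⊆ᵇ B} h))) (⊆ᵇ⁻ B A (proj₂ (∧-elim {A ⊆ᵇ B} h)))

    ∪⁅⁆-absorb : ∀ {A : Subset m} x → x ∈ˢ A → A ∪ ⁅ x ⁆ ≡ A
    ∪⁅⁆-absorb {A} x h = ≼-antisym sub (λ z → ∈∪⁺ˡ {A = A})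
      where
      sub : A ∪ ⁅ x ⁆ ≼ A
      sub z k with ∈∪⁻ {A = A} k
      ... | inj₁ p = p
      ... | inj₂ p with ∈⁅⁆⁻ x z p
      ... | refl = h

    ∪⁅⁆-least : ∀ {A B : Subset m} x → A ≼ B → x ∈ˢ B → A ∪ ⁅ x ⁆ ≼ B
    ∪⁅⁆-least {A} x h p z k with ∈∪⁻ {A = A} k
    ... | inj₁ q = h z q
    ... | inj₂ q with ∈⁅⁆⁻ x z q
    ... | refl = p

    insert-remove : ∀ (A : Subset m) x → (A [ x ]≔ false) ∪ ⁅ x ⁆ ≡ A [ x ]≔ true
    insert-remove A x = ≼-antisym (∪⁅⁆-least {A = A [ x ]≔ false} {A [ x ]≔ true} x lower (lookup∘update x A true)) upper
      where
      lower : A [ x ]≔ false ≼ A [ x ]≔ true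
      lower z h with remove-∈⁻ {x = x} {x} {A} h
      ... | ne , p = trans (lookup∘update′ ne A true) p
      upper : A [ x ]≔ true ≼ (A [ x ]≔ false) ∪ ⁅ x ⁆
      upper z h with z F.≟ x
      ... | yes refl = ∈∪⁺ʳ {A = A [ z ]≔ false} (∈⁅⁆ z)
      ... | no ne    = ∈∪⁺ˡ {A = A [ x ]≔ false} (remove-∈⁺ {x = x} {x} {A} ne (trans (sym (lookup∘update′ ne A true)) h))

  ⟦_⟧ : Bool → ℤ
  ⟦ true ⟧  = 1ℤ
  ⟦ false ⟧ = 0ℤ

  ⟦⟧-false : ∀ {b} z → b ≡ false → ⟦ b ⟧ * z ≡ 0ℤ
  ⟦⟧-false z refl = *-zeroˡ z

  ⟦⟧-cong : ∀ b {x y} → (b ≡ true → x ≡ y) → ⟦ b ⟧ * x ≡ ⟦ b ⟧ * y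
  ⟦⟧-cong true  h = cong (1ℤ *_) (h refl)
  ⟦⟧-cong false {x} {y} h = trans (*-zeroˡ x) (sym (*-zeroˡ y))

  ΣS : ∀ {m} → (Subset m → ℤ) → ℤ
  ΣS {zero}  f = f []
  ΣS {suc m} f = ΣS (λ A → f (false ∷ A)) + ΣS (λ A → f (true ∷ A))

  open +-*-Solver using (solve; _:=_; _:+_; _:*_; _:-_; :-_; con)

  ΣS-cong : ∀ {m} {f g : Subset m → ℤ} → (∀ A → f A ≡ g A) → ΣS f ≡ ΣS g
  ΣS-cong {zero}  h = h []
  ΣS-cong {suc m} h = cong₂ _+_ (ΣS-cong (λ A → h (false ∷ A))) (ΣS-cong (λ A → h (true ∷ A)))

  ΣS-+ : ∀ {m} (f g : Subset m → ℤ) → ΣS (λ A → f A + g A) ≡ ΣS f + ΣS g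
  ΣS-+ {zero}  f g = refl
  ΣS-+ {suc m} f g = trans (cong₂ _+_ (ΣS-+ (f ∘ (false ∷_)) (g ∘ (false ∷_))) (ΣS-+ (f ∘ (true ∷_)) (g ∘ (true ∷_))))
    (solve 4 (λ a b c d → (a :+ b) :+ (c :+ d) := (a :+ c) :+ (b :+ d)) refl
      (ΣS (f ∘ (false ∷_))) (ΣS (g ∘ (false ∷_))) (ΣS (f ∘ (true ∷_))) (ΣS (g ∘ (true ∷_))))

  ΣS-* : ∀ {m} c (f : Subset m → ℤ) → ΣS (λ A → c * f A) ≡ c * ΣS f
  ΣS-* {zero}  c f = refl
  ΣS-* {suc m} c f = trans (cong₂ _+_ (ΣS-* c (f ∘ (false ∷_))) (ΣS-* c (f ∘ (true ∷_)))) (sym (*-distribˡ-+ c (ΣS (f ∘ (false ∷_))) (ΣS (f ∘ (true ∷_)))))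

  ΣS-0 : ∀ {m} (f : Subset m → ℤ) → (∀ A → f A ≡ 0ℤ) → ΣS f ≡ 0ℤ
  ΣS-0 {zero}  f h = h []
  ΣS-0 {suc m} f h = cong₂ _+_ (ΣS-0 (f ∘ (false ∷_)) (λ A → h (false ∷ A))) (ΣS-0 (f ∘ (true ∷_)) (λ A → h (true ∷ A)))

  ΣS-swap : ∀ {m n} (f : Subset m → Subset n → ℤ) → ΣS (λ A → ΣS (f A)) ≡ ΣS (λ B → ΣS (λ A → f A B))
  ΣS-swap {zero}  f = refl
  ΣS-swap {suc m} f = trans (cong₂ _+_ (ΣS-swap (f ∘ (false ∷_))) (ΣS-swap (f ∘ (true ∷_))))
    (sym (ΣS-+ (λ B → ΣS (λ A → f (false ∷ A) B)) (λ B → ΣS (λ A → f (true ∷ A) B))))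

  -- Subsets that differ in `x` only cancel in pairs.
  ΣS-toggle : ∀ {m} x (f : Subset m → ℤ) → (∀ A → f (A [ x ]≔ true) ≡ - f (A [ x ]≔ false)) → ΣS f ≡ 0ℤ
  ΣS-toggle zero    f h = trans (sym (ΣS-+ (f ∘ (false ∷_)) (f ∘ (true ∷_))))
    (ΣS-0 _ λ A → trans (cong (_+_ (f (false ∷ A))) (h (false ∷ A))) (+-inverseʳ (f (false ∷ A))))
  ΣS-toggle (suc x) f h = cong₂ _+_ (ΣS-toggle x (f ∘ (false ∷_)) (λ A → h (false ∷ A))) (ΣS-toggle x (f ∘ (true ∷_)) (λ A → h (true ∷ A)))

  -- Recursive along the coordinates like `ΣS`, so that a sum against this Kronecker delta collapses
  -- by induction.
  _==_ : ∀ {m} → Subset m → Subset m → Bool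
  []          == []          = true
  (true  ∷ A) == (true  ∷ B) = A == B
  (false ∷ A) == (false ∷ B) = A == B
  (true  ∷ A) == (false ∷ B) = false
  (false ∷ A) == (true  ∷ B) = false

  ==-refl : ∀ {m} (A : Subset m) → (A == A) ≡ true
  ==-refl []          = refl
  ==-refl (true  ∷ A) = ==-refl A
  ==-refl (false ∷ A) = ==-refl A

  ==⇒≡ : ∀ {m} (A B : Subset m) → (A == B) ≡ true → A ≡ B
  ==⇒≡ []          []          h = refl
  ==⇒≡ (true  ∷ A) (true  ∷ B) h = cong (true ∷_) (==⇒≡ A B h)
  ==⇒≡ (false ∷ A) (false ∷ B) h = cong (false ∷_) (==⇒≡ A B h)

  ΣS-== : ∀ {m} (B : Subset m) (f : Subset m → ℤ) → ΣS (λ A → ⟦ B == A ⟧ * f A) ≡ f B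
  ΣS-== []          f = *-identityˡ (f [])
  ΣS-== (false ∷ B) f = trans (cong₂ _+_ (ΣS-== B (f ∘ (false ∷_))) (ΣS-0 (λ A → 0ℤ * f (true ∷ A)) (λ A → *-zeroˡ (f (true ∷ A))))) (+-identityʳ _)
  ΣS-== (true  ∷ B) f = trans (cong₂ _+_ (ΣS-0 (λ A → 0ℤ * f (false ∷ A)) (λ A → *-zeroˡ (f (false ∷ A)))) (ΣS-== B (f ∘ (true ∷_)))) (+-identityˡ _)

  sumℤ-++ : ∀ xs ys → sumℤ (xs ++ ys) ≡ sumℤ xs + sumℤ ys
  sumℤ-++ []       ys = sym (+-identityˡ (sumℤ ys))
  sumℤ-++ (x ∷ xs) ys = trans (cong (_+_ x) (sumℤ-++ xs ys)) (sym (+-assoc x (sumℤ xs) (sumℤ ys)))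

  sum-allSubsets : ∀ m (f : Subset m → ℤ) → sumℤ (map f (allSubsets m)) ≡ ΣS f
  sum-allSubsets zero    f = +-identityʳ (f [])
  sum-allSubsets (suc m) f = trans (cong sumℤ (L.map-++ f (map (false ∷_) (allSubsets m)) (map (true ∷_) (allSubsets m))))
    (trans (sumℤ-++ (map f (map (false ∷_) (allSubsets m))) (map f (map (true ∷_) (allSubsets m))))
      (cong₂ _+_ (trans (cong sumℤ (sym (L.map-∘ (allSubsets m)))) (sum-allSubsets m (f ∘ (false ∷_))))
                 (trans (cong sumℤ (sym (L.map-∘ (allSubsets m)))) (sum-allSubsets m (f ∘ (true ∷_))))))

  sum-filterᵇ : ∀ {A : Set} (p : A → Bool) (f : A → ℤ) xs → sumℤ (map f (filterᵇ p xs)) ≡ sumℤ (map (λ x → ⟦ p x ⟧ * f x) xs)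
  sum-filterᵇ p f []       = refl
  sum-filterᵇ p f (x ∷ xs) with p x
  ... | true  = cong₂ _+_ (sym (*-identityˡ (f x))) (sum-filterᵇ p f xs)
  ... | false = trans (sum-filterᵇ p f xs) (trans (sym (+-identityˡ _)) (cong (_+ sumℤ (map (λ x → ⟦ p x ⟧ * f x) xs)) (sym (*-zeroˡ (f x)))))

  sgn-toggle : ∀ {m} (A : Subset m) x → sgn ∣ A [ x ]≔ true ∣ ≡ - sgn ∣ A [ x ]≔ false ∣
  sgn-toggle A x = cong sgn (card A x)
    where
    card : ∀ {m} (A : Subset m) x → ∣ A [ x ]≔ true ∣ ≡ suc ∣ A [ x ]≔ false ∣
    card (b ∷ A)     zero    = refl
    card (true ∷ A)  (suc x) = cong suc (card A x)
    card (false ∷ A) (suc x) = card A x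

  ⊆ᵇ-toggle : ∀ {m} (A F : Subset m) x → x ∈ˢ F → ((A [ x ]≔ true) ⊆ᵇ F) ≡ ((A [ x ]≔ false) ⊆ᵇ F)
  ⊆ᵇ-toggle A F x h = bool-ext
    (λ k → ⊆ᵇ⁺ (A [ x ]≔ false) F λ z p → ⊆ᵇ⁻ (A [ x ]≔ true) F k z (subst (z ∈ˢ_) (insert-remove A x) (∈∪⁺ˡ {A = A [ x ]≔ false} p)))
    (λ k → ⊆ᵇ⁺ (A [ x ]≔ true) F (subst (_≼ F) (insert-remove A x) (∪⁅⁆-least {A = A [ x ]≔ false} {F} x (⊆ᵇ⁻ (A [ x ]≔ false) F k) h)))

  signed-subsets : ∀ {m} (F : Subset m) x → x ∈ˢ F → ΣS (λ A → ⟦ A ⊆ᵇ F ⟧ * sgn ∣ A ∣) ≡ 0ℤ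
  signed-subsets F x h = ΣS-toggle x _ λ A → trans (cong₂ (λ b s → ⟦ b ⟧ * s) (⊆ᵇ-toggle A F x h) (sgn-toggle A x))
    (sym (neg-distribʳ-* ⟦ (A [ x ]≔ false) ⊆ᵇ F ⟧ (sgn ∣ A [ x ]≔ false ∣)))

  module _ {m : ℕ} (S : Subset m) (ρ : Subset m → ℕ)
    (ρ-mono : ∀ A B → A ≼ B → ρ A ℕ.≤ ρ B)
    (ρ-closure : ∀ A B x → A ≼ B → ρ (A ∪ ⁅ x ⁆) ≡ ρ A → ρ (B ∪ ⁅ x ⁆) ≡ ρ B)
    (ρ-∅ : ρ ∅ˢ ≡ 0) where

    signedRank : ℤ
    signedRank = ΣS (λ A → ⟦ A ⊆ᵇ S ⟧ * (sgn ∣ A ∣ * + ρ A))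

    signedRank-loop : ∀ x → x ∈ˢ S → ρ ⁅ x ⁆ ≡ 0 → signedRank ≡ 0ℤ
    signedRank-loop x h loop = ΣS-toggle x _ λ A → trans
      (cong₂ (λ b s → ⟦ b ⟧ * s) (⊆ᵇ-toggle A S x h) (cong₂ _*_ (sgn-toggle A x)
        (cong +_ (trans (cong ρ (sym (insert-remove A x))) (ρ-closure ∅ˢ (A [ x ]≔ false) x (λ z p → true≢false p (∉∅ z)) at-∅)))))
      (solve 3 (λ b s r → b :* ((:- s) :* r) := :- (b :* (s :* r))) refl ⟦ (A [ x ]≔ false) ⊆ᵇ S ⟧ (sgn ∣ A [ x ]≔ false ∣) (+ ρ (A [ x ]≔ false)))
      where
      ∅∪ : ∅ˢ ∪ ⁅ x ⁆ ≡ ⁅ x ⁆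
      ∅∪ = ≼-antisym sub (λ z → ∈∪⁺ʳ {A = ∅ˢ} {⁅ x ⁆})
        where
        sub : ∅ˢ ∪ ⁅ x ⁆ ≼ ⁅ x ⁆
        sub z k with ∈∪⁻ {A = ∅ˢ} {⁅ x ⁆} k
        ... | inj₁ p = true≢false p (∉∅ z)
        ... | inj₂ p = p
      at-∅ : ρ (∅ˢ ∪ ⁅ x ⁆) ≡ ρ ∅ˢ
      at-∅ = trans (cong ρ ∅∪) (trans loop (sym ρ-∅))

    N : RankData m
    N = S , ρ

    flat⁻ : ∀ A → isFlatᵇ N A ≡ true → A ≼ S × (∀ x → x ∈ˢ S → x ∉ˢ A → ρ A ℕ.< ρ (A ∪ ⁅ x ⁆))
    flat⁻ A h = let h₁ , h₂ = ∧-elim {A ⊆ᵇ S} h in ⊆ᵇ⁻ A S h₁ , λ x p q →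
      <ᵇ⁻ (ρ A) (ρ (A ∪ ⁅ x ⁆)) (⇒-elim (all⁻ (λ x → not (mem x S ∧ not (mem x A)) ∨ (ρ A ℕ.<ᵇ ρ (A ∪ ⁅ x ⁆))) (allFin m) h₂ (∈-allFin x)) (∧-intro p (cong not q)))

    flat⁺ : ∀ A → A ≼ S → (∀ x → x ∈ˢ S → x ∉ˢ A → ρ A ℕ.< ρ (A ∪ ⁅ x ⁆)) → isFlatᵇ N A ≡ true
    flat⁺ A h k = ∧-intro (⊆ᵇ⁺ A S h) (all⁺ (λ x → not (mem x S ∧ not (mem x A)) ∨ (ρ A ℕ.<ᵇ ρ (A ∪ ⁅ x ⁆))) (allFin m) λ x _ → ⇒-true λ e →
      let p , q = ∧-elim {mem x S} e in <ᵇ⁺ (k x p (not-false q)))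

    -- Elements of `B` outside `A` are removed one at a time; by `ρ-closure` each adds nothing to
    -- the larger set that remains, as it adds nothing to `A`. The number `n` bounds how many are
    -- left.
    ρ-join : ∀ n {A B} → ∣ B ∖ A ∣ ℕ.≤ n → A ≼ B → (∀ x → x ∈ˢ B → ρ (A ∪ ⁅ x ⁆) ≡ ρ A) → ρ B ≡ ρ A
    ρ-join n {A} {B} le h k with search (λ x → mem x B ∧ not (mem x A))
    ... | inj₂ none = cong ρ (≼-antisym {A = B} {A} B≼A h)
      where
      B≼A : B ≼ A
      B≼A x p with bool? (mem x A)
      ... | inj₁ q = q
      ... | inj₂ q = true≢false (∧-intro p (cong not q)) (none x)
    ... | inj₁ (x , e) with ∧-elim {mem x B} e
    ... | p , q′ with not-false q′ | n
    ... | q | zero = ⊥-elim (ℕ.<⇒≱ (card-strict {A = ∅ˢ} {B ∖ A} x (λ z r → true≢false r (∉∅ z)) (∈∖⁺ {A = B} {A} p q) (∉∅ x)) (ℕ.≤-trans le ℕ.z≤n))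
    ... | q | suc n = trans (cong ρ (sym rebuild)) (trans (ρ-closure A (B [ x ]≔ false) x A≼ (k x p))
           (ρ-join n {A} {B [ x ]≔ false} (ℕ.≤-pred (ℕ.≤-trans smaller le)) A≼ (λ y r → k y (proj₂ (remove-∈⁻ {x = x} {x} {B} r)))))
      where
      A≼ : A ≼ B [ x ]≔ false
      A≼ z r = remove-∈⁺ {x = x} {x} {B} (λ { refl → true≢false r q }) (h z r)
      rebuild : (B [ x ]≔ false) ∪ ⁅ x ⁆ ≡ B
      rebuild = ≼-antisym (∪⁅⁆-least {A = B [ x ]≔ false} {B} x (λ z r → proj₂ (remove-∈⁻ {x = x} {x} {B} r)) p) back
        where
        back : B ≼ (B [ x ]≔ false) ∪ ⁅ x ⁆
        back z r with z F.≟ x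
        ... | yes refl = ∈∪⁺ʳ {A = B [ z ]≔ false} (∈⁅⁆ z)
        ... | no ne    = ∈∪⁺ˡ {A = B [ x ]≔ false} (remove-∈⁺ {x = x} {x} {B} ne r)
      smaller : ∣ (B [ x ]≔ false) ∖ A ∣ ℕ.< ∣ B ∖ A ∣
      smaller = card-strict {A = (B [ x ]≔ false) ∖ A} {B ∖ A} x
        (λ z r → let u , v = ∈∖⁻ {A = B [ x ]≔ false} {A} r in ∈∖⁺ {A = B} {A} (proj₂ (remove-∈⁻ {x = x} {x} {B} u)) v)
        (∈∖⁺ {A = B} {A} p q) (¬true⇒false λ r → proj₁ (remove-∈⁻ {x = x} {x} {B} (proj₁ (∈∖⁻ {A = B [ x ]≔ false} {A} r))) refl)

    inClosure : Subset m → Fin m → Bool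
    inClosure A x = mem x S ∧ (ρ (A ∪ ⁅ x ⁆) ℕ.≡ᵇ ρ A)

    cl : Subset m → Subset m
    cl A = tabulate (inClosure A)

    cl⁻ : ∀ A x → x ∈ˢ cl A → x ∈ˢ S × ρ (A ∪ ⁅ x ⁆) ≡ ρ A
    cl⁻ A x h = let p , q = ∧-elim {mem x S} (trans (sym (lookup∘tabulate (inClosure A) x)) h) in p , ≡ᵇ-true (ρ (A ∪ ⁅ x ⁆)) (ρ A) q

    cl⁺ : ∀ A x → x ∈ˢ S → ρ (A ∪ ⁅ x ⁆) ≡ ρ A → x ∈ˢ cl A
    cl⁺ A x p q = trans (lookup∘tabulate (inClosure A) x) (∧-intro p (true-≡ᵇ q))

    cl-⊇ : ∀ A → A ≼ S → A ≼ cl A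
    cl-⊇ A h x p = cl⁺ A x (h x p) (cong ρ (∪⁅⁆-absorb x p))

    cl-rank : ∀ A → A ≼ S → ρ (cl A) ≡ ρ A
    cl-rank A h = ρ-join ∣ cl A ∖ A ∣ ℕ.≤-refl (cl-⊇ A h) (λ x p → proj₂ (cl⁻ A x p))

    cl-flat : ∀ A → A ≼ S → isFlatᵇ N (cl A) ≡ true
    cl-flat A h = flat⁺ (cl A) (λ x p → proj₁ (cl⁻ A x p)) λ x p q → ℕ.≤∧≢⇒< (ρ-mono (cl A) (cl A ∪ ⁅ x ⁆) (λ z → ∈∪⁺ˡ {A = cl A}))
      λ e → true≢false (cl⁺ A x p (ℕ.≤-antisym
        (ℕ.≤-trans (ρ-mono (A ∪ ⁅ x ⁆) (cl A ∪ ⁅ x ⁆) (∪-mono {A = A} {cl A} {⁅ x ⁆} {⁅ x ⁆} (cl-⊇ A h) (λ _ r → r))) (ℕ.≤-reflexive (trans (sym e) (cl-rank A h))))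
        (ρ-mono A (A ∪ ⁅ x ⁆) (λ z → ∈∪⁺ˡ {A = A})))) q

    cl-least : ∀ A F → isFlatᵇ N F ≡ true → A ≼ F → cl A ≼ F
    cl-least A F f h x p with bool? (mem x F)
    ... | inj₁ q = q
    ... | inj₂ q = ⊥-elim (ℕ.<-irrefl (sym (ρ-closure A F x h (proj₂ (cl⁻ A x p)))) (proj₂ (flat⁻ F f) x (proj₁ (cl⁻ A x p)) q))

    -- The signed count of the spanning sets of F satisfies the recursion of μ(∅,F).
    ν : Subset m → ℤ
    ν F = ΣS (λ A → ⟦ A ⊆ᵇ S ⟧ * (⟦ cl A == F ⟧ * sgn ∣ A ∣))

    -- Every subset of `S` is counted by `ν` at exactly one set, its closure, so a sum over closures
    -- regroups into a sum over subsets.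
    ν-fibres : ∀ (g : Subset m → ℤ) → ΣS (λ F → g F * ν F) ≡ ΣS (λ A → ⟦ A ⊆ᵇ S ⟧ * (g (cl A) * sgn ∣ A ∣))
    ν-fibres g = trans (ΣS-cong λ F → sym (ΣS-* (g F) (λ A → ⟦ A ⊆ᵇ S ⟧ * (⟦ cl A == F ⟧ * sgn ∣ A ∣))))
      (trans (ΣS-swap (λ F A → g F * (⟦ A ⊆ᵇ S ⟧ * (⟦ cl A == F ⟧ * sgn ∣ A ∣))))
        (ΣS-cong λ A → trans (ΣS-cong λ F → solve 4 (λ g s c t → g :* (s :* (c :* t)) := c :* (s :* (g :* t))) refl (g F) ⟦ A ⊆ᵇ S ⟧ ⟦ cl A == F ⟧ (sgn ∣ A ∣))
          (ΣS-== (cl A) (λ F → ⟦ A ⊆ᵇ S ⟧ * (g F * sgn ∣ A ∣)))))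

    -- For a flat `F`, the closure of A lies in `F` if and only if A does; the fibres of `cl` over
    -- the flats inside `F` thus exhaust the subsets of `F`.
    flats-below : ∀ F → isFlatᵇ N F ≡ true → ΣS (λ Z → (⟦ isFlatᵇ N Z ⟧ * ⟦ Z ⊆ᵇ F ⟧) * ν Z) ≡ ΣS (λ A → ⟦ A ⊆ᵇ F ⟧ * sgn ∣ A ∣)
    flats-below F f = trans (ν-fibres (λ Z → ⟦ isFlatᵇ N Z ⟧ * ⟦ Z ⊆ᵇ F ⟧)) (ΣS-cong term)
      where
      term : ∀ A → ⟦ A ⊆ᵇ S ⟧ * ((⟦ isFlatᵇ N (cl A) ⟧ * ⟦ cl A ⊆ᵇ F ⟧) * sgn ∣ A ∣) ≡ ⟦ A ⊆ᵇ F ⟧ * sgn ∣ A ∣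
      term A with bool? (A ⊆ᵇ S)
      ... | inj₁ e = trans (cong₂ (λ b c → ⟦ b ⟧ * ((⟦ c ⟧ * ⟦ cl A ⊆ᵇ F ⟧) * sgn ∣ A ∣)) e (cl-flat A A≼S))
              (trans (solve 2 (λ c t → con 1ℤ :* ((con 1ℤ :* c) :* t) := c :* t) refl ⟦ cl A ⊆ᵇ F ⟧ (sgn ∣ A ∣))
                (cong (λ b → ⟦ b ⟧ * sgn ∣ A ∣) (bool-ext (λ h → ⊆ᵇ⁺ A F (≼-trans {A = A} {cl A} {F} (cl-⊇ A A≼S) (⊆ᵇ⁻ (cl A) F h))) (λ h → ⊆ᵇ⁺ (cl A) F (cl-least A F f (⊆ᵇ⁻ A F h))))))
        where
        A≼S : A ≼ S
        A≼S = ⊆ᵇ⁻ A S e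
      ... | inj₂ e = trans (⟦⟧-false _ e) (sym (⟦⟧-false (sgn ∣ A ∣) (¬true⇒false λ h → true≢false (⊆ᵇ⁺ A S (≼-trans {A = A} {F} {S} (⊆ᵇ⁻ A F h) (proj₁ (flat⁻ F f)))) e)))

    below-split : ∀ F → isFlatᵇ N F ≡ true → ΣS (λ Z → (⟦ isFlatᵇ N Z ⟧ * ⟦ Z ⊆ᵇ F ⟧) * ν Z) ≡ ΣS (λ Z → (⟦ isFlatᵇ N Z ⟧ * ⟦ Z ⊊ᵇ F ⟧) * ν Z) + ν F
    below-split F f = trans (ΣS-cong term) (trans (ΣS-+ (λ Z → (⟦ isFlatᵇ N Z ⟧ * ⟦ Z ⊊ᵇ F ⟧) * ν Z) (λ Z → ⟦ F == Z ⟧ * ν Z))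
        (cong (_+_ (ΣS (λ Z → (⟦ isFlatᵇ N Z ⟧ * ⟦ Z ⊊ᵇ F ⟧) * ν Z))) (ΣS-== F ν)))
      where
      term : ∀ Z → (⟦ isFlatᵇ N Z ⟧ * ⟦ Z ⊆ᵇ F ⟧) * ν Z ≡ (⟦ isFlatᵇ N Z ⟧ * ⟦ Z ⊊ᵇ F ⟧) * ν Z + ⟦ F == Z ⟧ * ν Z
      term Z with bool? (F == Z)
      ... | inj₁ e with ==⇒≡ F Z e
      ... | refl = diagonal f (⊆ᵇ⁺ F F (λ _ p → p)) (¬true⇒false λ h → let _ , x , p , q = ⊊ᵇ⁻ F F h in true≢false p q) e
        where
        diagonal : ∀ {b s t q v} → b ≡ true → s ≡ true → t ≡ false → q ≡ true → (⟦ b ⟧ * ⟦ s ⟧) * v ≡ (⟦ b ⟧ * ⟦ t ⟧) * v + ⟦ q ⟧ * v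
        diagonal {v = v} refl refl refl refl = solve 1 (λ v → (con 1ℤ :* con 1ℤ) :* v := (con 1ℤ :* con 0ℤ) :* v :+ con 1ℤ :* v) refl v
      term Z | inj₂ e = trans (cong (λ b → (⟦ isFlatᵇ N Z ⟧ * ⟦ b ⟧) * ν Z) same) (trans (sym (+-identityʳ _)) (cong (_+_ ((⟦ isFlatᵇ N Z ⟧ * ⟦ Z ⊊ᵇ F ⟧) * ν Z)) (sym (⟦⟧-false (ν Z) e))))
        where
        same : (Z ⊆ᵇ F) ≡ (Z ⊊ᵇ F)
        same = bool-ext (λ h → ∧-intro h (cong not (¬true⇒false λ k → true≢false (subst (λ B → (F == B) ≡ true) (≼-antisym (⊆ᵇ⁻ F Z k) (⊆ᵇ⁻ Z F h)) (==-refl F)) e)))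
                        (λ h → proj₁ (∧-elim {Z ⊆ᵇ F} h))

    -- For nonempty `F` the signed subsets of `F` cancel, so the values of `ν` on the flats inside
    -- `F` sum to zero, which is the recursion of μ. An empty `F` is its own closure, and only the
    -- empty set is counted. Strictly smaller flats have smaller cardinality, so the fuel suffices.
    μ≡ν : (∀ x → x ∈ˢ S → ρ ⁅ x ⁆ ≢ 0) → ∀ f F → ∣ F ∣ ℕ.< f → isFlatᵇ N F ≡ true → μ₀ f N F ≡ ν F
    μ≡ν loopless (suc f) F lt fl with bool? (F ≡ᵇ ∅ˢ)
    ... | inj₁ e = trans (cong (λ b → if b then 1ℤ else - sumℤ (map (μ₀ f N) (filterᵇ (λ Z → Z ⊊ᵇ F) (flats N)))) e)
           (sym (trans (ΣS-cong only-∅) (trans (ΣS-== (∅ˢ {m}) (λ A → sgn ∣ A ∣)) (cong sgn (card-∅ {m})))))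
      where
      F≡∅ : F ≡ ∅ˢ
      F≡∅ = ≡ᵇ⁻ F ∅ˢ e
      only-∅ : ∀ A → ⟦ A ⊆ᵇ S ⟧ * (⟦ cl A == F ⟧ * sgn ∣ A ∣) ≡ ⟦ ∅ˢ == A ⟧ * sgn ∣ A ∣
      only-∅ A with bool? (∅ˢ == A)
      ... | inj₁ h with ==⇒≡ ∅ˢ A h
      ... | refl = trans (cong₂ (λ b c → ⟦ b ⟧ * (⟦ c ⟧ * sgn ∣ ∅ˢ {m} ∣)) (⊆ᵇ⁺ ∅ˢ S (∅≼ S)) (trans (cong₂ _==_ cl∅ F≡∅) (==-refl (∅ˢ {m}))))
              (trans (*-identityˡ _) (cong (λ b → ⟦ b ⟧ * sgn ∣ ∅ˢ {m} ∣) (sym h)))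
        where
        ∅≼ : ∀ (B : Subset m) → ∅ˢ ≼ B
        ∅≼ B z p = true≢false p (∉∅ z)
        cl∅ : cl ∅ˢ ≡ ∅ˢ
        cl∅ = ≼-antisym (subst (cl ∅ˢ ≼_) F≡∅ (cl-least ∅ˢ F fl (∅≼ F))) (∅≼ (cl ∅ˢ))
      only-∅ A | inj₂ h = trans both (sym (⟦⟧-false (sgn ∣ A ∣) h))
        where
        both : ⟦ A ⊆ᵇ S ⟧ * (⟦ cl A == F ⟧ * sgn ∣ A ∣) ≡ 0ℤ
        both with bool? (A ⊆ᵇ S) | bool? (cl A == F)
        ... | inj₂ k | _ = ⟦⟧-false (⟦ cl A == F ⟧ * sgn ∣ A ∣) k
        ... | inj₁ _ | inj₂ k = trans (cong (λ b → ⟦ A ⊆ᵇ S ⟧ * (⟦ b ⟧ * sgn ∣ A ∣)) k) (trans (cong (⟦ A ⊆ᵇ S ⟧ *_) (*-zeroˡ (sgn ∣ A ∣))) (*-zeroʳ ⟦ A ⊆ᵇ S ⟧))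
        ... | inj₁ k | inj₁ l = true≢false (subst (λ B → (∅ˢ {m} == B) ≡ true) (sym A≡∅) (==-refl (∅ˢ {m}))) h
          where
          A≡∅ : A ≡ ∅ˢ
          A≡∅ = ≼-antisym (subst (A ≼_) (trans (==⇒≡ (cl A) F l) F≡∅) (cl-⊇ A (⊆ᵇ⁻ A S k))) (λ z p → true≢false p (∉∅ z))
    ... | inj₂ e = trans (cong (λ b → if b then 1ℤ else - sumℤ (map (μ₀ f N) (filterᵇ (λ Z → Z ⊊ᵇ F) (flats N)))) e)
           (trans (cong -_ recursive) (solve-neg (trans (sym (below-split F fl)) (trans (flats-below F fl) (signed-subsets F (proj₁ inhabitant) (proj₂ inhabitant))))))
      where
      solve-neg : ∀ {a b} → a + b ≡ 0ℤ → - a ≡ b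
      solve-neg {a} {b} h = trans (solve 2 (λ a b → :- a := b :- (a :+ b)) refl a b) (trans (cong (λ s → b + - s) h) (+-identityʳ b))
      inhabitant : ∃ λ x → x ∈ˢ F
      inhabitant with search (λ x → mem x F)
      ... | inj₁ w = w
      ... | inj₂ none = true≢false (∧-intro (⊆ᵇ⁺ F ∅ˢ (λ x p → true≢false p (none x))) (⊆ᵇ⁺ ∅ˢ F (λ z p → true≢false p (∉∅ z)))) e
      recursive : sumℤ (map (μ₀ f N) (filterᵇ (λ Z → Z ⊊ᵇ F) (flats N))) ≡ ΣS (λ Z → (⟦ isFlatᵇ N Z ⟧ * ⟦ Z ⊊ᵇ F ⟧) * ν Z)
      recursive = trans (sum-filterᵇ (λ Z → Z ⊊ᵇ F) (μ₀ f N) (flats N))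
        (trans (sum-filterᵇ (isFlatᵇ N) (λ Z → ⟦ Z ⊊ᵇ F ⟧ * μ₀ f N Z) (allSubsets m))
          (trans (sum-allSubsets m (λ Z → ⟦ isFlatᵇ N Z ⟧ * (⟦ Z ⊊ᵇ F ⟧ * μ₀ f N Z))) (ΣS-cong term)))
        where
        term : ∀ Z → ⟦ isFlatᵇ N Z ⟧ * (⟦ Z ⊊ᵇ F ⟧ * μ₀ f N Z) ≡ (⟦ isFlatᵇ N Z ⟧ * ⟦ Z ⊊ᵇ F ⟧) * ν Z
        term Z = trans (⟦⟧-cong (isFlatᵇ N Z) λ h → ⟦⟧-cong (Z ⊊ᵇ F) λ k → μ≡ν loopless f Z (ℕ.≤-trans (smaller (⊊ᵇ⁻ Z F k)) (ℕ.≤-pred lt)) h)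
                   (sym (*-assoc ⟦ isFlatᵇ N Z ⟧ ⟦ Z ⊊ᵇ F ⟧ (ν Z)))
          where
          smaller : (Z ≼ F × ∃ λ x → x ∈ˢ F × x ∉ˢ Z) → ∣ Z ∣ ℕ.< ∣ F ∣
          smaller (sub , x , p , q) = card-strict {A = Z} {F} x sub p q

    -- Regrouping by closures turns the sum over flats into one over subsets, and a set has the rank
    -- of its closure. If there is a loop, β is zero by convention and the signed sum is zero by
    -- toggling the loop, so one formula covers both cases.
    β-formula : β N ≡ sgn (ρ S) * signedRank
    β-formula with bool? (loopyᵇ N)
    ... | inj₁ e = trans (cong (λ b → if b then 0ℤ else sgn (ρ S) * sumℤ (map (λ F → μ₀ (suc m) N F * + (ρ F)) (flats N))) e)
           (sym (trans (cong (sgn (ρ S) *_) (looped (any-true _ (allFin m) e))) (*-zeroʳ (sgn (ρ S)))))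
      where
      looped : (∃ λ x → (mem x S ∧ (ρ ⁅ x ⁆ ℕ.≡ᵇ 0)) ≡ true) → signedRank ≡ 0ℤ
      looped (x , h) = let p , q = ∧-elim {mem x S} h in signedRank-loop x p (≡ᵇ-true (ρ ⁅ x ⁆) 0 q)
    ... | inj₂ e = trans (cong (λ b → if b then 0ℤ else sgn (ρ S) * sumℤ (map (λ F → μ₀ (suc m) N F * + (ρ F)) (flats N))) e)
           (cong (sgn (ρ S) *_) (trans (sum-filterᵇ (isFlatᵇ N) (λ F → μ₀ (suc m) N F * + (ρ F)) (allSubsets m))
             (trans (sum-allSubsets m (λ F → ⟦ isFlatᵇ N F ⟧ * (μ₀ (suc m) N F * + (ρ F))))
               (trans (ΣS-cong term₁) (trans (ν-fibres (λ F → ⟦ isFlatᵇ N F ⟧ * + ρ F)) (ΣS-cong term₂))))))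
      where
      loopless : ∀ x → x ∈ˢ S → ρ ⁅ x ⁆ ≢ 0
      loopless x p q = true≢false (∧-intro p (true-≡ᵇ q)) (any-false (λ x → mem x S ∧ (ρ ⁅ x ⁆ ℕ.≡ᵇ 0)) (allFin m) e (∈-allFin x))
      term₁ : ∀ F → ⟦ isFlatᵇ N F ⟧ * (μ₀ (suc m) N F * + ρ F) ≡ (⟦ isFlatᵇ N F ⟧ * + ρ F) * ν F
      term₁ F = trans (⟦⟧-cong (isFlatᵇ N F) λ h → cong (_* + ρ F) (μ≡ν loopless (suc m) F (ℕ.s≤s (∣p∣≤n F)) h))
                  (solve 3 (λ b v r → b :* (v :* r) := (b :* r) :* v) refl ⟦ isFlatᵇ N F ⟧ (ν F) (+ ρ F))
      term₂ : ∀ A → ⟦ A ⊆ᵇ S ⟧ * ((⟦ isFlatᵇ N (cl A) ⟧ * + ρ (cl A)) * sgn ∣ A ∣) ≡ ⟦ A ⊆ᵇ S ⟧ * (sgn ∣ A ∣ * + ρ A)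
      term₂ A = ⟦⟧-cong (A ⊆ᵇ S) λ h → trans (cong₂ (λ b r → (⟦ b ⟧ * + r) * sgn ∣ A ∣) (cl-flat A (⊆ᵇ⁻ A S h)) (cl-rank A (⊆ᵇ⁻ A S h)))
                  (solve 2 (λ r t → (con 1ℤ :* r) :* t := t :* r) refl (+ ρ A) (sgn ∣ A ∣))

-- Weights of `csm` on chains and their expansion into rank indicators.

module ChainWeights where

  open import Data.Bool.ListAction using (all)
  open import Data.Integer as ℤ using (ℤ; 0ℤ; 1ℤ; +_; -_; _+_; _*_)
  open import Data.Integer.Properties
  open import Data.Integer.Solver using (module +-*-Solver)
  open import Data.Fin.Subset.Properties using (∣p∣≤n; ∪-comm; ∪-identityˡ)
  open +-*-Solver using (solve; _:=_; _:+_; _:*_; _:-_; :-_; con)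
  open Euler using (ΣF; ΣF-cong; ΣF-+; ΣF-*; ΣF-0)
  open Subsets
  open Matroids
  open BetaInvariant
  open Valuations

  pos-∸ : ∀ {a b} → b ℕ.≤ a → + (a ∸ b) ≡ + a + - + b
  pos-∸ {a} {b} h = trans (sym (⊖-≥ h)) (sym (m-n≡m⊖n a b))

  strict : ∀ {m} → List (Subset m) → Bool
  strict Fs = all (λ p → proj₁ p ⊊ᵇ proj₂ p) (consecPairs Fs)

  lastOf : ∀ {m} → Subset m → List (Subset m) → Subset m
  lastOf F []       = F
  lastOf F (G ∷ Fs) = lastOf G Fs

  lastOf-++ : ∀ {m} (F : Subset m) Fs G → lastOf F (Fs ++ (G ∷ [])) ≡ G
  lastOf-++ F []       G = refl
  lastOf-++ F (H ∷ Fs) G = lastOf-++ H Fs G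

  module _ {m : ℕ} (M : Matroid m) where

    rk-mono : ∀ {A B} → A ≼ B → rk M A ℕ.≤ rk M B
    rk-mono {A} {B} h = subst₂ ℕ._≤_ (rank-unfold M A) (rank-unfold M B) (rank-mono M h)

    rk-closure : ∀ {A B} x → A ≼ B → rk M (A ∪ ⁅ x ⁆) ≡ rk M A → rk M (B ∪ ⁅ x ⁆) ≡ rk M B
    rk-closure {A} {B} x h e = trans (sym (rank-unfold M _)) (trans (rank-closure M x h (trans (rank-unfold M _) (trans e (sym (rank-unfold M A))))) (rank-unfold M B))

    ∪-right-comm : ∀ (A B C : Subset m) → (A ∪ B) ∪ C ≡ (A ∪ C) ∪ B
    ∪-right-comm A B C = ≼-antisym (sub B C) (sub C B)
      where
      sub : ∀ B C → (A ∪ B) ∪ C ≼ (A ∪ C) ∪ B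
      sub B C z h with ∈∪⁻ {A = A ∪ B} {C} h
      ... | inj₂ p = ∈∪⁺ˡ {A = A ∪ C} {B} (∈∪⁺ʳ {A = A} {C} p)
      ... | inj₁ p with ∈∪⁻ {A = A} {B} p
      ... | inj₁ q = ∈∪⁺ˡ {A = A ∪ C} {B} (∈∪⁺ˡ {A = A} {C} q)
      ... | inj₂ q = ∈∪⁺ʳ {A = A ∪ C} {B} q

    rank-∅ : rank M ∅ˢ ≡ 0
    rank-∅ = ℕ.n≤0⇒n≡0 (rank-least M ∅ˢ 0 λ B b → ℕ.≤-trans (card-mono {A = ∅ˢ ∩ B} {∅ˢ} (λ z h → proj₁ (∈∩⁻ {A = ∅ˢ} {B} h))) (ℕ.≤-reflexive (card-∅ {m})))

    rank-≤ : ∀ A → rank M A ℕ.≤ m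
    rank-≤ A = rank-least M A m λ B _ → ∣p∣≤n (A ∩ B)

    -- β of the minor M|F′/F up to sign.
    factor : Subset m → Subset m → ℤ
    factor F F′ = ΣS (λ A → ⟦ A ⊆ᵇ (F′ ∖ F) ⟧ * (sgn ∣ A ∣ * + rank M (A ∪ F)))

    module Minor (F F′ : Subset m) where

      ρ : Subset m → ℕ
      ρ A = rk M (A ∪ F) ∸ rk M F

      F≼ : ∀ A → F ≼ A ∪ F
      F≼ A z = ∈∪⁺ʳ {A = A} {F}

      ρ-mono : ∀ A B → A ≼ B → ρ A ℕ.≤ ρ B
      ρ-mono A B h = ℕ.∸-monoˡ-≤ (rk M F) (rk-mono {A ∪ F} {B ∪ F} (∪-mono {A = A} {B} {F} {F} h (λ _ p → p)))

      ρ-closure : ∀ A B x → A ≼ B → ρ (A ∪ ⁅ x ⁆) ≡ ρ A → ρ (B ∪ ⁅ x ⁆) ≡ ρ B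
      ρ-closure A B x h e = cong (_∸ rk M F) (trans (cong (rk M) (∪-right-comm B ⁅ x ⁆ F))
        (rk-closure {A ∪ F} {B ∪ F} x (∪-mono {A = A} {B} {F} {F} h (λ _ p → p)) (trans (cong (rk M) (∪-right-comm A F ⁅ x ⁆))
          (ℕ.∸-cancelʳ-≡ (rk-mono {F} {(A ∪ ⁅ x ⁆) ∪ F} (F≼ (A ∪ ⁅ x ⁆))) (rk-mono {F} {A ∪ F} (F≼ A)) e))))

      ρ-∅ : ρ ∅ˢ ≡ 0
      ρ-∅ = trans (cong (λ A → rk M A ∸ rk M F) (∪-identityˡ F)) (ℕ.n∸n≡0 (rk M F))

      -- The subtracted rank of `F` is the same for every A, and the signs of the subsets of a
      -- nonempty set sum to zero; `x` witnesses that the ground set of the minor is nonempty. What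
      -- remains is linear in the ranks of `M`.
      signedRank≡factor : ∀ x → x ∈ˢ F′ → x ∉ˢ F → signedRank (F′ ∖ F) ρ ρ-mono ρ-closure ρ-∅ ≡ factor F F′
      signedRank≡factor x p q = trans (ΣS-cong term)
        (trans (ΣS-+ (λ A → ⟦ A ⊆ᵇ (F′ ∖ F) ⟧ * (sgn ∣ A ∣ * + rank M (A ∪ F))) (λ A → - + rk M F * (⟦ A ⊆ᵇ (F′ ∖ F) ⟧ * sgn ∣ A ∣)))
          (trans (cong (_+_ (factor F F′)) (trans (ΣS-* (- + rk M F) (λ A → ⟦ A ⊆ᵇ (F′ ∖ F) ⟧ * sgn ∣ A ∣))
              (trans (cong (_*_ (- + rk M F)) (signed-subsets (F′ ∖ F) x (∈∖⁺ {A = F′} {F} p q))) (*-zeroʳ (- + rk M F)))))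
            (+-identityʳ (factor F F′))))
        where
        term : ∀ A → ⟦ A ⊆ᵇ (F′ ∖ F) ⟧ * (sgn ∣ A ∣ * + ρ A) ≡ ⟦ A ⊆ᵇ (F′ ∖ F) ⟧ * (sgn ∣ A ∣ * + rank M (A ∪ F)) + - + rk M F * (⟦ A ⊆ᵇ (F′ ∖ F) ⟧ * sgn ∣ A ∣)
        term A = trans (cong (λ r → ⟦ A ⊆ᵇ (F′ ∖ F) ⟧ * (sgn ∣ A ∣ * r)) (trans (pos-∸ (rk-mono {F} {A ∪ F} (F≼ A))) (cong (λ r → + r + - + rk M F) (sym (rank-unfold M (A ∪ F))))))
          (solve 4 (λ b s r f → b :* (s :* (r :+ (:- f))) := b :* (s :* r) :+ (:- f) :* (b :* s)) refl ⟦ A ⊆ᵇ (F′ ∖ F) ⟧ (sgn ∣ A ∣) (+ rank M (A ∪ F)) (+ rk M F))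

      β-factor : ∀ x → F ≼ F′ → x ∈ˢ F′ → x ∉ˢ F → β (minor M F′ F) ≡ sgn (rank M F′ ∸ rank M F) * factor F F′
      β-factor x h p q = trans (β-formula (F′ ∖ F) ρ ρ-mono ρ-closure ρ-∅)
        (cong₂ (λ r z → sgn r * z) (trans (cong (λ A → rk M A ∸ rk M F) rejoin) (sym (cong₂ _∸_ (rank-unfold M F′) (rank-unfold M F)))) (signedRank≡factor x p q))
        where
        rejoin : (F′ ∖ F) ∪ F ≡ F′
        rejoin = ≼-antisym to from
          where
          to : (F′ ∖ F) ∪ F ≼ F′
          to z k with ∈∪⁻ {A = F′ ∖ F} {F} k
          ... | inj₁ u = proj₁ (∈∖⁻ {A = F′} {F} u)
          ... | inj₂ u = h z u
          from : F′ ≼ (F′ ∖ F) ∪ F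
          from z k with bool? (mem z F)
          ... | inj₁ u = ∈∪⁺ʳ {A = F′ ∖ F} {F} u
          ... | inj₂ u = ∈∪⁺ˡ {A = F′ ∖ F} {F} (∈∖⁺ {A = F′} {F} k u)

      factor-loop : ∀ x → x ∈ˢ F′ → x ∉ˢ F → rank M (F ∪ ⁅ x ⁆) ≡ rank M F → factor F F′ ≡ 0ℤ
      factor-loop x p q e = trans (sym (signedRank≡factor x p q)) (signedRank-loop (F′ ∖ F) ρ ρ-mono ρ-closure ρ-∅ x (∈∖⁺ {A = F′} {F} p q)
        (trans (cong (_∸ rk M F) (trans (cong (rk M) swap-∪) (trans (sym (rank-unfold M (F ∪ ⁅ x ⁆))) (trans e (rank-unfold M F))))) (ℕ.n∸n≡0 (rk M F))))
        where
        swap-∪ : ⁅ x ⁆ ∪ F ≡ F ∪ ⁅ x ⁆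
        swap-∪ = ∪-comm ⁅ x ⁆ F

    open Minor using (β-factor; factor-loop)

    chainProduct : List (Subset m) → ℤ
    chainProduct []           = 1ℤ
    chainProduct (F ∷ [])     = 1ℤ
    chainProduct (F ∷ G ∷ Fs) = factor F G * chainProduct (G ∷ Fs)

    rank-last : ∀ F Fs → strict (F ∷ Fs) ≡ true → rank M F ℕ.≤ rank M (lastOf F Fs)
    rank-last F []       s = ℕ.≤-refl
    rank-last F (G ∷ Fs) s = let s₁ , s₂ = ∧-elim {F ⊊ᵇ G} s in ℕ.≤-trans (rank-mono M (proj₁ (⊊ᵇ⁻ F G s₁))) (rank-last G Fs s₂)

    -- The sign exponents are the rank differences along the chain and telescope to the difference
    -- between its ends.
    β-product : ∀ F Fs → strict (F ∷ Fs) ≡ true →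
      prodℤ (map (λ p → β (minor M (proj₂ p) (proj₁ p))) (consecPairs (F ∷ Fs))) ≡ sgn (rank M (lastOf F Fs) ∸ rank M F) * chainProduct (F ∷ Fs)
    β-product F []       s = sym (cong (λ r → sgn r * 1ℤ) (ℕ.n∸n≡0 (rank M F)))
    β-product F (G ∷ Fs) s =
      let s₁ , s₂ = ∧-elim {F ⊊ᵇ G} s
          sub , x , p , q = ⊊ᵇ⁻ F G s₁
      in trans (cong₂ _*_ (β-factor F G x sub p q) (β-product G Fs s₂))
           (trans (solve 4 (λ a b c d → (a :* b) :* (c :* d) := (a :* c) :* (b :* d)) refl
                    (sgn (rank M G ∸ rank M F)) (factor F G) (sgn (rank M (lastOf G Fs) ∸ rank M G)) (chainProduct (G ∷ Fs)))
             (cong (_* (factor F G * chainProduct (G ∷ Fs))) (trans (sym (sgn-+ (rank M G ∸ rank M F) (rank M (lastOf G Fs) ∸ rank M G)))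
               (cong sgn (telescope (rank-mono M sub) (rank-last G Fs s₂))))))
      where
      telescope : ∀ {a b c} → a ℕ.≤ b → b ℕ.≤ c → (b ∸ a) ℕ.+ (c ∸ b) ≡ c ∸ a
      telescope {a} {b} {c} h k = trans (ℕ.+-comm (b ∸ a) (c ∸ b)) (trans (sym (ℕ.+-∸-assoc (c ∸ b) h)) (cong (_∸ a) (ℕ.m∸n+n≡m k)))

    -- A point of the closure of F outside F is a loop of the minor of the
    -- step at which it enters the chain.
    closed-at-head : ∀ F Fs x → strict (F ∷ Fs) ≡ true → x ∉ˢ F → x ∈ˢ lastOf F Fs → rank M (F ∪ ⁅ x ⁆) ≡ rank M F → chainProduct (F ∷ Fs) ≡ 0ℤ
    closed-at-head F []       x s q p e = true≢false p q
    closed-at-head F (G ∷ Fs) x s q p e with bool? (mem x G)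
    ... | inj₁ r = trans (cong (_* chainProduct (G ∷ Fs)) (factor-loop F G x r q e)) (*-zeroˡ (chainProduct (G ∷ Fs)))
    ... | inj₂ r = let s₁ , s₂ = ∧-elim {F ⊊ᵇ G} s in
      trans (cong (factor F G *_) (closed-at-head G Fs x s₂ r p (rank-closure M x (proj₁ (⊊ᵇ⁻ F G s₁)) e))) (*-zeroʳ (factor F G))

    closed-inside : ∀ F Fs G x → strict (F ∷ Fs) ≡ true → G ∈ Fs → x ∉ˢ G → x ∈ˢ lastOf F Fs → rank M (G ∪ ⁅ x ⁆) ≡ rank M G → chainProduct (F ∷ Fs) ≡ 0ℤ
    closed-inside F (G ∷ Fs) H x s h∈ q p e = trans (cong (factor F G *_) (rest h∈)) (*-zeroʳ (factor F G))
      where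
      s₂ = proj₂ (∧-elim {F ⊊ᵇ G} s)
      rest : H ∈ (G ∷ Fs) → chainProduct (G ∷ Fs) ≡ 0ℤ
      rest (here refl) = closed-at-head G Fs x s₂ q p e
      rest (there h∈′) = closed-inside G Fs H x s₂ h∈′ q p e

    nonflat : ∀ G → isFlatᵇ (asRankData M) G ≡ false → ∃ λ x → x ∉ˢ G × rank M (G ∪ ⁅ x ⁆) ≡ rank M G
    nonflat G h = let x , _ , e = all-false (λ x → not (mem x Eˢ ∧ not (mem x G)) ∨ (rk M G ℕ.<ᵇ rk M (G ∪ ⁅ x ⁆))) (allFin m)
                                   (second (⊆ᵇ⁺ G Eˢ (λ x _ → ∈E x)) h)
                      u , v = failing e
      in x , not-false (proj₂ (∧-elim {mem x Eˢ} u)) ,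
         ℕ.≤-antisym (subst₂ ℕ._≤_ (sym (rank-unfold M (G ∪ ⁅ x ⁆))) (sym (rank-unfold M G)) (ℕ.≮⇒≥ λ l → true≢false (<ᵇ⁺ l) v)) (rank-mono M (λ z → ∈∪⁺ˡ {A = G}))
      where
      second : ∀ {a b} → a ≡ true → a ∧ b ≡ false → b ≡ false
      second refl h = h
      failing : ∀ {a b} → not a ∨ b ≡ false → a ≡ true × b ≡ false
      failing {true} {false} h = refl , refl

    csm-not-strict : ∀ k (c : Vec (Subset m) k) → strict (fullChain c) ≡ false → csm k M c ≡ 0ℤ
    csm-not-strict k c h = none (loopyᵇ (asRankData M)) (cong (_∧ all (isFlatᵇ (asRankData M)) (V.toList c)) h)
      where
      none : ∀ l {f} {z : ℤ} → f ≡ false → (if l then 0ℤ else if f then z else 0ℤ) ≡ 0ℤ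
      none true  e    = refl
      none false refl = refl

    -- One formula for all branches of `csm`. A loop of `M` is a point in the closure of the empty
    -- first set, a member of the chain that is not a flat misses a point of its closure, and either
    -- makes the product vanish. The signs in front depend on the rank and on `k` only.
    csm-strict : ∀ k (c : Vec (Subset m) k) → strict (fullChain c) ≡ true →
      csm k M c ≡ sgn ((rank M Eˢ ∸ 1) ℕ.+ k) * (sgn (rank M Eˢ) * chainProduct (fullChain c))
    csm-strict k c h = cases (loopyᵇ (asRankData M)) (all (isFlatᵇ (asRankData M)) (V.toList c)) refl refl
      where
      Fs = V.toList c ++ (Eˢ ∷ [])
      last≡E : lastOf ∅ˢ Fs ≡ Eˢ
      last≡E = lastOf-++ ∅ˢ (V.toList c) Eˢ
      in-last : ∀ x → x ∈ˢ lastOf ∅ˢ Fs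
      in-last x = subst (x ∈ˢ_) (sym last≡E) (∈E x)
      vanish : chainProduct (fullChain c) ≡ 0ℤ → 0ℤ ≡ sgn ((rank M Eˢ ∸ 1) ℕ.+ k) * (sgn (rank M Eˢ) * chainProduct (fullChain c))
      vanish e = sym (trans (cong (λ z → sgn ((rank M Eˢ ∸ 1) ℕ.+ k) * (sgn (rank M Eˢ) * z)) e)
        (solve 2 (λ a b → a :* (b :* con 0ℤ) := con 0ℤ) refl (sgn ((rank M Eˢ ∸ 1) ℕ.+ k)) (sgn (rank M Eˢ))))
      βs = prodℤ (map (λ p → β (minor M (proj₂ p) (proj₁ p))) (consecPairs (fullChain c)))
      cases : ∀ l f → loopyᵇ (asRankData M) ≡ l → all (isFlatᵇ (asRankData M)) (V.toList c) ≡ f →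
        (if l then 0ℤ else if strict (fullChain c) ∧ f then sgn ((rk M Eˢ ∸ 1) ℕ.+ k) * βs else 0ℤ)
        ≡ sgn ((rank M Eˢ ∸ 1) ℕ.+ k) * (sgn (rank M Eˢ) * chainProduct (fullChain c))
      cases true f el ef = let x , e = any-true (λ x → mem x Eˢ ∧ (rk M ⁅ x ⁆ ℕ.≡ᵇ 0)) (allFin m) el
                               loop = ≡ᵇ-true (rk M ⁅ x ⁆) 0 (proj₂ (∧-elim {mem x Eˢ} e))
        in vanish (closed-at-head ∅ˢ Fs x h (∉∅ x) (in-last x) (trans (cong (rank M) (∪-identityˡ ⁅ x ⁆)) (trans (rank-unfold M ⁅ x ⁆) (trans loop (sym rank-∅)))))
      cases false true el ef = trans (cong (λ b → if b ∧ true then sgn ((rk M Eˢ ∸ 1) ℕ.+ k) * βs else 0ℤ) h)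
        (cong₂ (λ r z → sgn ((r ∸ 1) ℕ.+ k) * z) (sym (rank-unfold M Eˢ)) (trans (β-product ∅ˢ Fs h)
          (cong (λ r → sgn r * chainProduct (fullChain c)) (cong₂ _∸_ (cong (rank M) last≡E) rank-∅))))
      cases false false el ef = trans (cong (λ b → if b ∧ false then sgn ((rk M Eˢ ∸ 1) ℕ.+ k) * βs else 0ℤ) h)
        (let G , G∈ , f = all-false (isFlatᵇ (asRankData M)) (V.toList c) ef
             x , q , e = nonflat G f
         in vanish (closed-inside ∅ˢ Fs G x h (∈-++⁺ˡ G∈) q (in-last x) e))

    rank-E : ∀ {B} → IsBasis M B → rank M Eˢ ≡ ∣ B ∣
    rank-E {B} b = ℕ.≤-antisym (rank-least M Eˢ ∣ B ∣ λ C c → ℕ.≤-trans (card-mono {A = Eˢ ∩ C} {C} (λ z h → proj₂ (∈∩⁻ {A = Eˢ} {C} h))) (ℕ.≤-reflexive (basis-card M c b)))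
      (ℕ.≤-trans (card-mono {A = B} {Eˢ ∩ B} (λ z h → ∈∩⁺ {A = Eˢ} {B} (∈E z) h)) (rank-ub M Eˢ b))

  ΣF-ΣS : ∀ r {m} (f : Fin r → Subset m → ℤ) → ΣF r (λ i → ΣS (f i)) ≡ ΣS (λ A → ΣF r (λ i → f i A))
  ΣF-ΣS zero {m} f = sym (ΣS-0 {m} (λ A → 0ℤ) (λ A → refl))
  ΣF-ΣS (suc r) f = trans (cong (_+_ (ΣS (f zero))) (ΣF-ΣS r (λ i → f (suc i)))) (sym (ΣS-+ (f zero) (λ A → ΣF r (λ i → f (suc i) A))))

  ΣF-swap : ∀ r s (f : Fin r → Fin s → ℤ) → ΣF r (λ i → ΣF s (f i)) ≡ ΣF s (λ j → ΣF r (λ i → f i j))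
  ΣF-swap zero    s f = sym (ΣF-0 s (λ j → 0ℤ) (λ j → refl))
  ΣF-swap (suc r) s f = trans (cong (_+_ (ΣF s (f zero))) (ΣF-swap r s (λ i → f (suc i)))) (sym (ΣF-+ s (f zero) (λ j → ΣF r (λ i → f (suc i) j))))

  count-below : ∀ {m r} → r ℕ.≤ m → + r ≡ ΣF m (λ j → ⟦ toℕ j ℕ.<ᵇ r ⟧)
  count-below {m} {zero} h = sym (ΣF-0 m (λ _ → 0ℤ) (λ j → refl))
  count-below {suc m} {suc r} (ℕ.s≤s h) = cong (_+_ 1ℤ) (count-below h)

  module _ {m : ℕ} (M : Matroid m) {r : ℕ} (face : Fin r → Matroid m) (s : Fin r → ℤ) where

    -- Faces and signs enter as arbitrary data, so the closure properties below are pure linearity: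
    -- sums and coefficients may be pulled through when they do not depend on the matroid.
    Valuative : (Matroid m → ℤ) → Set
    Valuative f = f M ≡ ΣF r (λ i → s i * f (face i))

    valuative-cong : ∀ {f g : Matroid m → ℤ} → (∀ N → f N ≡ g N) → Valuative g → Valuative f
    valuative-cong h v = trans (h M) (trans v (ΣF-cong r λ i → cong (s i *_) (sym (h (face i)))))

    valuative-0 : Valuative (λ _ → 0ℤ)
    valuative-0 = sym (ΣF-0 r _ λ i → *-zeroʳ (s i))

    valuative-* : ∀ c (f : Matroid m → ℤ) → Valuative f → Valuative (λ N → c * f N)
    valuative-* c f v = trans (cong (c *_) v) (trans (sym (ΣF-* r c (λ i → s i * f (face i))))
      (ΣF-cong r λ i → solve 3 (λ c s f → c :* (s :* f) := s :* (c :* f)) refl c (s i) (f (face i))))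

    valuative-ΣS : ∀ {n} {f : Subset n → Matroid m → ℤ} → (∀ A → Valuative (f A)) → Valuative (λ N → ΣS (λ A → f A N))
    valuative-ΣS {f = f} v = trans (ΣS-cong v) (trans (sym (ΣF-ΣS r (λ i A → s i * f A (face i)))) (ΣF-cong r λ i → ΣS-* (s i) (λ A → f A (face i))))

    valuative-ΣF : ∀ n {f : Fin n → Matroid m → ℤ} → (∀ j → Valuative (f j)) → Valuative (λ N → ΣF n (λ j → f j N))
    valuative-ΣF n {f} v = trans (ΣF-cong n v) (trans (ΣF-swap n r (λ j i → s i * f j (face i))) (ΣF-cong r λ i → ΣF-* n (s i) (λ j → f j (face i))))

    module _ (χ-valuative : ∀ acc → (∀ N → Descending N (map proj₁ acc)) → Valuative (λ N → χ N acc)) where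

      χ-∷ : ∀ (N : Matroid m) A a acc → χ N ((A , a) ∷ acc) ≡ ⟦ a ℕ.<ᵇ rank N A ⟧ * χ N acc
      χ-∷ N A a acc with a ℕ.<ᵇ rank N A
      ... | true  = sym (*-identityˡ (χ N acc))
      ... | false = sym (*-zeroˡ (χ N acc))

      -- The leading factor is a signed sum of ranks, and each rank counts the levels j below it.
      -- The indicator of such a level is absorbed into `χ` as a new head of `acc`.
      expand : ∀ N F G acc z → χ N acc * (factor N F G * z) ≡
        ΣS (λ A → ⟦ A ⊆ᵇ (G ∖ F) ⟧ * (sgn ∣ A ∣ * ΣF m (λ j → χ N ((A ∪ F , toℕ j) ∷ acc) * z)))
      expand N F G acc z = trans (solve 3 (λ c f z → c :* (f :* z) := (c :* z) :* f) refl (χ N acc) (factor N F G) z)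
        (trans (sym (ΣS-* (χ N acc * z) (λ A → ⟦ A ⊆ᵇ (G ∖ F) ⟧ * (sgn ∣ A ∣ * + rank N (A ∪ F))))) (ΣS-cong λ A →
          trans (solve 5 (λ c z b t r → (c :* z) :* (b :* (t :* r)) := b :* (t :* ((c :* z) :* r))) refl (χ N acc) z ⟦ A ⊆ᵇ (G ∖ F) ⟧ (sgn ∣ A ∣) (+ rank N (A ∪ F)))
            (cong (λ v → ⟦ A ⊆ᵇ (G ∖ F) ⟧ * (sgn ∣ A ∣ * v)) (trans (cong (χ N acc * z *_) (count-below (rank-≤ N (A ∪ F))))
              (trans (sym (ΣF-* m (χ N acc * z) (λ j → ⟦ toℕ j ℕ.<ᵇ rank N (A ∪ F) ⟧))) (ΣF-cong m λ j →
                trans (solve 3 (λ c z b → (c :* z) :* b := (b :* c) :* z) refl (χ N acc) z ⟦ toℕ j ℕ.<ᵇ rank N (A ∪ F) ⟧)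
                  (cong (_* z) (sym (χ-∷ N (A ∪ F) (toℕ j) acc)))))))))

      -- `acc` collects the sets chosen at earlier steps, all inside `F`. The new set A ∪ F contains
      -- them and lies in `G`, so the list stays descending; when the chain is used up, only `χ` is
      -- left.
      chainProduct-valuative : ∀ Fs F acc → strict (F ∷ Fs) ≡ true → All (_≼ F) (map proj₁ acc) → (∀ N → Descending N (map proj₁ acc)) →
        Valuative (λ N → χ N acc * chainProduct N (F ∷ Fs))
      chainProduct-valuative []       F acc st below desc = valuative-cong (λ N → *-identityʳ (χ N acc)) (χ-valuative acc desc)
      chainProduct-valuative (G ∷ Fs) F acc st below desc =
        valuative-cong (λ N → expand N F G acc (chainProduct N (G ∷ Fs))) (valuative-ΣS term)
        where
        F≼G : F ≼ G
        F≼G = proj₁ (⊊ᵇ⁻ F G (proj₁ (∧-elim {F ⊊ᵇ G} st)))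
        term : ∀ A → Valuative (λ N → ⟦ A ⊆ᵇ (G ∖ F) ⟧ * (sgn ∣ A ∣ * ΣF m (λ j → χ N ((A ∪ F , toℕ j) ∷ acc) * chainProduct N (G ∷ Fs))))
        -- The next step requires A ∪ F inside `G`, which holds for the subsets A that are counted;
        -- the others have coefficient zero.
        term A with bool? (A ⊆ᵇ (G ∖ F))
        ... | inj₂ e = valuative-cong (λ N → ⟦⟧-false (v N) e) valuative-0
          where
          v : Matroid m → ℤ
          v N = sgn ∣ A ∣ * ΣF m (λ j → χ N ((A ∪ F , toℕ j) ∷ acc) * chainProduct N (G ∷ Fs))
        ... | inj₁ e = valuative-* ⟦ A ⊆ᵇ (G ∖ F) ⟧ (λ N → sgn ∣ A ∣ * u N) (valuative-* (sgn ∣ A ∣) u (valuative-ΣF m λ j →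
            chainProduct-valuative Fs G ((A ∪ F , toℕ j) ∷ acc) (proj₂ (∧-elim {F ⊊ᵇ G} st))
              (A∪F≼G ∷ All.map (λ {B} h z p → F≼G z (h z p)) below)
              (λ N → All.map (λ {B} h z p → ∈∪⁺ʳ {A = A} {F} (h z p)) below , desc N)))
          where
          u : Matroid m → ℤ
          u N = ΣF m (λ j → χ N ((A ∪ F , toℕ j) ∷ acc) * chainProduct N (G ∷ Fs))
          A∪F≼G : A ∪ F ≼ G
          A∪F≼G z k with ∈∪⁻ {A = A} {F} k
          ... | inj₁ p = proj₁ (∈∖⁻ {A = G} {F} (⊆ᵇ⁻ A (G ∖ F) e z p))
          ... | inj₂ p = F≼G z p

  sum-lookup : ∀ {A : Set} (f : A → ℤ) xs → sumℤ (map f xs) ≡ ΣF (length xs) (λ i → f (L.lookup xs i))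
  sum-lookup f []       = refl
  sum-lookup f (x ∷ xs) = cong (_+_ (f x)) (sum-lookup f xs)

-- The weights of `csm` over a matroid subdivision.

module ChernClasses where

  open import Data.Integer using (ℤ; _*_)
  open import Data.Integer.Properties using (*-identityˡ)
  open Euler using (ΣF-cong)
  open Subsets
  open Matroids
  open Valuations
  open ChainWeights

  module _ {m : ℕ} (M : Matroid m) (S : List (Matroid m)) (subdivides : IsMatroidSubdivision M S)
    {dQ : ℕ} (dimM : IsDim (basesOf M) dQ) (Ls : List (Matroid m × ℕ)) (enum : EnumeratesInt M S Ls) where

    open Subdivision M S subdivides

    N : Fin (length Ls) → Matroid m
    N = face dimM Ls enum

    sign : Fin (length Ls) → ℤ
    sign i = sgn (dQ ∸ dimension dimM Ls enum i)

    -- Any basis of an interior face is a basis of `M`. The signs in `csm-strict` therefore agree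
    -- for all faces and can be pulled out of the sum.
    same-rank : ∀ i → rank (N i) Eˢ ≡ rank M Eˢ
    same-rank i = let B , b = nonempty (N i) in
      trans (rank-E (N i) b) (sym (rank-E M (face⊆M (N i) (faceOfCell (N i) (interior dimM Ls enum i)) B b)))

    csm-valuative : ∀ k (c : Vec (Subset m) k) → Valuative M N sign (λ P → csm k P c)
    csm-valuative k c = by-strictness (bool? (strict (fullChain c)))
      where
      by-strictness : (strict (fullChain c) ≡ true) ⊎ (strict (fullChain c) ≡ false) → Valuative M N sign (λ P → csm k P c)
      -- Strictness is a property of the chain alone, so here `M` and all faces have weight zero.
      by-strictness (inj₂ h) = trans (csm-not-strict M k c h)
        (trans (valuative-0 M N sign) (ΣF-cong (length Ls) λ i → cong (sign i *_) (sym (csm-not-strict (N i) k c h))))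
      by-strictness (inj₁ h) = trans (csm-strict M k c h)
        (trans (valuative-* M N sign a (λ P → b * product P) (valuative-* M N sign b product product-valuative))
          (ΣF-cong (length Ls) λ i → cong (sign i *_) (sym (trans (csm-strict (N i) k c h) (cong (λ r → sgn ((r ∸ 1) ℕ.+ k) * (sgn r * product (N i))) (same-rank i))))))
        where
        a = sgn ((rank M Eˢ ∸ 1) ℕ.+ k)
        b = sgn (rank M Eˢ)
        product : Matroid m → ℤ
        product P = chainProduct P (fullChain c)
        product-valuative : Valuative M N sign product
        -- With no level chosen yet, `χ` is 1 and the product may be multiplied by it to start the
        -- induction.
        product-valuative = valuative-cong M N sign (λ P → sym (*-identityˡ (product P)))
          (chainProduct-valuative M N sign (χ-valuative dimM Ls enum) (V.toList c ++ (Eˢ ∷ [])) ∅ˢ [] h [] (λ _ → tt))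

open import Data.Nat using (ℕ; suc; _∸_)
open import Data.Integer using (ℤ; _*_)
open import Data.Vec using (Vec)
open import Data.List using (List; map)
open import Data.Fin.Subset using (Subset)
open import Data.Product using (_×_; _,_; proj₁; proj₂)
open import Relation.Binary.PropositionalEquality using (_≡_; trans; sym)

theorem4p5 : (n k : ℕ) (M : Matroid (suc n)) (S : List (Matroid (suc n))) →
    IsMatroidSubdivision M S →
    (dQ : ℕ) → IsDim (basesOf M) dQ →
    (Ls : List (Matroid (suc n) × ℕ)) → EnumeratesInt M S Ls →
    (c : Vec (Subset (suc n)) k) →
    csm k M c ≡ sumℤ (map (λ q → sgn (dQ ∸ proj₂ q) * csm k (proj₁ q) c) Ls)
theorem4p5 n k M S subdivides dQ dimM Ls enum c =
  trans (ChernClasses.csm-valuative M S subdivides dimM Ls enum k c)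
        (sym (ChainWeights.sum-lookup (λ q → sgn (dQ ∸ proj₂ q) * csm k (proj₁ q) c) Ls))
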